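{- Let $k \leq n$ be positive integers. The Hilbert series of the graded vector space $R_{n,k}$ is the generating function for $\mathrm{coinv}$ on $\mathcal{OP}_{n,k}$: $$\mathrm{Hilb}(R_{n,k};q) = \sum_{\sigma \in \mathcal{OP}_{n,k}} q^{\mathrm{coinv}(\sigma)} = \mathrm{rev}_q\left([k]!_q \cdot \mathrm{Stir}_q(n,k)\right).$$ In particular, $\dim(R_{n,k}) = |\mathcal{OP}_{n,k}| = k! \cdot \mathrm{Stir}(n,k)$.
   Context: For positive integers $k \le n$, $I_{n,k} \subseteq \mathbb{Q}[x_1,\dots,x_n]$ is the ideal $\langle x_1^k, \dots, x_n^k, e_n, e_{n-1}, \dots, e_{n-k+1}\rangle$, where $e_d = e_d(x_1,\dots,x_n)$ is the elementary symmetric polynomial of degree $d$, and $R_{n,k} := \mathbb{Q}[x_1,\dots,x_n]/I_{n,k}$, graded by degree. $\mathrm{Hilb}(V;q) = \sum_{d\ge 0} \dim(V_d) q^d$. $\mathcal{OP}_{n,k}$ is the set of ordered set partitions $\sigma = (B_1 \mid \cdots \mid B_k)$ of $[n]=\{1,\dots,n\}$ into $k$ nonempty blocks. An inversion of $\sigma$ is a pair of letters $i<j$ such that $i$ is the minimum of its block $B_m$, $j \in B_\ell$, and $\ell < m$; $\mathrm{inv}(\sigma)$ is the number of inversions, and $\mathrm{coinv}(\sigma) := (n-k)(k-1) + \binom{k}{2} - \mathrm{inv}(\sigma)$. $[k]_q = 1+q+\cdots+q^{k-1}$ and $[k]!_q = [k]_q[k-1]_q\cdots[1]_q$. $\mathrm{Stir}(n,k)$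 is the Stirling number of the second kind. The $q$-Stirling numbers are defined by $\mathrm{Stir}_q(n,k) = \mathrm{Stir}_q(n-1,k-1) + [k]_q\,\mathrm{Stir}_q(n-1,k)$, with $\mathrm{Stir}_q(1,1) = 1$, $\mathrm{Stir}_q(1,k) = 0$ for $k>1$, and $\mathrm{Stir}_q(n,0)=0$ for $n \geq 1$. For $f = a_d q^d + \cdots + a_0$ with $a_d \neq 0$, $\mathrm{rev}_q(f) = a_0 q^d + a_1 q^{d-1} + \cdots + a_d$. -}

module Defs where

open import Algebra.Module.Bundles using (LeftModule)
open import Data.Fin as Fin using (Fin; zero; suc)
import Data.Fin.Properties as Fin
open import Data.Fin.Subset using (Subset; inside; outside; _∈_; Nonempty; ∣_∣)
open import Data.Fin.Subset.Properties using (_∈?_; nonempty?)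
open import Data.List as List using (List; []; _∷_; _++_)
open import Data.Nat as ℕ using (ℕ; zero; suc)
open import Data.Nat.Combinatorics using (_C_)
import Data.Nat.Properties as ℕ
open import Data.Product using (Σ; ∃; _×_; _,_)
open import Data.Rational as ℚ using (ℚ; 0ℚ; 1ℚ)
import Data.Rational.Properties as ℚ
open import Data.Rational.Solver using (module +-*-Solver)
open import Data.Vec as Vec using (Vec; []; _∷_)
import Data.Vec.Properties as Vec
open import Data.Vec.Functional using (Vector)
open import Data.Bool using (true; false; if_then_else_)
open import Level using (Level; 0ℓ)
open import Relation.Binary.PropositionalEquality
  using (_≡_; _≢_; refl; sym; trans; cong; cong₂)
open import Relation.Nullary using (Dec; does)
open import Relation.Nullary.Decidable using (_×-dec_; _→-dec_)
open import Relation.Unary using (Pred)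

ℚ-VectorSpace : Set₁
ℚ-VectorSpace = LeftModule ℚ.+-*-ring 0ℓ 0ℓ

module _ (V : ℚ-VectorSpace) where
  open LeftModule V
  open import Algebra.Definitions.RawMonoid +ᴹ-rawMonoid using (sum)

  linearCombination : ∀ {r} → Vector ℚ r → Vector Carrierᴹ r → Carrierᴹ
  linearCombination c b = sum (λ i → c i *ₗ b i)

  record IsBasisOf {r} (W : Pred Carrierᴹ 0ℓ) (b : Vector Carrierᴹ r) : Set where
    field
      contained   : ∀ i → W (b i)
      independent : ∀ c → linearCombination c b ≈ᴹ 0ᴹ → ∀ i → c i ≡ 0ℚ
      spanning    : ∀ v → W v → ∃ λ c → v ≈ᴹ linearCombination c b

  -- Dimension is a relation, since a basis cannot be computed from an
  -- arbitrary predicate W.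
  HasDimension : Pred Carrierᴹ 0ℓ → ℕ → Set
  HasDimension W r = Σ (Vector Carrierᴹ r) (IsBasisOf W)

-- The list a₀ ∷ a₁ ∷ … stands for a₀ + a₁ q + ….
ℕ[q] : Set
ℕ[q] = List ℕ

coeffq : ℕ[q] → ℕ → ℕ
coeffq []      d       = 0
coeffq (a ∷ f) zero    = a
coeffq (a ∷ f) (suc d) = coeffq f d

infix 4 _≈q_
_≈q_ : ℕ[q] → ℕ[q] → Set
f ≈q g = ∀ d → coeffq f d ≡ coeffq g d

infixl 6 _+q_
_+q_ : ℕ[q] → ℕ[q] → ℕ[q]
[]      +q g       = g
(a ∷ f) +q []      = a ∷ f
(a ∷ f) +q (b ∷ g) = (a ℕ.+ b) ∷ (f +q g)

infixl 7 _*q_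
_*q_ : ℕ[q] → ℕ[q] → ℕ[q]
[]      *q g = []
(a ∷ f) *q g = List.map (a ℕ.*_) g +q (0 ∷ (f *q g))

q^_ : ℕ → ℕ[q]
q^ d = List.replicate d 0 ++ (1 ∷ [])

sumq : List ℕ[q] → ℕ[q]
sumq = List.foldr _+q_ []

-- In f = a₀ ∷ … ∷ a_d ∷ 0 ∷ … ∷ 0 with a_d ≢ 0 the trailing zeros are not
-- part of the polynomial, so they are discarded after the reversal.
revq : ℕ[q] → ℕ[q]
revq f = List.dropWhile (ℕ._≟ 0) (List.reverse f)

[_]q : ℕ → ℕ[q]
[ k ]q = List.replicate k 1

[_]!q : ℕ → ℕ[q]
[ zero  ]!q = 1 ∷ []
[ suc k ]!q = [ suc k ]q *q [ k ]!q

-- The value at n = 0 is a dummy: the recursion is anchored at n = 1.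
Stirq : ℕ → ℕ → ℕ[q]
Stirq zero          k             = []
Stirq (suc n)       zero          = []
Stirq (suc zero)    (suc zero)    = 1 ∷ []
Stirq (suc zero)    (suc (suc k)) = []
Stirq (suc (suc n)) (suc k)       =
  Stirq (suc n) k +q [ suc k ]q *q Stirq (suc n) (suc k)

-- Vd d is the homogeneous component of V of degree d.
IsHilbertSeries : (V : ℚ-VectorSpace) → (ℕ → Pred (LeftModule.Carrierᴹ V) 0ℓ) →
                  ℕ[q] → Set
IsHilbertSeries V Vd f = ∀ d → HasDimension V (Vd d) (coeffq f d)

private variable
  a : Level
  A : Set a

vectors : ∀ k → List A → List (Vec A k)
vectors zero    xs = [] ∷ []
vectors (suc k) xs = List.cartesianProductWith _∷_ xs (vectors k xs)

-- The k-element sublists of xs, that is, the k-element subsets of a set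
-- listed without repetition by xs.
combinations : ∀ k → List A → List (Vec A k)
combinations zero    xs       = [] ∷ []
combinations (suc k) []       = []
combinations (suc k) (x ∷ xs) =
  List.map (x ∷_) (combinations k xs) ++ combinations (suc k) xs

subsets : ∀ n → List (Subset n)
subsets n = vectors n (outside ∷ inside ∷ [])

-- The letters 1 < … < n are the elements of Fin n.
Blocks : ℕ → ℕ → Set
Blocks n k = Vec (Subset n) k

module _ {n k : ℕ} (B : Blocks n k) where

  infix 4 _∈B_ _∈B?_
  _∈B_ : Fin n → Fin k → Set
  i ∈B m = i ∈ Vec.lookup B m

  _∈B?_ : ∀ i m → Dec (i ∈B m)
  i ∈B? m = i ∈? Vec.lookup B m

  IsPartition : Set
  IsPartition = (∀ m → Nonempty (Vec.lookup B m))
              × (∀ i → ∃ λ m → i ∈B m × (∀ ℓ → i ∈B ℓ → ℓ ≡ m))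

  isPartition? : Dec IsPartition
  isPartition? =
    Fin.all? (λ m → nonempty? (Vec.lookup B m)) ×-dec
    Fin.all? (λ i → Fin.any? λ m → (i ∈B? m) ×-dec
      Fin.all? (λ ℓ → (i ∈B? ℓ) →-dec (ℓ Fin.≟ m)))

  IsMinimum : Fin n → Fin k → Set
  IsMinimum i m = i ∈B m × (∀ j → j ∈B m → i Fin.≤ j)

  IsInversion : Fin n × Fin n → Set
  IsInversion (i , j) =
    i Fin.< j × ∃ λ m → IsMinimum i m × ∃ λ ℓ → j ∈B ℓ × ℓ Fin.< m

  isInversion? : ∀ p → Dec (IsInversion p)
  isInversion? (i , j) =
    (i Fin.<? j) ×-dec Fin.any? λ m →
      ((i ∈B? m) ×-dec Fin.all? (λ j → (j ∈B? m) →-dec (i Fin.≤? j))) ×-dec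
      Fin.any? (λ ℓ → (j ∈B? ℓ) ×-dec (ℓ Fin.<? m))

  inv : ℕ
  inv = List.length
    (List.filter isInversion? (List.cartesianProduct (List.allFin n) (List.allFin n)))

  -- Truncated subtraction is exact here: if B is a partition, a letter that
  -- is not a minimum is the larger one in at most k - 1 inversions, and two
  -- minima form at most one inversion.
  coinv : ℕ
  coinv = (n ℕ.∸ k) ℕ.* (k ℕ.∸ 1) ℕ.+ (k C 2) ℕ.∸ inv

OP : ∀ n k → List (Blocks n k)
OP n k = List.filter isPartition? (vectors k (subsets n))

-- An unordered set partition is a set of k subsets of [n], hence a
-- combination of k entries of the list of all subsets.
Stir : ℕ → ℕ → ℕ
Stir n k = List.length (List.filter isPartition? (combinations k (subsets n)))

coinvSeries : ℕ → ℕ → ℕ[q]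
coinvSeries n k = sumq (List.map (λ σ → q^ coinv σ) (OP n k))

Monomial : ℕ → Set
Monomial n = Vec ℕ n

_≟ᴹ_ : ∀ {n} (μ ν : Monomial n) → Dec (μ ≡ ν)
_≟ᴹ_ = Vec.≡-dec ℕ._≟_

-- Formal sums of terms c · x^μ. Equality is equality of all coefficients;
-- a list may contain a monomial repeatedly or with coefficient 0.
Poly : ℕ → Set
Poly n = List (ℚ × Monomial n)

module _ {n : ℕ} where

  coeff : Poly n → Monomial n → ℚ
  coeff []            ν = 0ℚ
  coeff ((c , μ) ∷ p) ν = (if does (μ ≟ᴹ ν) then c else 0ℚ) ℚ.+ coeff p ν

  infix 4 _≈ᴾ_
  _≈ᴾ_ : Poly n → Poly n → Set
  p ≈ᴾ q = ∀ ν → coeff p ν ≡ coeff q ν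

  infixl 6 _+ᴾ_
  _+ᴾ_ : Poly n → Poly n → Poly n
  _+ᴾ_ = _++_

  infixl 7 _*ᴾ_
  _*ᴾ_ : Poly n → Poly n → Poly n
  _*ᴾ_ = List.cartesianProductWith
    λ (c , μ) (d , ν) → c ℚ.* d , Vec.zipWith ℕ._+_ μ ν

  constant : ℚ → Poly n
  constant c = (c , Vec.replicate n 0) ∷ []

  infixr 8 _·_
  _·_ : ℚ → Poly n → Poly n
  c · p = List.map (λ (d , μ) → c ℚ.* d , μ) p

  infix 8 -ᴾ_
  -ᴾ_ : Poly n → Poly n
  -ᴾ p = (ℚ.- 1ℚ) · p

  infixr 9 _^ᴾ_
  _^ᴾ_ : Poly n → ℕ → Poly n
  p ^ᴾ zero  = constant 1ℚ
  p ^ᴾ suc m = p *ᴾ p ^ᴾ m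

  x : Fin n → Poly n
  x i = (1ℚ , Vec.replicate n 0 Vec.[ i ]≔ 1) ∷ []

  Homogeneous : ℕ → Pred (Poly n) 0ℓ
  Homogeneous d p = ∀ μ → coeff p μ ≢ 0ℚ → Vec.sum μ ≡ d

  data Ideal (G : Pred (Poly n) 0ℓ) : Pred (Poly n) 0ℓ where
    generator : ∀ {p} → G p → Ideal G p
    0∈        : Ideal G []
    +-closed  : ∀ {p q} → Ideal G p → Ideal G q → Ideal G (p +ᴾ q)
    *-closed  : ∀ p {q} → Ideal G q → Ideal G (p *ᴾ q)
    resp-≈    : ∀ {p q} → p ≈ᴾ q → Ideal G p → Ideal G q

-- The term of a subset S is ∏_{i ∈ S} xᵢ.
elementary : ∀ n → ℕ → Poly n
elementary n d = List.map (λ S → 1ℚ , Vec.map (λ s → if s then 1 else 0) S)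
                          (List.filter (λ S → ∣ S ∣ ℕ.≟ d) (subsets n))

module _ {n : ℕ} where

  coeff-+ : ∀ (p q : Poly n) ν → coeff (p +ᴾ q) ν ≡ coeff p ν ℚ.+ coeff q ν
  coeff-+ []      q ν = sym (ℚ.+-identityˡ _)
  coeff-+ ((c , μ) ∷ p) q ν = trans (cong (t ℚ.+_) (coeff-+ p q ν))
                                    (sym (ℚ.+-assoc t (coeff p ν) (coeff q ν)))
    where t = if does (μ ≟ᴹ ν) then c else 0ℚ

  coeff-· : ∀ c (p : Poly n) ν → coeff (c · p) ν ≡ c ℚ.* coeff p ν
  coeff-· c []            ν = sym (ℚ.*-zeroʳ c)
  coeff-· c ((d , μ) ∷ p) ν = trans (cong₂ ℚ._+_ head (coeff-· c p ν))
                                    (sym (ℚ.*-distribˡ-+ c _ _))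
    where
    head : (if does (μ ≟ᴹ ν) then c ℚ.* d else 0ℚ)
         ≡ c ℚ.* (if does (μ ≟ᴹ ν) then d else 0ℚ)
    head with does (μ ≟ᴹ ν)
    ... | true  = refl
    ... | false = sym (ℚ.*-zeroʳ c)

  constant-* : ∀ c (p : Poly n) → constant c *ᴾ p ≡ c · p
  constant-* c []            = refl
  constant-* c ((d , μ) ∷ p) =
    cong₂ (λ ν r → (c ℚ.* d , ν) ∷ r) (Vec.zipWith-identityˡ ℕ.+-identityˡ μ)
          (constant-* c p)

module _ {n : ℕ} (G : Pred (Poly n) 0ℓ) where

  infix 4 _∼_
  -- A record, so that p and q can be inferred from the type.
  record _∼_ (p q : Poly n) : Set where
    constructor mod
    field difference : Ideal G (p +ᴾ -ᴾ q)

  private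
    open +-*-Solver using (solve; con; _:+_; _:*_; :-_; _:=_)

    coeff-- : ∀ (p : Poly n) q ν →
              coeff (p +ᴾ -ᴾ q) ν ≡ coeff p ν ℚ.+ ℚ.- 1ℚ ℚ.* coeff q ν
    coeff-- p q ν = trans (coeff-+ p (-ᴾ q) ν) (cong (coeff p ν ℚ.+_) (coeff-· (ℚ.- 1ℚ) q ν))

    ·-closed : ∀ c {p} → Ideal G p → Ideal G (c · p)
    ·-closed c {p} I rewrite sym (constant-* c p) = *-closed (constant c) I

    ≈⇒∼ : ∀ {p q} → p ≈ᴾ q → p ∼ q
    ≈⇒∼ {p} {q} e = mod (resp-≈
      (λ ν → sym (trans (coeff-- p q ν) (trans (cong (ℚ._+ (ℚ.- 1ℚ ℚ.* coeff q ν)) (e ν))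
        (solve 1 (λ a → a :+ (:- con 1ℚ) :* a := con 0ℚ) refl (coeff q ν)))))
      0∈)

    ∼-sym : ∀ {p q} → p ∼ q → q ∼ p
    ∼-sym {p} {q} (mod I) = mod (resp-≈
      (λ ν → trans (coeff-· (ℚ.- 1ℚ) (p +ᴾ -ᴾ q) ν)
        (trans (cong (ℚ.- 1ℚ ℚ.*_) (coeff-- p q ν))
        (trans (solve 2 (λ a b → (:- con 1ℚ) :* (a :+ (:- con 1ℚ) :* b)
                              := b :+ (:- con 1ℚ) :* a) refl (coeff p ν) (coeff q ν))
        (sym (coeff-- q p ν)))))
      (·-closed (ℚ.- 1ℚ) I))

    ∼-trans : ∀ {p q r} → p ∼ q → q ∼ r → p ∼ r
    ∼-trans {p} {q} {r} (mod I) (mod J) = mod (resp-≈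
      (λ ν → trans (coeff-+ (p +ᴾ -ᴾ q) (q +ᴾ -ᴾ r) ν)
        (trans (cong₂ ℚ._+_ (coeff-- p q ν) (coeff-- q r ν))
        (trans (solve 3 (λ a b c → (a :+ (:- con 1ℚ) :* b) :+ (b :+ (:- con 1ℚ) :* c)
                              := a :+ (:- con 1ℚ) :* c) refl
                      (coeff p ν) (coeff q ν) (coeff r ν))
        (sym (coeff-- p r ν)))))
      (+-closed I J))

    +-cong : ∀ {p p′ q q′} → p ∼ p′ → q ∼ q′ → p +ᴾ q ∼ p′ +ᴾ q′
    +-cong {p} {p′} {q} {q′} (mod I) (mod J) = mod (resp-≈
      (λ ν → trans (coeff-+ (p +ᴾ -ᴾ p′) (q +ᴾ -ᴾ q′) ν)
        (trans (cong₂ ℚ._+_ (coeff-- p p′ ν) (coeff-- q q′ ν))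
        (trans (solve 4 (λ a b c d → (a :+ (:- con 1ℚ) :* b) :+ (c :+ (:- con 1ℚ) :* d)
                              := (a :+ c) :+ (:- con 1ℚ) :* (b :+ d)) refl
                      (coeff p ν) (coeff p′ ν) (coeff q ν) (coeff q′ ν))
        (sym (trans (coeff-- (p +ᴾ q) (p′ +ᴾ q′) ν)
          (cong₂ (λ a b → a ℚ.+ ℚ.- 1ℚ ℚ.* b) (coeff-+ p q ν) (coeff-+ p′ q′ ν)))))))
      (+-closed I J))

    ·-congʳ : ∀ c {p q} → p ∼ q → c · p ∼ c · q
    ·-congʳ c {p} {q} (mod I) = mod (resp-≈
      (λ ν → trans (coeff-· c (p +ᴾ -ᴾ q) ν)
        (trans (cong (c ℚ.*_) (coeff-- p q ν))
        (trans (solve 3 (λ c a b → c :* (a :+ (:- con 1ℚ) :* b)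
                              := c :* a :+ (:- con 1ℚ) :* (c :* b)) refl
                      c (coeff p ν) (coeff q ν))
        (sym (trans (coeff-- (c · p) (c · q) ν)
          (cong₂ (λ a b → a ℚ.+ ℚ.- 1ℚ ℚ.* b) (coeff-· c p ν) (coeff-· c q ν)))))))
      (·-closed c I))

    +-comm : ∀ p q → p +ᴾ q ∼ q +ᴾ p
    +-comm p q = ≈⇒∼ λ ν → trans (coeff-+ p q ν)
      (trans (ℚ.+-comm (coeff p ν) (coeff q ν)) (sym (coeff-+ q p ν)))

    +-identityʳ : ∀ p → p +ᴾ [] ∼ p
    +-identityʳ p = ≈⇒∼ λ ν → trans (coeff-+ p [] ν) (ℚ.+-identityʳ _)

    -‿inverseʳ : ∀ p → p +ᴾ -ᴾ p ∼ []
    -‿inverseʳ p = ≈⇒∼ λ ν → trans (coeff-- p p ν)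
      (solve 1 (λ a → a :+ (:- con 1ℚ) :* a := con 0ℚ) refl (coeff p ν))

    ·-cong : ∀ {c d p q} → c ≡ d → p ∼ q → c · p ∼ d · q
    ·-cong {c} refl = ·-congʳ c

    ·-zeroˡ : ∀ p → 0ℚ · p ∼ []
    ·-zeroˡ p = ≈⇒∼ λ ν → trans (coeff-· 0ℚ p ν) (ℚ.*-zeroˡ (coeff p ν))

    ·-distribʳ : ∀ p c d → (c ℚ.+ d) · p ∼ c · p +ᴾ d · p
    ·-distribʳ p c d = ≈⇒∼ λ ν → trans (coeff-· (c ℚ.+ d) p ν)
      (trans (ℚ.*-distribʳ-+ (coeff p ν) c d)
      (sym (trans (coeff-+ (c · p) (d · p) ν)
                  (cong₂ ℚ._+_ (coeff-· c p ν) (coeff-· d p ν)))))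

    ·-identityˡ : ∀ p → 1ℚ · p ∼ p
    ·-identityˡ p = ≈⇒∼ λ ν → trans (coeff-· 1ℚ p ν) (ℚ.*-identityˡ (coeff p ν))

    ·-assoc : ∀ c d p → (c ℚ.* d) · p ∼ c · d · p
    ·-assoc c d p = ≈⇒∼ λ ν → trans (coeff-· (c ℚ.* d) p ν)
      (trans (ℚ.*-assoc c d (coeff p ν))
      (sym (trans (coeff-· c (d · p) ν) (cong (c ℚ.*_) (coeff-· d p ν)))))

    ·-distribˡ : ∀ c p q → c · (p +ᴾ q) ∼ c · p +ᴾ c · q
    ·-distribˡ c p q = ≈⇒∼ λ ν → trans (coeff-· c (p +ᴾ q) ν)
      (trans (cong (c ℚ.*_) (coeff-+ p q ν))
      (trans (ℚ.*-distribˡ-+ c (coeff p ν) (coeff q ν))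
      (sym (trans (coeff-+ (c · p) (c · q) ν)
                  (cong₂ ℚ._+_ (coeff-· c p ν) (coeff-· c q ν))))))

    +-assoc : ∀ p q r → p +ᴾ q +ᴾ r ∼ p +ᴾ (q +ᴾ r)
    +-assoc p q r = ≈⇒∼ λ ν → trans (coeff-+ (p +ᴾ q) r ν)
      (trans (cong (ℚ._+ coeff r ν) (coeff-+ p q ν))
      (trans (ℚ.+-assoc (coeff p ν) (coeff q ν) (coeff r ν))
      (sym (trans (coeff-+ p (q +ᴾ r) ν) (cong (coeff p ν ℚ.+_) (coeff-+ q r ν))))))

  quotient : ℚ-VectorSpace
  quotient = record
    { Carrierᴹ = Poly n
    ; _≈ᴹ_     = _∼_
    ; _+ᴹ_     = _+ᴾ_
    ; _*ₗ_     = _·_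
    ; 0ᴹ       = []
    ; -ᴹ_      = -ᴾ_
    ; isLeftModule = record
      { isLeftSemimodule = record
        { +ᴹ-isCommutativeMonoid = record
          { isMonoid = record
            { isSemigroup = record
              { isMagma = record
                { isEquivalence = record
                  { refl  = ≈⇒∼ λ _ → refl
                  ; sym   = ∼-sym
                  ; trans = ∼-trans
                  }
                ; ∙-cong = +-cong
                }
              ; assoc = +-assoc
              }
            ; identity = (λ p → ≈⇒∼ λ _ → refl) , +-identityʳ
            }
          ; comm = +-comm
          }
        ; isPreleftSemimodule = record
          { *ₗ-cong      = ·-cong
          ; *ₗ-zeroˡ     = ·-zeroˡ
          ; *ₗ-distribʳ  = ·-distribʳ
          ; *ₗ-identityˡ = ·-identityˡ
          ; *ₗ-assoc     = ·-assoc
          ; *ₗ-zeroʳ     = λ _ → ≈⇒∼ λ _ → refl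
          ; *ₗ-distribˡ  = ·-distribˡ
          }
        }
      ; -ᴹ‿cong    = ·-congʳ (ℚ.- 1ℚ)
      ; -ᴹ‿inverse = (λ p → ∼-trans (+-comm (-ᴾ p) p) (-‿inverseʳ p)) , -‿inverseʳ
      }
    }

  -- The classes of the homogeneous polynomials of degree d.
  component : ℕ → Pred (Poly n) 0ℓ
  component d p = ∃ λ h → Homogeneous d h × h ∼ p

data Generator (n k : ℕ) : Pred (Poly n) 0ℓ where
  power : ∀ i → Generator n k (x i ^ᴾ k)
  elem  : ∀ d → n ℕ.∸ k ℕ.+ 1 ℕ.≤ d → d ℕ.≤ n → Generator n k (elementary n d)

R : ∀ n k → ℚ-VectorSpace
R n k = quotient (Generator n k)

R-component : ∀ n k → ℕ → Pred (LeftModule.Carrierᴹ (R n k)) 0ℓ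
R-component n k = component (Generator n k)

{-# OPTIONS --safe #-}
-- Fix k and let I(n,s) be generated by the xᵢ^k and the e_d with d > n - s, so
-- that I(n,k) is the ideal of R n k. Filtering by the powers x₁^i and using
-- e_d(x₁,…,xₙ) = e_d(x₂,…,xₙ) + x₁ e_{d-1}(x₂,…,xₙ), one sees that the quotient
-- by I(n,s) is spanned by the monomials x₁^i μ with μ from the spanning set of
-- I(n-1,s-1) if i < s and from that of I(n-1,s) if s ≤ i < k.
--
-- These monomials are independent as functions on the points of {α₁,…,α_k}^n
-- whose coordinates include s prescribed values, by Vandermonde arguments in the
-- first coordinate. The generators of I(n,s) are leading forms of polynomials
-- vanishing on these points, namely of ∏ⱼ (xᵢ - αⱼ) and of the coefficients of
-- ∏ (1 + xᵢ t) / ∏ (1 + α t). Since lower terms can be rewritten in the spanning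
-- set without raising the degree, independence passes to the quotient.
--
-- An ordered set partition is a surjective word. Removing the largest letter
-- gives a recursion for the joint distribution of inv and coinv over words with
-- a given image. For coinv it agrees with the degree recursion of the basis, and
-- for inv with that of [k]!_q Stir_q(n,k). Polynomials in q are compared through
-- their values at all natural numbers.
module Submission where

open import Defs
open import Algebra.Bundles using (CommutativeRing)
open import Algebra.Module.Bundles using (LeftModule)
open import Data.Bool as Bool using (Bool; true; false; if_then_else_; not; _∧_)
import Data.Bool.Properties as Bool
open import Data.Fin as Fin using (Fin; zero; suc; fromℕ; inject₁; opposite)
import Data.Fin.Properties as Fin
open import Data.Fin.Subset using (Subset; inside; outside; ⊥; ⊤; ∣_∣; Nonempty)
import Data.Fin.Subset.Properties as Subset
open import Data.Integer using () renaming (+_ to pos)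
open import Data.List as List using (List; []; _∷_; _++_; length)
open import Data.List.Membership.Propositional using (_∈_)
import Data.List.Membership.Propositional.Properties as ∈
open import Data.List.Membership.Propositional.Properties.WithK using (unique∧set⇒bag)
import Data.List.Properties as List
open import Data.List.Relation.Binary.BagAndSetEquality using (∼bag⇒↭)
open import Data.List.Relation.Binary.Permutation.Propositional as ↭ using (_↭_; ↭-sym)
open import Data.List.Relation.Binary.Permutation.Propositional.Properties
  using (∈-resp-↭; All-resp-↭; ↭-reverse)
open import Data.List.Relation.Unary.All as All using (All; []; _∷_)
import Data.List.Relation.Unary.All.Properties as All
open import Data.List.Relation.Unary.AllPairs using ([]; _∷_)
open import Data.List.Relation.Unary.Any as Any using (Any; here; there; _─_)
import Data.List.Relation.Unary.Any.Properties as Any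
open import Data.List.Relation.Unary.Unique.Propositional using (Unique)
import Data.List.Relation.Unary.Unique.Propositional.Properties as Unique
open import Data.Nat as ℕ using (ℕ; zero; suc; pred; _+_; _*_; _^_; _∸_; _≤_; _<_; z≤n; s≤s; _!)
open import Data.Nat.Combinatorics using (_C_; nC1≡n; nCk+nC[k+1]≡[n+1]C[k+1])
import Data.Nat.Coprimality as Coprime
import Data.Nat.DivMod as ℕ
import Data.Nat.Properties as ℕ
open import Data.Nat.Tactic.RingSolver using () renaming (solve-∀ to ℕ-solve-∀)
open import Data.Product using (∃; _×_; _,_; proj₁; proj₂)
open import Data.Rational as ℚ using (ℚ; 0ℚ; 1ℚ)
import Data.Rational.Properties as ℚ
open import Algebra.Properties.Semiring.Exp (CommutativeRing.semiring ℚ.+-*-commutativeRing)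
  using () renaming (_^_ to _^ℚ_; ^-homo-* to ^ℚ-homo-*)
open import Data.Sum using (inj₁; inj₂)
open import Data.Unit using (tt) renaming (⊤ to Unit)
open import Data.Vec as Vec using (Vec; []; _∷_)
open import Data.Vec.Functional using (Vector)
import Data.Vec.Properties as Vec
open import Function using (_⇔_; _∘_; mk⇔; Equivalence)
open import Level using (0ℓ)
open import Relation.Binary.PropositionalEquality
open import Relation.Nullary using (Dec; yes; no; ¬_; does; contradiction)
open import Relation.Nullary.Decidable using (dec⇒maybe; dec-true; dec-false; does-⇔; _×-dec_; _→-dec_)
open import Relation.Unary using (Pred; Decidable; U)
open import Tactic.RingSolver using (solve-∀)
open import Tactic.RingSolver.Core.AlmostCommutativeRing using (AlmostCommutativeRing; fromCommutativeRing)

-- The generators of the ideal do not vanish on the points; only perturbations of them by terms of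
-- lower degree do. Independence in the quotient can therefore not be read off from values directly,
-- and the argument has to descend through the degrees. If the prescribed values are all the α's,
-- the points are the words in which every value occurs, one for each ordered set partition, which
-- is where the dimension comes from.
--
-- The parameter s has to be separated from k: splitting off x₁ lowers the number of variables by
-- one, the bound n - s on the degrees of the elementary generators either stays or drops by one,
-- but the power k never changes.
--
-- The words are counted with two variables because the local factors for inv and coinv are
-- specialisations of one homogeneous bracket. The reversal then only expresses that inv + coinv is
-- constant. That this constant is the actual degree of the polynomial to be reversed comes from the
-- algebraic side: 1 is a basis monomial, so coinv takes the value 0.

private variable
  m n : ℕ
  A B E : Set

-- Polynomials as linear functionals

ℚ-ring : AlmostCommutativeRing 0ℓ 0ℓ
ℚ-ring = fromCommutativeRing ℚ.+-*-commutativeRing (λ x → dec⇒maybe (0ℚ ℚ.≟ x))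

-- The linear extension of φ from monomials to polynomials. Coefficients are the case φ = `δ ν` and
-- evaluations the case φ = `y ^^_`, so one lemma for each operation on lists of terms serves both.
lin : (Monomial n → ℚ) → Poly n → ℚ
lin φ []            = 0ℚ
lin φ ((c , μ) ∷ p) = c ℚ.* φ μ ℚ.+ lin φ p

lin-cong : ∀ {φ ψ : Monomial n → ℚ} → (∀ μ → φ μ ≡ ψ μ) → ∀ p → lin φ p ≡ lin ψ p
lin-cong e []            = refl
lin-cong e ((c , μ) ∷ p) = cong₂ (λ a b → c ℚ.* a ℚ.+ b) (e μ) (lin-cong e p)

lin-++ : ∀ (φ : Monomial n → ℚ) p q → lin φ (p ++ q) ≡ lin φ p ℚ.+ lin φ q
lin-++ φ []            q = sym (ℚ.+-identityˡ _)
lin-++ φ ((c , μ) ∷ p) q = trans (cong (c ℚ.* φ μ ℚ.+_) (lin-++ φ p q)) (sym (ℚ.+-assoc (c ℚ.* φ μ) _ _))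

lin-· : ∀ (φ : Monomial n → ℚ) c p → lin φ (c · p) ≡ c ℚ.* lin φ p
lin-· φ c []            = sym (ℚ.*-zeroʳ c)
lin-· φ c ((d , μ) ∷ p) = trans (cong (c ℚ.* d ℚ.* φ μ ℚ.+_) (lin-· φ c p)) (lemma c d (φ μ) (lin φ p))
  where
  lemma : ∀ c d a b → c ℚ.* d ℚ.* a ℚ.+ c ℚ.* b ≡ c ℚ.* (d ℚ.* a ℚ.+ b)
  lemma = solve-∀ ℚ-ring

lin-*ˡ : ∀ c φ (p : Poly n) → lin (λ μ → c ℚ.* φ μ) p ≡ c ℚ.* lin φ p
lin-*ˡ c φ []            = sym (ℚ.*-zeroʳ c)
lin-*ˡ c φ ((d , μ) ∷ p) = trans (cong (d ℚ.* (c ℚ.* φ μ) ℚ.+_) (lin-*ˡ c φ p)) (lemma c d (φ μ) (lin φ p))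
  where
  lemma : ∀ c d a b → d ℚ.* (c ℚ.* a) ℚ.+ c ℚ.* b ≡ c ℚ.* (d ℚ.* a ℚ.+ b)
  lemma = solve-∀ ℚ-ring

δ : Monomial n → Monomial n → ℚ
δ ν μ = if does (μ ≟ᴹ ν) then 1ℚ else 0ℚ

δ-≢ : ∀ (μ ν : Monomial n) → μ ≢ ν → δ ν μ ≡ 0ℚ
δ-≢ μ ν ne rewrite dec-false (μ ≟ᴹ ν) ne = refl

coeff≡lin : ∀ (p : Poly n) ν → coeff p ν ≡ lin (δ ν) p
coeff≡lin []            ν = refl
coeff≡lin ((c , μ) ∷ p) ν = cong₂ ℚ._+_ head (coeff≡lin p ν)
  where
  head : (if does (μ ≟ᴹ ν) then c else 0ℚ) ≡ c ℚ.* δ ν μ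
  head with μ ≟ᴹ ν
  ... | yes _ = sym (ℚ.*-identityʳ c)
  ... | no  _ = sym (ℚ.*-zeroʳ c)

lin⇒≈ : ∀ {p q : Poly n} → (∀ φ → lin φ p ≡ lin φ q) → p ≈ᴾ q
lin⇒≈ {p = p} {q} e ν = trans (coeff≡lin p ν) (trans (e (δ ν)) (sym (coeff≡lin q ν)))

remove : Monomial n → Poly n → Poly n
remove μ []            = []
remove μ ((c , ν) ∷ p) with ν ≟ᴹ μ
... | yes _ = remove μ p
... | no  _ = (c , ν) ∷ remove μ p

length-remove : ∀ (μ : Monomial n) p → List.length (remove μ p) ≤ List.length p
length-remove μ []            = z≤n
length-remove μ ((c , ν) ∷ p) with ν ≟ᴹ μ
... | yes _ = ℕ.m≤n⇒m≤1+n (length-remove μ p)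
... | no  _ = s≤s (length-remove μ p)

lin-remove : ∀ φ (μ : Monomial n) p → lin φ p ≡ coeff p μ ℚ.* φ μ ℚ.+ lin φ (remove μ p)
lin-remove φ μ []            = lemma (φ μ)
  where
  lemma : ∀ a → 0ℚ ≡ 0ℚ ℚ.* a ℚ.+ 0ℚ
  lemma = solve-∀ ℚ-ring
lin-remove φ μ ((c , ν) ∷ p) with ν ≟ᴹ μ
... | yes refl = trans (cong (c ℚ.* φ ν ℚ.+_) (lin-remove φ ν p))
    (lemma c (coeff p ν) (φ ν) (lin φ (remove ν p)))
  where
  lemma : ∀ c d a b → c ℚ.* a ℚ.+ (d ℚ.* a ℚ.+ b) ≡ (c ℚ.+ d) ℚ.* a ℚ.+ b
  lemma = solve-∀ ℚ-ring
... | no  _ = trans (cong (c ℚ.* φ ν ℚ.+_) (lin-remove φ μ p))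
                    (lemma (c ℚ.* φ ν) (coeff p μ) (φ μ) (lin φ (remove μ p)))
  where
  lemma : ∀ t d a b → t ℚ.+ (d ℚ.* a ℚ.+ b) ≡ (0ℚ ℚ.+ d) ℚ.* a ℚ.+ (t ℚ.+ b)
  lemma = solve-∀ ℚ-ring

-- All terms with the monomial of the head are removed at once. Their total coefficient is 0, so no
-- functional notices. As this may shorten the list by more than one term, `go` recurses on a bound
-- for its length.
lin-vanishing : ∀ φ (p : Poly n) → (∀ ν → coeff p ν ≡ 0ℚ) → lin φ p ≡ 0ℚ
lin-vanishing {n} φ p = go (List.length p) p ℕ.≤-refl
  where
  0*a+b : ∀ {c} a b → c ≡ 0ℚ → c ℚ.* a ℚ.+ b ≡ b
  0*a+b a b refl = trans (cong (ℚ._+ b) (ℚ.*-zeroˡ a)) (ℚ.+-identityˡ b)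

  go : ∀ l (p : Poly n) → List.length p ≤ l → (∀ ν → coeff p ν ≡ 0ℚ) → lin φ p ≡ 0ℚ
  go l       []              _         z = refl
  go (suc l) p@((c , μ) ∷ q) (s≤s q≤l) z =
    trans (lin-remove φ μ p)
    (trans (0*a+b (φ μ) _ (z μ))
    (go l (remove μ p) shorter
      λ ν → trans (coeff≡lin (remove μ p) ν)
           (trans (sym (0*a+b (δ ν μ) _ (z μ)))
           (trans (sym (lin-remove (δ ν) μ p))
           (trans (sym (coeff≡lin p ν)) (z ν))))))
    where
    shorter : List.length (remove μ p) ≤ l
    shorter with μ ≟ᴹ μ
    ... | yes _  = ℕ.≤-trans (length-remove μ q) q≤l
    ... | no  ne = contradiction refl ne

≈⇒lin : ∀ {p q : Poly n} → p ≈ᴾ q → ∀ φ → lin φ p ≡ lin φ q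
≈⇒lin {p = p} {q} e φ = trans (lemma (lin φ p) (lin φ q))
    (trans (cong (ℚ._+ lin φ q) difference) (ℚ.+-identityˡ _))
  where
  lemma : ∀ a b → a ≡ (a ℚ.+ ℚ.- 1ℚ ℚ.* b) ℚ.+ b
  lemma = solve-∀ ℚ-ring

  cancel : ∀ a → a ℚ.+ ℚ.- 1ℚ ℚ.* a ≡ 0ℚ
  cancel = solve-∀ ℚ-ring

  difference : lin φ p ℚ.+ ℚ.- 1ℚ ℚ.* lin φ q ≡ 0ℚ
  difference = trans (sym (trans (lin-++ φ p (-ᴾ q)) (cong (lin φ p ℚ.+_) (lin-· φ (ℚ.- 1ℚ) q))))
    (lin-vanishing φ (p +ᴾ -ᴾ q) λ ν → trans (coeff-+ p (-ᴾ q) ν)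
      (trans (cong₂ ℚ._+_ (e ν) (coeff-· (ℚ.- 1ℚ) q ν)) (cancel (coeff q ν))))

infixl 6 _∙_
_∙_ : Monomial n → Monomial n → Monomial n
_∙_ = Vec.zipWith ℕ._+_

lin-*-term : ∀ φ c (μ : Monomial n) q → lin φ (((c , μ) ∷ []) *ᴾ q) ≡ c ℚ.* lin (λ ν → φ (μ ∙ ν)) q
lin-*-term φ c μ []            = sym (ℚ.*-zeroʳ c)
lin-*-term φ c μ ((d , ν) ∷ q) = trans (cong (c ℚ.* d ℚ.* φ (μ ∙ ν) ℚ.+_) (lin-*-term φ c μ q))
  (lemma c d (φ (μ ∙ ν)) (lin (λ ν → φ (μ ∙ ν)) q))
  where
  lemma : ∀ c d a b → c ℚ.* d ℚ.* a ℚ.+ c ℚ.* b ≡ c ℚ.* (d ℚ.* a ℚ.+ b)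
  lemma = solve-∀ ℚ-ring

lin-*-∷ : ∀ φ t (p q : Poly n) → lin φ ((t ∷ p) *ᴾ q) ≡ lin φ ((t ∷ []) *ᴾ q) ℚ.+ lin φ (p *ᴾ q)
lin-*-∷ φ t p q = trans (lin-++ φ ts (p *ᴾ q))
  (cong (ℚ._+ lin φ (p *ᴾ q)) (sym (trans (lin-++ φ ts []) (ℚ.+-identityʳ (lin φ ts)))))
  where ts = List.map (λ (d , ν) → proj₁ t ℚ.* d , proj₂ t ∙ ν) q

-- A record, so that p and q can be inferred from the type.
infix 4 _≋_
record _≋_ (p q : Poly n) : Set where
  constructor mk≋
  field on : ∀ φ → lin φ p ≡ lin φ q
open _≋_ public

≈⇒≋ : ∀ {p q : Poly n} → p ≈ᴾ q → p ≋ q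
≈⇒≋ {p = p} {q} e = mk≋ (≈⇒lin {p = p} {q} e)

≋⇒≈ : ∀ {p q : Poly n} → p ≋ q → p ≈ᴾ q
≋⇒≈ {p = p} {q} e = lin⇒≈ {p = p} {q} (on e)

≋-sym : ∀ {p q : Poly n} → p ≋ q → q ≋ p
≋-sym e = mk≋ λ φ → sym (on e φ)

≋-trans : ∀ {p q r : Poly n} → p ≋ q → q ≋ r → p ≋ r
≋-trans e f = mk≋ λ φ → trans (on e φ) (on f φ)

resp-≋ : ∀ {G : Poly n → Set} {p q} → p ≋ q → Ideal G p → Ideal G q
resp-≋ e = resp-≈ (≋⇒≈ e)


-- Multiplication by a polynomial is reduced to multiplication by a term.
Ideal-induction : {G : Poly n → Set} (Φ : Poly n → Set) →
  (∀ {p} → G p → Φ p) →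
  Φ [] →
  (∀ {p q} → Φ p → Φ q → Φ (p +ᴾ q)) →
  (∀ c μ {q} → Φ q → Φ (((c , μ) ∷ []) *ᴾ q)) →
  (∀ {p q} → p ≋ q → Φ p → Φ q) →
  ∀ {p} → Ideal G p → Φ p
Ideal-induction Φ gen Φ0 plus term resp = go
  where
  times : ∀ p {q} → Φ q → Φ (p *ᴾ q)
  times []            h = Φ0
  times ((c , μ) ∷ p) {q} h = resp
    (mk≋ λ φ → trans (lin-++ φ (((c , μ) ∷ []) *ᴾ q) (p *ᴾ q)) (sym (lin-*-∷ φ (c , μ) p q)))
    (plus (term c μ h) (times p h))

  go : ∀ {p} → Ideal _ p → Φ p
  go (generator g)  = gen g
  go 0∈             = Φ0
  go (+-closed a b) = plus (go a) (go b)
  go (*-closed p a) = times p (go a)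
  go (resp-≈ e a)   = resp (≈⇒≋ e) (go a)

-- Spanning

cons : ℕ → Poly n → Poly (suc n)
cons i = List.map λ (c , μ) → c , i ∷ μ

lin-cons : ∀ φ i (p : Poly n) → lin φ (cons i p) ≡ lin (λ μ → φ (i ∷ μ)) p
lin-cons φ i []            = refl
lin-cons φ i ((c , μ) ∷ p) = cong (c ℚ.* φ (i ∷ μ) ℚ.+_) (lin-cons φ i p)

cons-≋ : ∀ i {p q : Poly n} → p ≋ q → cons i p ≋ cons i q
cons-≋ i {p} {q} e = mk≋ λ φ → trans (lin-cons φ i p) (trans (on e _) (sym (lin-cons φ i q)))

cons-term-* : ∀ i c (μ : Monomial n) q → cons i (((c , μ) ∷ []) *ᴾ q) ≋ ((c , 0 ∷ μ) ∷ []) *ᴾ cons i q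
cons-term-* i c μ q = mk≋ λ φ →
  trans (lin-cons φ i (((c , μ) ∷ []) *ᴾ q))
  (trans (lin-*-term (λ ν → φ (i ∷ ν)) c μ q)
  (sym (trans (lin-*-term φ c (0 ∷ μ) (cons i q))
    (cong (c ℚ.*_) (lin-cons (λ ν → φ ((0 ∷ μ) ∙ ν)) i q)))))

𝟘 : Monomial n
𝟘 = Vec.replicate _ 0

unit : Fin n → ℕ → Monomial n
unit i m = 𝟘 Vec.[ i ]≔ m

unit-0 : ∀ (i : Fin n) → unit i 0 ≡ 𝟘
unit-0 zero    = refl
unit-0 (suc i) = cong (0 ∷_) (unit-0 i)

𝟘-∙ : ∀ (μ : Monomial n) → 𝟘 ∙ μ ≡ μ
𝟘-∙ = Vec.zipWith-identityˡ ℕ.+-identityˡ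

∙-𝟘 : ∀ (μ : Monomial n) → μ ∙ 𝟘 ≡ μ
∙-𝟘 = Vec.zipWith-identityʳ ℕ.+-identityʳ

unit-suc : ∀ (i : Fin n) m → unit i 1 ∙ unit i m ≡ unit i (suc m)
unit-suc zero    m = cong (suc m ∷_) (𝟘-∙ 𝟘)
unit-suc (suc i) m = cong (0 ∷_) (unit-suc i m)

x^ᴾ : ∀ (i : Fin n) m → x i ^ᴾ m ≡ (1ℚ , unit i m) ∷ []
x^ᴾ i zero    = cong (λ μ → (1ℚ , μ) ∷ []) (sym (unit-0 i))
x^ᴾ i (suc m) rewrite x^ᴾ i m = cong (λ μ → (1ℚ , μ) ∷ []) (unit-suc i m)

-- The elementary polynomials and the first variable

private
  monomial : Subset n → Monomial n
  monomial = Vec.map (λ s → if s then 1 else 0)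

  ∑ₑ : ℕ → List (Subset n) → Poly n
  ∑ₑ d Ss = List.map (λ S → 1ℚ , monomial S) (List.filter (λ S → ∣ S ∣ ℕ.≟ d) Ss)

  ∑ₑ-++ : ∀ d (Ss Ts : List (Subset n)) → ∑ₑ d (Ss ++ Ts) ≡ ∑ₑ d Ss ++ ∑ₑ d Ts
  ∑ₑ-++ d []       Ts = refl
  ∑ₑ-++ d (S ∷ Ss) Ts with does (∣ S ∣ ℕ.≟ d)
  ... | true  = cong (_ ∷_) (∑ₑ-++ d Ss Ts)
  ... | false = ∑ₑ-++ d Ss Ts

  ∑ₑ-outside : ∀ d (Ss : List (Subset n)) → ∑ₑ d (List.map (outside ∷_) Ss) ≡ cons 0 (∑ₑ d Ss)
  ∑ₑ-outside d []       = refl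
  ∑ₑ-outside d (S ∷ Ss) with does (∣ S ∣ ℕ.≟ d)
  ... | true  = cong (_ ∷_) (∑ₑ-outside d Ss)
  ... | false = ∑ₑ-outside d Ss

  ∑ₑ-inside : ∀ d (Ss : List (Subset n)) → ∑ₑ (suc d) (List.map (inside ∷_) Ss) ≡ cons 1 (∑ₑ d Ss)
  ∑ₑ-inside d []       = refl
  ∑ₑ-inside d (S ∷ Ss) with does (∣ S ∣ ℕ.≟ d)
  ... | true  = cong (_ ∷_) (∑ₑ-inside d Ss)
  ... | false = ∑ₑ-inside d Ss

  ∑ₑ-inside-0 : ∀ (Ss : List (Subset n)) → ∑ₑ 0 (List.map (inside ∷_) Ss) ≡ []
  ∑ₑ-inside-0 []       = refl
  ∑ₑ-inside-0 (S ∷ Ss) = ∑ₑ-inside-0 Ss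

-- The elementary polynomial of degree d - 1, with the convention that it is 0 for d = 0. This keeps
-- `elementary-suc` free of a case distinction.
preElementary : ∀ n → ℕ → Poly n
preElementary n zero    = []
preElementary n (suc d) = elementary n d

elementary-suc : ∀ n d → elementary (suc n) d ≡ cons 0 (elementary n d) ++ cons 1 (preElementary n d)
elementary-suc n d = trans (∑ₑ-++ d (List.map (outside ∷_) (subsets n)) _)
  (cong₂ _++_ (∑ₑ-outside d (subsets n)) (trans (∑ₑ-++ d (List.map (inside ∷_) (subsets n)) [])
    (trans (++-[] _) (with-first d))))
  where
  ++-[] : ∀ (p : Poly (suc n)) → p ++ [] ≡ p
  ++-[] []      = refl
  ++-[] (t ∷ p) = cong (t ∷_) (++-[] p)

  with-first : ∀ d → ∑ₑ d (List.map (inside ∷_) (subsets n)) ≡ cons 1 (preElementary n d)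
  with-first zero    = ∑ₑ-inside-0 (subsets n)
  with-first (suc d) = ∑ₑ-inside d (subsets n)

elementary-> : ∀ n {d} → n < d → elementary n d ≡ []
elementary-> zero    {suc d} _         = refl
elementary-> (suc n) {suc d} (s≤s n<d) rewrite elementary-suc n (suc d)
  | elementary-> n (ℕ.m<n⇒m<1+n n<d) | elementary-> n n<d = refl

module _ (k : ℕ) where

  -- For s = k this is the ideal of R n k; removing a variable lowers s.
  data Gen (s : ℕ) : Poly n → Set where
    power : ∀ i → Gen s {n} (x i ^ᴾ k)
    elem  : ∀ d → n < d ℕ.+ s → Gen s (elementary n d)

  -- The exponent vectors of the monomial basis of the quotient by Gen s.
  data InB : ℕ → Monomial n → Set where
    []   : InB 0 []
    low  : ∀ {s i} {μ : Monomial n} → i ≤ s → InB s μ → InB (suc s) (i ∷ μ)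
    high : ∀ {s i} {μ : Monomial n} → s ≤ i → i < k → InB s μ → InB s (i ∷ μ)

  -- Inductive rather than "a combination of basis monomials plus an element of the ideal", so that
  -- `cons-spanned` can treat the summands of a reduction separately. The combination is extracted
  -- later by `spanned⇒basis`.
  data Spanned (s : ℕ) : Poly n → Set where
    basis : ∀ c {μ : Monomial n} → InB s μ → Spanned s ((c , μ) ∷ [])
    ideal : ∀ {p : Poly n} → Ideal (Gen s) p → Spanned s p
    sum   : ∀ {p q : Poly n} → Spanned s p → Spanned s q → Spanned s (p +ᴾ q)
    respects : ∀ {p q : Poly n} → p ≋ q → Spanned s p → Spanned s q

  private variable
    s : ℕ

  cons-≥ : ∀ {i} → k ≤ i → ∀ p → Ideal (Gen s) (cons {n} i p)
  cons-≥ k≤i []            = 0∈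
  cons-≥ {n = n} {i = i} k≤i ((c , μ) ∷ p) = +-closed {p = (c , i ∷ μ) ∷ []}
    (subst (Ideal (Gen _)) factor (*-closed ((c , i ℕ.∸ k ∷ μ) ∷ []) (generator (power zero))))
    (cons-≥ k≤i p)
    where
    factor : ((c , i ℕ.∸ k ∷ μ) ∷ []) *ᴾ (x zero ^ᴾ k) ≡ (c , i ∷ μ) ∷ []
    factor rewrite x^ᴾ {suc n} zero k = cong₂ (λ d ν → (d , ν) ∷ []) (ℚ.*-identityʳ c)
      (cong₂ _∷_ (ℕ.m∸n+n≡m k≤i) (∙-𝟘 μ))

  x₀^_ : ℕ → Poly (suc n)
  x₀^ i = (1ℚ , i ∷ 𝟘) ∷ []

  x₀^-* : ∀ i d → (x₀^ i) *ᴾ elementary (suc n) d ≋ cons i (elementary n d) +ᴾ cons (suc i)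
      (preElementary n d)
  x₀^-* {n} i d = mk≋ λ φ → begin
    lin φ ((x₀^ i) *ᴾ elementary (suc n) d)
      ≡⟨ lin-*-term φ 1ℚ (i ∷ 𝟘) (elementary (suc n) d) ⟩
    1ℚ ℚ.* lin (λ ν → φ ((i ∷ 𝟘) ∙ ν)) (elementary (suc n) d)
      ≡⟨ ℚ.*-identityˡ _ ⟩
    lin (λ ν → φ ((i ∷ 𝟘) ∙ ν)) (elementary (suc n) d)
      ≡⟨ cong (lin _) (elementary-suc n d) ⟩
    lin (λ ν → φ ((i ∷ 𝟘) ∙ ν)) (cons 0 (elementary n d) ++ cons 1 (preElementary n d))
      ≡⟨ lin-++ _ (cons 0 (elementary n d)) (cons 1 (preElementary n d)) ⟩
    lin (λ ν → φ ((i ∷ 𝟘) ∙ ν)) (cons 0 (elementary n d)) ℚ.+ lin (λ ν → φ ((i ∷ 𝟘) ∙ ν))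
        (cons 1 (preElementary n d))
      ≡⟨ cong₂ ℚ._+_ (shift φ 0 (ℕ.+-identityʳ i) (elementary n d))
          (shift φ 1 (ℕ.+-comm i 1) (preElementary n d)) ⟩
    lin φ (cons i (elementary n d)) ℚ.+ lin φ (cons (suc i) (preElementary n d))
      ≡⟨ sym (lin-++ φ (cons i (elementary n d)) (cons (suc i) (preElementary n d))) ⟩
    lin φ (cons i (elementary n d) +ᴾ cons (suc i) (preElementary n d)) ∎
    where
    open ≡-Reasoning
    shift : ∀ φ j {l} → i ℕ.+ j ≡ l → ∀ p → lin (λ ν → φ ((i ∷ 𝟘) ∙ ν)) (cons j p) ≡ lin φ (cons l p)
    shift φ j refl p = trans (lin-cons _ j p)
      (trans (lin-cong (λ μ → cong (λ ν → φ (i ℕ.+ j ∷ ν)) (𝟘-∙ μ)) p) (sym (lin-cons φ (i ℕ.+ j) p)))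

  ·-closed : ∀ {G : Poly n → Set} c {p} → Ideal G p → Ideal G (c · p)
  ·-closed c {p} I rewrite sym (constant-* c p) = *-closed (constant c) I

  private
    a≡[a+b]-b : ∀ a b → (a ℚ.+ b) ℚ.+ ℚ.- 1ℚ ℚ.* b ≡ a
    a≡[a+b]-b = solve-∀ ℚ-ring

    b≡[a+b]-a : ∀ a b → (a ℚ.+ b) ℚ.+ ℚ.- 1ℚ ℚ.* a ≡ b
    b≡[a+b]-a = solve-∀ ℚ-ring

  lin-- : ∀ φ (p q : Poly n) → lin φ (p +ᴾ -ᴾ q) ≡ lin φ p ℚ.+ ℚ.- 1ℚ ℚ.* lin φ q
  lin-- φ p q = trans (lin-++ φ p (-ᴾ q)) (cong (lin φ p ℚ.+_) (lin-· φ (ℚ.- 1ℚ) q))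

  -- Modulo the generators, x₀^(j+1) e_d and - x₀^j e_(d+1) agree, both taken in the remaining n
  -- variables. Exchanging every factor x₀ in this way raises the degree above n, where the
  -- elementary polynomial is 0.
  cons-elementary : ∀ j {d} → n < d ℕ.+ j → n < d ℕ.+ s → Ideal (Gen s) (cons j (elementary n d))
  cons-elementary {n} zero    {d} lt _ = subst (Ideal (Gen _))
    (cong (cons 0) (sym (elementary-> n (subst (n <_) (ℕ.+-identityʳ d) lt)))) 0∈
  cons-elementary {n} {s} (suc j) {d} lt lt′ = resp-≋
    (mk≋ λ φ → trans (lin-- φ ((x₀^ j) *ᴾ elementary (suc n) (suc d)) (cons j (elementary n (suc d))))
      (trans (cong (ℚ._+ ℚ.- 1ℚ ℚ.* lin φ (cons j (elementary n (suc d))))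
        (trans (on (x₀^-* j (suc d)) φ) (lin-++ φ (cons j (elementary n (suc d)))
            (cons (suc j) (elementary n d)))))
      (b≡[a+b]-a (lin φ (cons j (elementary n (suc d)))) (lin φ (cons (suc j) (elementary n d))))))
    (+-closed (*-closed (x₀^ j) (generator (elem (suc d) (s≤s lt′))))
      (·-closed (ℚ.- 1ℚ) (cons-elementary j {suc d} (subst (n <_) (ℕ.+-suc d j) lt) (ℕ.m<n⇒m<1+n lt′))))

  -- x₀^i q vanishes modulo the ideal and x₀^(i+1).
  Deferred : ℕ → ℕ → Poly n → Set
  Deferred s i q = ∃ λ r → ∃ λ t → Ideal (Gen s) r × cons i q ≋ r +ᴾ cons (suc i) t

  -- Only the elementary generators need a hypothesis: x₀^i xⱼ^k is a multiple of a generator in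
  -- either ideal, and multiplication by a term in the remaining variables commutes with `cons i`.
  ideal⇒deferred : ∀ s i s′ → (∀ {d} → n < d ℕ.+ s′ → Deferred s i (elementary n d)) →
    ∀ {p : Poly n} → Ideal (Gen s′) p → Deferred s i p
  ideal⇒deferred {n} s i s′ elems = Ideal-induction (Deferred s i) gen
      ([] , [] , 0∈ , mk≋ λ _ → refl) plus term
    λ e (r , t , I , eq) → r , t , I , ≋-trans (cons-≋ i (≋-sym e)) eq
    where
    gen : ∀ {p} → Gen s′ p → Deferred s i p
    gen (power j)   = cons i (x j ^ᴾ k) , [] , I , mk≋ λ φ → sym
        (trans (lin-++ φ (cons i (x j ^ᴾ k)) []) (ℚ.+-identityʳ _))
      where
      I : Ideal (Gen s) (cons i (x j ^ᴾ k))
      I = subst (Ideal (Gen s)) (trans (cong ((x₀^ i) *ᴾ_) (x^ᴾ (suc j) k))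
          (trans (cong (λ μ → (1ℚ , μ) ∷ []) (cong₂ _∷_ (ℕ.+-identityʳ i) (𝟘-∙ (unit j k))))
                 (cong (cons i) (sym (x^ᴾ j k)))))
        (*-closed (x₀^ i) (generator (power (suc j))))
    gen (elem d lt) = elems lt

    plus : ∀ {p q} → Deferred s i p → Deferred s i q → Deferred s i (p +ᴾ q)
    plus {p} {q} (r , t , I , e) (r′ , t′ , I′ , e′) = r +ᴾ r′ , t +ᴾ t′ , +-closed I I′ , mk≋ λ φ → begin
      lin φ (cons i (p +ᴾ q))
        ≡⟨ lin-cons φ i (p +ᴾ q) ⟩
      lin (λ μ → φ (i ∷ μ)) (p +ᴾ q)
        ≡⟨ lin-++ _ p q ⟩
      lin (λ μ → φ (i ∷ μ)) p ℚ.+ lin (λ μ → φ (i ∷ μ)) q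
        ≡⟨ cong₂ ℚ._+_ (trans (sym (lin-cons φ i p)) (trans (on e φ) (split φ r t)))
                       (trans (sym (lin-cons φ i q)) (trans (on e′ φ) (split φ r′ t′))) ⟩
      (lin φ r ℚ.+ lin (λ μ → φ (suc i ∷ μ)) t) ℚ.+ (lin φ r′ ℚ.+ lin (λ μ → φ (suc i ∷ μ)) t′)
        ≡⟨ exchange (lin φ r) _ (lin φ r′) _ ⟩
      (lin φ r ℚ.+ lin φ r′) ℚ.+ (lin (λ μ → φ (suc i ∷ μ)) t ℚ.+ lin (λ μ → φ (suc i ∷ μ)) t′)
        ≡⟨ sym (cong₂ ℚ._+_ (lin-++ φ r r′) (lin-++ _ t t′)) ⟩
      lin φ (r +ᴾ r′) ℚ.+ lin (λ μ → φ (suc i ∷ μ)) (t +ᴾ t′)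
        ≡⟨ sym (split φ (r +ᴾ r′) (t +ᴾ t′)) ⟩
      lin φ ((r +ᴾ r′) +ᴾ cons (suc i) (t +ᴾ t′)) ∎
      where
      open ≡-Reasoning
      split : ∀ φ r t → lin φ (r +ᴾ cons (suc i) t) ≡ lin φ r ℚ.+ lin (λ μ → φ (suc i ∷ μ)) t
      split φ r t = trans (lin-++ φ r (cons (suc i) t)) (cong (lin φ r ℚ.+_) (lin-cons φ (suc i) t))

      exchange : ∀ a b c d → (a ℚ.+ b) ℚ.+ (c ℚ.+ d) ≡ (a ℚ.+ c) ℚ.+ (b ℚ.+ d)
      exchange = solve-∀ ℚ-ring

    term : ∀ c μ {q} → Deferred s i q → Deferred s i (((c , μ) ∷ []) *ᴾ q)
    term c μ {q} (r , t , I , e) = τ *ᴾ r , σ *ᴾ t , *-closed τ I , mk≋ λ φ → begin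
      lin φ (cons i (σ *ᴾ q))
        ≡⟨ on (cons-term-* i c μ q) φ ⟩
      lin φ (τ *ᴾ cons i q)
        ≡⟨ lin-*-term φ c (0 ∷ μ) (cons i q) ⟩
      c ℚ.* lin (λ ν → φ ((0 ∷ μ) ∙ ν)) (cons i q)
        ≡⟨ cong (c ℚ.*_) (trans (on e _) (lin-++ _ r (cons (suc i) t))) ⟩
      c ℚ.* (lin (λ ν → φ ((0 ∷ μ) ∙ ν)) r ℚ.+ lin (λ ν → φ ((0 ∷ μ) ∙ ν)) (cons (suc i) t))
        ≡⟨ ℚ.*-distribˡ-+ c _ _ ⟩
      c ℚ.* lin (λ ν → φ ((0 ∷ μ) ∙ ν)) r ℚ.+ c ℚ.* lin (λ ν → φ ((0 ∷ μ) ∙ ν)) (cons (suc i) t)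
        ≡⟨ sym (cong₂ ℚ._+_ (lin-*-term φ c (0 ∷ μ) r)
             (trans (on (cons-term-* (suc i) c μ t) φ) (lin-*-term φ c (0 ∷ μ) (cons (suc i) t)))) ⟩
      lin φ (τ *ᴾ r) ℚ.+ lin φ (cons (suc i) (σ *ᴾ t))
        ≡⟨ sym (lin-++ φ (τ *ᴾ r) (cons (suc i) (σ *ᴾ t))) ⟩
      lin φ (τ *ᴾ r +ᴾ cons (suc i) (σ *ᴾ t)) ∎
      where
      open ≡-Reasoning
      σ = (c , μ) ∷ []
      τ = (c , 0 ∷ μ) ∷ []

  -- With one more variable and `suc s`, the same degree d is still admissible, and the two versions
  -- of e_d differ by a multiple of x₀.
  deferred-low : ∀ {s i d} → n < d ℕ.+ s → Deferred (suc s) i (elementary n d)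
  deferred-low {n} {s} {i} {d} lt =
    (x₀^ i) *ᴾ elementary (suc n) d , -ᴾ preElementary n d ,
    *-closed (x₀^ i) (generator (elem d (subst (suc n <_) (sym (ℕ.+-suc d s)) (s≤s lt)))) ,
    mk≋ λ φ → sym (trans (lin-++ φ ((x₀^ i) *ᴾ elementary (suc n) d) (cons (suc i) (-ᴾ preElementary n d)))
      (trans (cong₂ ℚ._+_ (trans (on (x₀^-* i d) φ) (lin-++ φ (cons i (elementary n d))
          (cons (suc i) (preElementary n d))))
        (trans (lin-cons φ (suc i) (-ᴾ preElementary n d))
        (trans (lin-· (λ μ → φ (suc i ∷ μ)) (ℚ.- 1ℚ) (preElementary n d))
               (cong (ℚ.- 1ℚ ℚ.*_) (sym (lin-cons φ (suc i) (preElementary n d)))))))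
      (a≡[a+b]-b (lin φ (cons i (elementary n d))) (lin φ (cons (suc i) (preElementary n d))))))

  -- Here s is kept, so the lowest admissible degree for n variables is too small for n + 1.
  -- Instead, x₀^i supplies enough factors for the exchanges of `cons-elementary`, and nothing is
  -- left to defer.
  deferred-high : ∀ {s i d} → s ≤ i → n < d ℕ.+ s → Deferred s i (elementary n d)
  deferred-high {n} {s} {i} {d} s≤i lt = cons i (elementary n d) , [] ,
    cons-elementary i {d} (ℕ.<-≤-trans lt (ℕ.+-monoʳ-≤ d s≤i)) lt ,
    mk≋ λ φ → sym (trans (lin-++ φ (cons i (elementary n d)) []) (ℚ.+-identityʳ _))

  cons-spanned : ∀ {s i s′} → (∀ t → Spanned s (cons {n} (suc i) t)) →
    (∀ {μ : Monomial n} → InB s′ μ → InB s (i ∷ μ)) →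
    (∀ {d} → n < d ℕ.+ s′ → Deferred s i (elementary n d)) →
    ∀ {p : Poly n} → Spanned s′ p → Spanned s (cons i p)
  cons-spanned rest extend elems (basis c b) = basis c (extend b)
  cons-spanned rest extend elems (ideal I) =
    let r , t , I′ , e = ideal⇒deferred _ _ _ elems I in respects (≋-sym e) (sum (ideal I′) (rest t))
  cons-spanned {i = i} rest extend elems (sum {p = p} {q = q} a b) = respects (mk≋ λ φ →
      trans (lin-++ φ (cons i p) (cons i q)) (trans (cong₂ ℚ._+_ (lin-cons φ i p) (lin-cons φ i q))
      (sym (trans (lin-cons φ i (p +ᴾ q)) (lin-++ _ p q)))))
    (sum (cons-spanned rest extend elems a) (cons-spanned rest extend elems b))
  cons-spanned {i = i} rest extend elems (respects e a) = respects (cons-≋ i e)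
      (cons-spanned rest extend elems a)

  spanned : ∀ n s (p : Poly n) → Spanned s p
  -- A reduction in the remaining variables leaves a remainder divisible by x₀^(i+1), so the
  -- exponent of x₀ climbs until it reaches k. The number l bounds the steps that remain.
  spanned-cons : ∀ n s l i (p : Poly n) → k ≤ i ℕ.+ l → Spanned s (cons i p)

  spanned zero    s       []             = ideal 0∈
  spanned zero    zero    ((c , []) ∷ p) = sum (basis c []) (spanned zero zero p)
  -- Without variables and with s > 0 the generators contain e_0 = 1. The quotient is 0, in
  -- accordance with `InB` having no empty monomial for `suc s`.
  spanned zero    (suc s) ((c , []) ∷ p) = sum
    (ideal (subst (Ideal (Gen (suc s))) (cong (λ d → (d , []) ∷ []) (ℚ.*-identityʳ c))
      (*-closed ((c , []) ∷ []) (generator (elem 0 (s≤s z≤n))))))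
    (spanned zero (suc s) p)
  spanned (suc n) s       []             = ideal 0∈
  spanned (suc n) s ((c , i ∷ μ) ∷ p) =
    sum {p = (c , i ∷ μ) ∷ []} (spanned-cons n s k i ((c , μ) ∷ []) (ℕ.m≤n+m k i)) (spanned (suc n) s p)

  spanned-cons n s zero    i p k≤i+l = ideal (cons-≥ (subst (k ≤_) (ℕ.+-identityʳ i) k≤i+l) p)
  spanned-cons n s (suc l) i p k≤i+l with k ℕ.≤? i
  ... | yes k≤i = ideal (cons-≥ k≤i p)
  ... | no  k≰i with s ℕ.≤? i
  ...   | yes s≤i = cons-spanned (λ t → spanned-cons n s l (suc i) t (subst (k ≤_) (ℕ.+-suc i l) k≤i+l))
                      (high s≤i (ℕ.≰⇒> k≰i)) (λ {d} → deferred-high {d = d} s≤i) (spanned n s p)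
  ...   | no  s≰i with s | ℕ.≰⇒> s≰i
  ...     | suc s′ | s≤s i≤s′ =
                    cons-spanned (λ t → spanned-cons n (suc s′) l (suc i) t
                        (subst (k ≤_) (ℕ.+-suc i l) k≤i+l))
                      (low i≤s′) (λ {d} → deferred-low {d = d}) (spanned n s′ p)

-- Independence on a point set

horner : Vec ℚ m → ℚ → ℚ
horner []      b = 0ℚ
horner (c ∷ p) b = c ℚ.+ b ℚ.* horner p b

-- Synthetic division by X - a: the coefficients of the quotient are the Horner values at a of the
-- successive tails, and the remainder is the value of the polynomial itself.
divide : ℚ → Vec ℚ (suc m) → Vec ℚ m
divide a (c ∷ [])        = []
divide a (c ∷ p@(_ ∷ _)) = horner p a ∷ divide a p

horner-divide : ∀ a b (p : Vec ℚ (suc m)) → horner p b ≡ (b ℚ.+ ℚ.- a) ℚ.* horner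
    (divide a p) b ℚ.+ horner p a
horner-divide a b (c ∷ [])        = lemma a b c
  where
  lemma : ∀ a b c → c ℚ.+ b ℚ.* 0ℚ ≡ (b ℚ.+ ℚ.- a) ℚ.* 0ℚ ℚ.+ (c ℚ.+ a ℚ.* 0ℚ)
  lemma = solve-∀ ℚ-ring
horner-divide a b (c ∷ p@(_ ∷ _)) = trans (cong (λ h → c ℚ.+ b ℚ.* h) (horner-divide a b p))
  (lemma a b c (horner (divide a p) b) (horner p a))
  where
  lemma : ∀ a b c q r → c ℚ.+ b ℚ.* ((b ℚ.+ ℚ.- a) ℚ.* q ℚ.+ r) ≡ (b ℚ.+ ℚ.- a) ℚ.* (r ℚ.+ b ℚ.* q) ℚ.+
      (c ℚ.+ a ℚ.* r)
  lemma = solve-∀ ℚ-ring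

divide-zero : ∀ a (p : Vec ℚ (suc m)) → divide a p ≡ Vec.replicate m 0ℚ → horner p a ≡ 0ℚ →
    p ≡ Vec.replicate (suc m) 0ℚ
divide-zero a (c ∷ [])        _  pa = cong (_∷ []) (trans (lemma c a) pa)
  where
  lemma : ∀ c a → c ≡ c ℚ.+ a ℚ.* 0ℚ
  lemma = solve-∀ ℚ-ring
divide-zero a (c ∷ p@(_ ∷ _)) qe pa = cong₂ _∷_ head≡0 (divide-zero a p (Vec.∷-injectiveʳ qe)
    (Vec.∷-injectiveˡ qe))
  where
  lemma : ∀ c a → c ≡ c ℚ.+ a ℚ.* 0ℚ
  lemma = solve-∀ ℚ-ring

  head≡0 : c ≡ 0ℚ
  head≡0 = trans (lemma c a) (trans (cong (λ h → c ℚ.+ a ℚ.* h) (sym (Vec.∷-injectiveˡ qe))) pa)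

a*b≡0⇒b≡0 : ∀ a b → a ≢ 0ℚ → a ℚ.* b ≡ 0ℚ → b ≡ 0ℚ
a*b≡0⇒b≡0 a b a≢0 e = trans (sym (ℚ.*-identityˡ b)) (trans (cong (ℚ._* b) (sym (ℚ.*-inverseˡ a)))
  (trans (ℚ.*-assoc (ℚ.1/ a) a b) (trans (cong (ℚ.1/ a ℚ.*_) e) (ℚ.*-zeroʳ (ℚ.1/ a)))))
  where instance _ = ℚ.≢-nonZero a≢0

too-many-roots : ∀ (p : Vec ℚ m) as → Unique as → length as ≡ m → All (λ a → horner p a ≡ 0ℚ) as →
    p ≡ Vec.replicate m 0ℚ
too-many-roots []         []       _        _ _        = refl
too-many-roots p@(_ ∷ _) (a ∷ as) (a∉ ∷ u) e (r ∷ rs) =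
  divide-zero a p (too-many-roots (divide a p) as u (ℕ.suc-injective e) (All.map root (All.zip (a∉ , rs)))) r
  where
  root : ∀ {b} → a ≢ b × horner p b ≡ 0ℚ → horner (divide a p) b ≡ 0ℚ
  root {b} (a≢b , pb) = a*b≡0⇒b≡0 (b ℚ.+ ℚ.- a) _
    (λ b-a≡0 → a≢b (sym (trans (lemma b a) (trans (cong (ℚ._+ a) b-a≡0) (ℚ.+-identityˡ a)))))
    (trans (sym (ℚ.+-identityʳ _)) (trans (cong ((b ℚ.+ ℚ.- a) ℚ.* horner (divide a p) b ℚ.+_) (sym r))
        (trans (sym (horner-divide a b p)) pb)))
    where
    lemma : ∀ b a → b ≡ (b ℚ.+ ℚ.- a) ℚ.+ a
    lemma = solve-∀ ℚ-ring

∑< : ℕ → (ℕ → ℚ) → ℚ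
∑< zero    f = 0ℚ
∑< (suc m) f = ∑< m f ℚ.+ f m

∑<-cong : ∀ m {f g} → (∀ i → i < m → f i ≡ g i) → ∑< m f ≡ ∑< m g
∑<-cong zero    e = refl
∑<-cong (suc m) e = cong₂ ℚ._+_ (∑<-cong m λ i i<m → e i (ℕ.m<n⇒m<1+n i<m)) (e m ℕ.≤-refl)

∑<-zero : ∀ m {f} → (∀ i → i < m → f i ≡ 0ℚ) → ∑< m f ≡ 0ℚ
∑<-zero zero    e = refl
∑<-zero (suc m) e rewrite ∑<-zero m (λ i i<m → e i (ℕ.m<n⇒m<1+n i<m)) | e m ℕ.≤-refl = refl

∑<-truncate : ∀ {m n f} → m ≤ n → (∀ i → m ≤ i → i < n → f i ≡ 0ℚ) → ∑< n f ≡ ∑< m f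
∑<-truncate {zero}  {n} _ e = ∑<-zero n λ i → e i z≤n
∑<-truncate {suc m} {suc n} {f} 1+m≤1+n e with ℕ.m≤n⇒m<n∨m≡n 1+m≤1+n
... | inj₂ refl = refl
... | inj₁ (s≤s 1+m≤n) = trans (cong₂ ℚ._+_ (∑<-truncate 1+m≤n λ i l u → e i l (ℕ.m<n⇒m<1+n u))
    (e n 1+m≤n ℕ.≤-refl))
                            (ℚ.+-identityʳ _)

∑<-suc : ∀ m f → ∑< (suc m) f ≡ f 0 ℚ.+ ∑< m (λ i → f (suc i))
∑<-suc zero    f = ℚ.+-comm 0ℚ (f 0)
∑<-suc (suc m) f = trans (cong (ℚ._+ f (suc m)) (∑<-suc m f)) (ℚ.+-assoc (f 0) _ _)

∑<-*ˡ : ∀ m a f → ∑< m (λ i → a ℚ.* f i) ≡ a ℚ.* ∑< m f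
∑<-*ˡ zero    a f = sym (ℚ.*-zeroʳ a)
∑<-*ˡ (suc m) a f = trans (cong (ℚ._+ a ℚ.* f m) (∑<-*ˡ m a f)) (sym (ℚ.*-distribˡ-+ a _ _))

coefficients : ∀ m → (ℕ → ℚ) → Vec ℚ m
coefficients zero    f = []
coefficients (suc m) f = f 0 ∷ coefficients m (λ i → f (suc i))

horner-coefficients : ∀ m f a → horner (coefficients m f) a ≡ ∑< m (λ i → a ^ℚ i ℚ.* f i)
horner-coefficients zero    f a = refl
horner-coefficients (suc m) f a = sym (trans (∑<-suc m (λ i → a ^ℚ i ℚ.* f i))
    (cong₂ ℚ._+_ (ℚ.*-identityˡ (f 0))
  (trans (∑<-cong m (λ i _ → ℚ.*-assoc a (a ^ℚ i) (f (suc i))))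
  (trans (∑<-*ˡ m a (λ i → a ^ℚ i ℚ.* f (suc i))) (cong (a ℚ.*_)
      (sym (horner-coefficients m (λ i → f (suc i)) a)))))))

-- The sums are the values of the polynomial with coefficients f 0, ..., f (m - 1), which has m
-- distinct roots and degree less than m.
vandermonde : ∀ as {m} → length as ≡ m → Unique as → ∀ f →
    (∀ {a} → a ∈ as → ∑< m (λ i → a ^ℚ i ℚ.* f i) ≡ 0ℚ) →
              ∀ i → i < m → f i ≡ 0ℚ
vandermonde as {m} len u f roots = read m f
  (too-many-roots (coefficients m f) as u len (All.tabulate λ {a} a∈ → trans (horner-coefficients m f a) (roots a∈)))
  where
  read : ∀ m f → coefficients m f ≡ Vec.replicate m 0ℚ → ∀ i → i < m → f i ≡ 0ℚ
  read (suc m) f e zero    _         = Vec.∷-injectiveˡ e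
  read (suc m) f e (suc i) (s≤s i<m) = read m (λ i → f (suc i)) (Vec.∷-injectiveʳ e) i i<m

infixr 8 _^^_
_^^_ : Vec ℚ n → Monomial n → ℚ
[]      ^^ []      = 1ℚ
(a ∷ y) ^^ (i ∷ μ) = a ^ℚ i ℚ.* y ^^ μ

^^-∙ : ∀ (y : Vec ℚ n) μ ν → y ^^ (μ ∙ ν) ≡ y ^^ μ ℚ.* y ^^ ν
^^-∙ []      []      []      = refl
^^-∙ (a ∷ y) (i ∷ μ) (j ∷ ν) = trans (cong₂ ℚ._*_ (^ℚ-homo-* a i j) (^^-∙ y μ ν))
    (lemma (a ^ℚ i) (a ^ℚ j) (y ^^ μ) (y ^^ ν))
  where
  lemma : ∀ a b c d → (a ℚ.* b) ℚ.* (c ℚ.* d) ≡ (a ℚ.* c) ℚ.* (b ℚ.* d)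
  lemma = solve-∀ ℚ-ring

eval : Vec ℚ n → Poly n → ℚ
eval y = lin (y ^^_)

slice : ℕ → Poly (suc n) → Poly n
slice i []                = []
slice i ((c , j ∷ μ) ∷ p) with j ℕ.≟ i
... | yes _ = (c , μ) ∷ slice i p
... | no  _ = slice i p

coeff-slice : ∀ i (p : Poly (suc n)) μ → coeff (slice i p) μ ≡ coeff p (i ∷ μ)
coeff-slice i []                μ = refl
coeff-slice i ((c , j ∷ ν) ∷ p) μ with j ℕ.≟ i
... | no j≢i rewrite dec-false (j ℕ.≟ i) j≢i = trans (coeff-slice i p μ) (sym (ℚ.+-identityˡ _))
... | yes refl rewrite dec-true (i ℕ.≟ i) refl = cong ((if does (ν ≟ᴹ μ) then c else 0ℚ) ℚ.+_) (coeff-slice i p μ)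

slice-cons : ∀ i (p : Poly n) → slice i (cons i p) ≡ p
slice-cons i []            = refl
slice-cons i ((c , μ) ∷ p) with i ℕ.≟ i
... | yes _  = cong (_ ∷_) (slice-cons i p)
... | no i≢i = contradiction refl i≢i

slice-cons-≢ : ∀ {i j} → j ≢ i → (p : Poly n) → slice i (cons j p) ≡ []
slice-cons-≢         j≢i []            = refl
slice-cons-≢ {i = i} {j} j≢i ((c , μ) ∷ p) with j ℕ.≟ i
... | yes j≡i = contradiction j≡i j≢i
... | no _    = slice-cons-≢ j≢i p

join : ℕ → (ℕ → Poly n) → Poly (suc n)
join zero    g = []
join (suc m) g = join m g ++ cons m (g m)

coeff-join-≥ : ∀ {m i} → m ≤ i → ∀ (g : ℕ → Poly n) μ → coeff (join m g) (i ∷ μ) ≡ 0ℚ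
coeff-join-≥ {m = zero}      _   g μ = refl
coeff-join-≥ {m = suc m} {i} m<i g μ = trans (coeff-+ (join m g) (cons m (g m)) (i ∷ μ))
  (cong₂ ℚ._+_ (coeff-join-≥ (ℕ.<⇒≤ m<i) g μ)
    (trans (sym (coeff-slice i (cons m (g m)) μ)) (cong (λ p → coeff p μ) (slice-cons-≢ (ℕ.<⇒≢ m<i) (g m)))))

coeff-join-< : ∀ {m i} → i < m → ∀ (g : ℕ → Poly n) μ → coeff (join m g) (i ∷ μ) ≡ coeff (g i) μ
coeff-join-< {m = suc m} {i} (s≤s i≤m) g μ with ℕ.m≤n⇒m<n∨m≡n i≤m
... | inj₁ i<m = trans (coeff-+ (join m g) (cons m (g m)) (i ∷ μ)) (trans (cong₂ ℚ._+_ (coeff-join-< i<m g μ)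
    (trans (sym (coeff-slice i (cons m (g m)) μ)) (cong (λ p → coeff p μ)
        (slice-cons-≢ (λ m≡i → ℕ.<⇒≢ i<m (sym m≡i)) (g m)))))
    (ℚ.+-identityʳ _))
... | inj₂ refl = trans (coeff-+ (join m g) (cons m (g m)) (m ∷ μ))
    (trans (cong₂ ℚ._+_ (coeff-join-≥ {m = m} ℕ.≤-refl g μ)
    (trans (sym (coeff-slice i (cons m (g m)) μ)) (cong (λ p → coeff p μ) (slice-cons m (g m)))))
    (ℚ.+-identityˡ _))

eval-join : ∀ m (g : ℕ → Poly n) a y → eval (a ∷ y) (join m g) ≡ ∑< m (λ i → a ^ℚ i ℚ.* eval y (g i))
eval-join zero    g a y = refl
eval-join (suc m) g a y = trans (lin-++ _ (join m g) (cons m (g m))) (cong₂ ℚ._+_ (eval-join m g a y)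
  (trans (lin-cons _ m (g m)) (lin-*ˡ (a ^ℚ m) (y ^^_) (g m))))

eval-slices : ∀ m (p : Poly (suc n)) → (∀ {i} μ → m ≤ i → coeff p (i ∷ μ) ≡ 0ℚ) →
  ∀ a y → eval (a ∷ y) p ≡ ∑< m (λ i → a ^ℚ i ℚ.* eval y (slice i p))
eval-slices {n} m p high≡0 a y = trans (≈⇒lin {p = p} {join m (λ i → slice i p)} e ((a ∷ y) ^^_))
    (eval-join m (λ i → slice i p) a y)
  where
  e : p ≈ᴾ join m (λ i → slice i p)
  e (i ∷ μ) with m ℕ.≤? i
  ... | yes m≤i = trans (high≡0 μ m≤i) (sym (coeff-join-≥ m≤i (λ i → slice i p) μ))
  ... | no  m≰i = sym (trans (coeff-join-< (ℕ.≰⇒> m≰i) (λ i → slice i p) μ) (coeff-slice i p μ))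

-- The specialisation x₀ = a of `join m g`. It is again a polynomial, in one variable less, so an
-- induction on the number of variables applies to it.
combination : ℕ → (ℕ → Poly n) → ℚ → Poly n
combination zero    g a = []
combination (suc m) g a = combination m g a ++ (a ^ℚ m) · g m

lin-combination : ∀ φ m (g : ℕ → Poly n) a → lin φ (combination m g a) ≡ ∑< m (λ i → a ^ℚ i ℚ.* lin φ (g i))
lin-combination φ zero    g a = refl
lin-combination φ (suc m) g a = trans (lin-++ φ (combination m g a) _)
    (cong₂ ℚ._+_ (lin-combination φ m g a) (lin-· φ (a ^ℚ m) (g m)))

unique-─ : ∀ {A : Set} {P : A → Set} {xs : List A} (p : Any P xs) → Unique xs → Unique (xs ─ p)
unique-─ (here _)  (_ ∷ u) = u
unique-─ (there p) (a ∷ u) = All.─⁺ p a ∷ unique-─ p u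

length-─ : ∀ {A : Set} {P : A → Set} {xs : List A} (p : Any P xs) → suc (length (xs ─ p)) ≡ length xs
length-─ (here _)  = refl
length-─ (there p) = cong suc (length-─ p)

module _ (αs : List ℚ) where

  -- The points with coordinates in αs among which all elements of S occur.
  data Point : List ℚ → Vec ℚ n → Set where
    []   : Point [] []
    take : ∀ {S a} {y : Vec ℚ n} (a∈S : a ∈ S) → Point (S ─ a∈S) y → Point S (a ∷ y)
    skip : ∀ {S a} {y : Vec ℚ n} → a ∈ αs → Point S y → Point S (a ∷ y)

  private k = length αs

  -- Two Vandermonde arguments: a skipped first coordinate ranges over all of
  -- αs and a taken one over S.
  vanishing⇒zero : Unique αs → ∀ S s → length S ≡ s → s ≤ k → Unique S → All (_∈ αs) S → (p : Poly n) →
    (∀ μ → ¬ InB k s μ → coeff p μ ≡ 0ℚ) →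
    (∀ {y} → Point S y → eval y p ≡ 0ℚ) →
    ∀ μ → coeff p μ ≡ 0ℚ
  vanishing⇒zero {zero} uα []      .0 refl _ _ _ p _       van [] = trans (constants p) (van [])
    where
    constants : ∀ (p : Poly 0) → coeff p [] ≡ eval [] p
    constants []             = refl
    constants ((c , []) ∷ p) = cong₂ ℚ._+_ (sym (ℚ.*-identityʳ c)) (constants p)
  vanishing⇒zero {zero} uα (_ ∷ _) .(suc _) refl _ _ _ p support van [] = support [] λ ()
  vanishing⇒zero {suc n} uα S s len s≤k u S⊆ p support van (i ∷ μ) with k ℕ.≤? i
  ... | yes k≤i = support (i ∷ μ) (k≤i⇒∉ k≤i)
    where
    k≤i⇒∉ : ∀ {i} {μ : Monomial n} → k ≤ i → ¬ InB k s (i ∷ μ)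
    k≤i⇒∉ k≤i (low i≤s′ _)    = ℕ.<⇒≱ (s≤s i≤s′) (ℕ.≤-trans s≤k k≤i)
    k≤i⇒∉ k≤i (high _ i<k _)  = ℕ.<⇒≱ i<k k≤i
  ... | no  k≰i = trans (sym (coeff-slice i p μ)) (by-cases (s ℕ.≤? i))
    where
    i<k = ℕ.≰⇒> k≰i

    beyond : ∀ {i} μ → k ≤ i → coeff p (i ∷ μ) ≡ 0ℚ
    beyond μ k≤i = support (_ ∷ μ) λ where
      (low i≤s′ _)   → ℕ.<⇒≱ (s≤s i≤s′) (ℕ.≤-trans s≤k k≤i)
      (high _ i<k _) → ℕ.<⇒≱ i<k k≤i

    -- A first coordinate a may be any of the k values, and by the support condition only the slices
    -- below k occur: as many unknowns as nodes.
    skipped : ∀ {y} → Point S y → ∀ i → i < k → eval y (slice i p) ≡ 0ℚ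
    skipped {y} pt = vandermonde αs refl uα (λ i → eval y (slice i p))
      λ {a} a∈ → trans (sym (eval-slices k p beyond a y)) (van (skip a∈ pt))

    high-slices : ∀ i → s ≤ i → i < k → ∀ μ → coeff (slice i p) μ ≡ 0ℚ
    high-slices i s≤i i<k = vanishing⇒zero uα S s len s≤k u S⊆ (slice i p)
      (λ μ μ∉ → trans (coeff-slice i p μ) (support (i ∷ μ) λ where
        (low i≤s′ _)   → ℕ.<⇒≱ (s≤s i≤s′) s≤i
        (high _ _ μ∈)  → μ∉ μ∈))
      (λ pt → skipped pt i i<k)

    -- A first coordinate taken from S gives only s nodes. They suffice once the slices from s on
    -- are known to vanish: the sum over the exponents below s is then the full value, and its
    -- monomials are basis monomials for S without a.
    taken : ∀ {a} → a ∈ S → ∀ μ → coeff (combination s (λ i → slice i p) a) μ ≡ 0ℚ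
    taken {a} a∈ with length (S ─ a∈) in len′
    ... | s′ = vanishing⇒zero uα (S ─ a∈) s′ len′ (ℕ.≤-trans (ℕ.n≤1+n s′) (subst (_≤ k) (sym 1+s′≡s) s≤k))
        (unique-─ a∈ u) (All.─⁺ a∈ S⊆) (combination s (λ i → slice i p) a)
        (λ μ μ∉ → trans (coeff≡lin (combination s (λ i → slice i p) a) μ)
            (trans (lin-combination (δ μ) s (λ i → slice i p) a)
          (∑<-zero s λ i i<s → trans (cong (a ^ℚ i ℚ.*_)
            (trans (sym (coeff≡lin (slice i p) μ)) (trans (coeff-slice i p μ)
                (support (i ∷ μ) (below μ∉ i<s)))))
            (ℚ.*-zeroʳ (a ^ℚ i)))))
        λ {y} pt → trans (lin-combination (y ^^_) s (λ i → slice i p) a)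
          (trans (sym (∑<-truncate s≤k λ i s≤i i<k → trans (cong (a ^ℚ i ℚ.*_)
            (lin-vanishing (y ^^_) (slice i p) (high-slices i s≤i i<k))) (ℚ.*-zeroʳ (a ^ℚ i))))
          (trans (sym (eval-slices k p beyond a y)) (van (take a∈ pt))))
      where
      1+s′≡s : suc s′ ≡ s
      1+s′≡s = trans (cong suc (sym len′)) (trans (length-─ a∈) len)

      below : ∀ {μ i} → ¬ InB k s′ μ → i < s → ¬ InB k s (i ∷ μ)
      below μ∉ i<s (low _ μ∈)     = μ∉ (subst (λ t → InB k t _) (ℕ.suc-injective (sym 1+s′≡s)) μ∈)
      below μ∉ i<s (high s≤i _ _) = ℕ.<⇒≱ i<s s≤i

    by-cases : Dec (s ≤ i) → coeff (slice i p) μ ≡ 0ℚ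
    by-cases (yes s≤i) = high-slices i s≤i i<k μ
    by-cases (no  s≰i) = vandermonde S len u (λ i → coeff (slice i p) μ)
      (λ {a} a∈ → trans (∑<-cong s λ i _ → cong (a ^ℚ i ℚ.*_) (coeff≡lin (slice i p) μ))
        (trans (sym (lin-combination (δ μ) s (λ i → slice i p) a))
        (trans (sym (coeff≡lin (combination s (λ i → slice i p) a) μ)) (taken a∈ μ))))
      i (ℕ.≰⇒> s≰i)

-- Leading forms and reduction

deg : Monomial n → ℕ
deg = Vec.sum

deg-∙ : ∀ (μ ν : Monomial n) → deg (μ ∙ ν) ≡ deg μ ℕ.+ deg ν
deg-∙ []      []      = refl
deg-∙ (i ∷ μ) (j ∷ ν) = trans (cong (i ℕ.+ j ℕ.+_) (deg-∙ μ ν)) (lemma i j (deg μ) (deg ν))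
  where
  open import Data.Nat.Tactic.RingSolver using () renaming (solve-∀ to ℕ-solve-∀)
  lemma : ∀ i j a b → i ℕ.+ j ℕ.+ (a ℕ.+ b) ≡ i ℕ.+ a ℕ.+ (j ℕ.+ b)
  lemma = ℕ-solve-∀

deg-𝟘 : ∀ n → deg (𝟘 {n}) ≡ 0
deg-𝟘 zero    = refl
deg-𝟘 (suc n) = deg-𝟘 n

deg-unit : ∀ (i : Fin n) m → deg (unit i m) ≡ m
deg-unit {suc n} zero m = trans (cong (m ℕ.+_) (deg-𝟘 n)) (ℕ.+-identityʳ m)
deg-unit (suc i)      m = deg-unit i m

-- A condition on the listed terms, which is stronger than one on the monomials with nonzero
-- coefficient. List operations preserve it without any discussion of cancellation.
Terms : (Monomial n → Set) → Poly n → Set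
Terms P = All (λ (c , μ) → P μ)

Terms-· : ∀ {P : Monomial n → Set} c {p} → Terms P p → Terms P (c · p)
Terms-· c []       = []
Terms-· c (h ∷ hs) = h ∷ Terms-· c hs

Terms-cons : ∀ {P : Monomial (suc n) → Set} {Q : Monomial n → Set} i → (∀ {μ} → Q μ → P (i ∷ μ)) →
             ∀ {p} → Terms Q p → Terms P (cons i p)
Terms-cons i f []       = []
Terms-cons i f (h ∷ hs) = f h ∷ Terms-cons i f hs

Terms-term-* : ∀ {P Q : Monomial n → Set} c μ → (∀ {ν} → Q ν → P (μ ∙ ν)) →
               ∀ {p} → Terms Q p → Terms P (((c , μ) ∷ []) *ᴾ p)
Terms-term-* c μ f []       = []
Terms-term-* c μ f (h ∷ hs) = f h ∷ Terms-term-* c μ f hs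

-- The adjoint of `comp d`: identities between homogeneous components become pointwise identities
-- between functionals on monomials.
restrict : ℕ → (Monomial n → ℚ) → Monomial n → ℚ
restrict d φ μ = if does (deg μ ℕ.≟ d) then φ μ else 0ℚ

restrict-≡ : ∀ d (φ : Monomial n → ℚ) μ → deg μ ≡ d → restrict d φ μ ≡ φ μ
restrict-≡ d φ μ e rewrite dec-true (deg μ ℕ.≟ d) e = refl

restrict-≢ : ∀ d (φ : Monomial n → ℚ) μ → deg μ ≢ d → restrict d φ μ ≡ 0ℚ
restrict-≢ d φ μ ne rewrite dec-false (deg μ ℕ.≟ d) ne = refl

lin-cong-Terms : ∀ {P : Monomial n → Set} {φ ψ} → (∀ μ → P μ → φ μ ≡ ψ μ) → ∀ {p} → Terms P p →
    lin φ p ≡ lin ψ p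
lin-cong-Terms e []                       = refl
lin-cong-Terms e (_∷_ {x = c , μ} h hs) = cong₂ (λ a b → c ℚ.* a ℚ.+ b) (e μ h) (lin-cong-Terms e hs)

lin-0 : ∀ (p : Poly n) → lin (λ _ → 0ℚ) p ≡ 0ℚ
lin-0 []            = refl
lin-0 ((c , μ) ∷ p) rewrite lin-0 p = trans (ℚ.+-identityʳ _) (ℚ.*-zeroʳ c)

comp : ℕ → Poly n → Poly n
comp d []            = []
comp d ((c , μ) ∷ p) with deg μ ℕ.≟ d
... | yes _ = (c , μ) ∷ comp d p
... | no  _ = comp d p

lin-comp : ∀ φ d (p : Poly n) → lin φ (comp d p) ≡ lin (restrict d φ) p
lin-comp φ d []            = refl
lin-comp φ d ((c , μ) ∷ p) with deg μ ℕ.≟ d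
... | yes e rewrite dec-true  (deg μ ℕ.≟ d) e = cong (c ℚ.* φ μ ℚ.+_) (lin-comp φ d p)
... | no ne rewrite dec-false (deg μ ℕ.≟ d) ne =
  trans (lin-comp φ d p) (sym (trans (cong (ℚ._+ lin (restrict d φ) p) (ℚ.*-zeroʳ c)) (ℚ.+-identityˡ _)))

Terms-comp : ∀ {P : Monomial n → Set} d {p} → Terms P p → Terms (λ μ → P μ × deg μ ≡ d) (comp d p)
Terms-comp d []                     = []
Terms-comp d (_∷_ {x = c , μ} h hs) with deg μ ℕ.≟ d
... | yes e = (h , e) ∷ Terms-comp d hs
... | no  _ = Terms-comp d hs

coeff-comp-≡ : ∀ {d} (p : Poly n) {ν} → deg ν ≡ d → coeff (comp d p) ν ≡ coeff p ν
coeff-comp-≡ {d = d} p {ν} e = trans (coeff≡lin (comp d p) ν) (trans (lin-comp (δ ν) d p)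
  (trans (lin-cong pointwise p) (sym (coeff≡lin p ν))))
  where
  pointwise : ∀ μ → restrict d (δ ν) μ ≡ δ ν μ
  pointwise μ with deg μ ℕ.≟ d
  ... | yes e′ = restrict-≡ d (δ ν) μ e′
  ... | no ne  = trans (restrict-≢ d (δ ν) μ ne) (sym (δ-≢ μ ν λ { refl → ne e }))

coeff-comp-≢ : ∀ {d} (p : Poly n) {ν} → deg ν ≢ d → coeff (comp d p) ν ≡ 0ℚ
coeff-comp-≢ {d = d} p {ν} ne = trans (coeff≡lin (comp d p) ν) (trans (lin-comp (δ ν) d p)
  (trans (lin-cong pointwise p) (lin-0 p)))
  where
  pointwise : ∀ μ → restrict d (δ ν) μ ≡ 0ℚ
  pointwise μ with deg μ ℕ.≟ d
  ... | no ne′ = restrict-≢ d (δ ν) μ ne′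
  ... | yes e  = trans (restrict-≡ d (δ ν) μ e) (δ-≢ μ ν λ { refl → ne e })

coeff-∉ : ∀ {P : Monomial n → Set} {p} → Terms P p → ∀ {ν} → ¬ P ν → coeff p ν ≡ 0ℚ
coeff-∉ {P = P} {p} h {ν} ν∉ = trans (coeff≡lin p ν)
  (trans (lin-cong-Terms {P = P} (λ μ Pμ → δ-≢ μ ν λ { refl → ν∉ Pμ }) h) (lin-0 p))

elementary-degree : ∀ n d → Terms (λ μ → deg μ ≡ d) (elementary n d)
elementary-degree zero    zero    = refl ∷ []
elementary-degree zero    (suc d) = []
elementary-degree (suc n) d rewrite elementary-suc n d =
  All.++⁺ (Terms-cons 0 (λ e → e) (elementary-degree n d)) (pre d)
  where
  pre : ∀ d → Terms (λ μ → deg μ ≡ d) (cons 1 (preElementary n d))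
  pre zero    = []
  pre (suc d) = Terms-cons 1 (cong suc) (elementary-degree n d)

generator-homogeneous : ∀ {k s} {p : Poly n} → Gen k s p → ∃ λ e → Terms (λ μ → deg μ ≡ e) p
generator-homogeneous {k = k} (power i) = k , subst (Terms _) (sym (x^ᴾ i k)) (deg-unit i k ∷ [])
generator-homogeneous {n = n} (elem d _) = d , elementary-degree n d

comp-homogeneous : ∀ {d} {p : Poly n} → Terms (λ μ → deg μ ≡ d) p → comp d p ≋ p
comp-homogeneous {d = d} {p} h = mk≋ λ φ → trans (lin-comp φ d p) (lin-cong-Terms (restrict-≡ d φ) h)

-- The generators are homogeneous, and multiplication by a term of degree e sends the component of
-- degree d - e to that of degree d, while degrees below e receive nothing.
comp-closed : ∀ {k s} {p : Poly n} → Ideal (Gen k s) p → ∀ d → Ideal (Gen k s) (comp d p)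
comp-closed {n} {k} {s} = Ideal-induction (λ p → ∀ d → Ideal (Gen k s) (comp d p)) gen (λ _ → 0∈)
  (λ {p} {q} a b d → resp-≋ (mk≋ λ φ → trans (lin-++ φ (comp d p) (comp d q))
     (trans (cong₂ ℚ._+_ (lin-comp φ d p) (lin-comp φ d q))
     (sym (trans (lin-comp φ d (p +ᴾ q)) (lin-++ _ p q))))) (+-closed (a d) (b d)))
  term
  λ {p} {q} e a d → resp-≋ (mk≋ λ φ → trans (lin-comp φ d p) (trans (on e _) (sym (lin-comp φ d q)))) (a d)
  where
  gen : ∀ {p} → Gen k s p → ∀ d → Ideal (Gen k s) (comp d p)
  gen {p} g d with generator-homogeneous g
  ... | e , h with e ℕ.≟ d
  ...   | yes refl = resp-≋ (≋-sym (comp-homogeneous h)) (generator g)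
  ...   | no e≢d   = resp-≋ (mk≋ λ φ → sym (trans (lin-comp φ d p)
            (trans (lin-cong-Terms (λ { μ refl → restrict-≢ d φ μ e≢d }) h) (lin-0 p)))) 0∈

  term : ∀ c μ {q} → (∀ d → Ideal (Gen k s) (comp d q)) → ∀ d → Ideal (Gen k s) (comp d (((c , μ) ∷ []) *ᴾ q))
  term c μ {q} I d with deg μ ℕ.≤? d
  ... | yes l = resp-≋ (mk≋ λ φ → trans (lin-*-term φ c μ (comp (d ℕ.∸ deg μ) q))
      (trans (cong (c ℚ.*_) (trans (lin-comp _ (d ℕ.∸ deg μ) q) (lin-cong (shift φ) q)))
      (sym (trans (lin-comp φ d (((c , μ) ∷ []) *ᴾ q)) (lin-*-term (restrict d φ) c μ q)))))
    (*-closed ((c , μ) ∷ []) (I (d ℕ.∸ deg μ)))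
    where
    shift : ∀ φ ν → restrict (d ℕ.∸ deg μ) (λ ν → φ (μ ∙ ν)) ν ≡ restrict d φ (μ ∙ ν)
    shift φ ν with deg ν ℕ.≟ d ℕ.∸ deg μ
    ... | yes e = trans (restrict-≡ (d ℕ.∸ deg μ) (λ ν → φ (μ ∙ ν)) ν e) (sym (restrict-≡ d φ (μ ∙ ν)
      (trans (deg-∙ μ ν) (trans (cong (deg μ ℕ.+_) e) (ℕ.m+[n∸m]≡n l)))))
    ... | no ne = trans (restrict-≢ (d ℕ.∸ deg μ) (λ ν → φ (μ ∙ ν)) ν ne)
        (sym (restrict-≢ d φ (μ ∙ ν) λ e → ne
      (trans (sym (ℕ.m+n∸m≡n (deg μ) (deg ν))) (cong (ℕ._∸ deg μ) (trans (sym (deg-∙ μ ν)) e)))))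
  ... | no nl = resp-≋ (mk≋ λ φ → sym (trans (lin-comp φ d (((c , μ) ∷ []) *ᴾ q))
      (trans (lin-*-term (restrict d φ) c μ q)
      (trans (cong (c ℚ.*_) (trans (lin-cong (λ ν → restrict-≢ d φ (μ ∙ ν) λ e → nl
          (subst (deg μ ≤_) (trans (sym (deg-∙ μ ν)) e) (ℕ.m≤m+n _ _))) q) (lin-0 q)))
      (ℚ.*-zeroʳ c))))) 0∈

-- Polynomials vanishing on the points

^^-𝟘 : ∀ (y : Vec ℚ n) → y ^^ 𝟘 ≡ 1ℚ
^^-𝟘 []      = refl
^^-𝟘 (a ∷ y) = trans (ℚ.*-identityˡ _) (^^-𝟘 y)

^^-unit : ∀ (y : Vec ℚ n) i m → y ^^ unit i m ≡ Vec.lookup y i ^ℚ m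
^^-unit (a ∷ y) zero    m = trans (cong (a ^ℚ m ℚ.*_) (^^-𝟘 y)) (ℚ.*-identityʳ _)
^^-unit (a ∷ y) (suc i) m = trans (ℚ.*-identityˡ _) (^^-unit y i m)

eval-term : ∀ (y : Vec ℚ n) μ → eval y ((1ℚ , μ) ∷ []) ≡ y ^^ μ
eval-term y μ = trans (ℚ.+-identityʳ _) (ℚ.*-identityˡ _)

eval-*-term : ∀ (y : Vec ℚ n) c μ p → eval y (((c , μ) ∷ []) *ᴾ p) ≡ c ℚ.* (y ^^ μ ℚ.* eval y p)
eval-*-term y c μ p = trans (lin-*-term (y ^^_) c μ p)
  (cong (c ℚ.*_) (trans (lin-cong (^^-∙ y μ) p) (lin-*ˡ (y ^^ μ) (y ^^_) p)))

-- ∏ (xᵢ - a) over a ∈ as, without its leading term.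
rootTail : Fin n → List ℚ → Poly n
rootTail i []       = []
rootTail i (a ∷ as) = ((1ℚ , unit i 1) ∷ []) *ᴾ rootTail i as ++ (ℚ.- a) ·
    ((1ℚ , unit i (length as)) ∷ rootTail i as)

rootTail-degree : ∀ (i : Fin n) as → Terms (λ μ → deg μ < length as) (rootTail i as)
rootTail-degree i []       = []
rootTail-degree {n} i (a ∷ as) = All.++⁺
  (Terms-term-* {Q = λ μ → deg μ < length as} 1ℚ (unit i 1)
    (λ {ν} lt → subst (_< suc (length as)) (sym (trans (deg-∙ (unit i 1) ν) (cong (ℕ._+ deg ν) (deg-unit i 1)))) (s≤s lt))
    (rootTail-degree i as))
  (Terms-· {P = λ μ → deg μ < suc (length as)} (ℚ.- a) {(1ℚ , unit i (length as)) ∷ rootTail i as}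
    (s≤s (ℕ.≤-reflexive (deg-unit i (length as))) ∷ All.map ℕ.m<n⇒m<1+n (rootTail-degree i as)))

rootTail-vanishes : ∀ (i : Fin n) as y → Vec.lookup y i ∈ as → y ^^ unit i (length as) ℚ.+ eval y
    (rootTail i as) ≡ 0ℚ
rootTail-vanishes {n} i (a ∷ as) y z∈ = trans factor (product z∈)
  where
  z = Vec.lookup y i
  rest = y ^^ unit i (length as) ℚ.+ eval y (rootTail i as)

  factor : y ^^ unit i (suc (length as)) ℚ.+ eval y (rootTail i (a ∷ as)) ≡ (z ℚ.+ ℚ.- a) ℚ.* rest
  factor = trans (cong₂ ℚ._+_ (trans (^^-unit y i (suc (length as)))
      (cong (z ℚ.*_) (sym (^^-unit y i (length as)))))
      (trans (lin-++ (y ^^_) (((1ℚ , unit i 1) ∷ []) *ᴾ rootTail i as) _)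
        (cong₂ ℚ._+_ (trans (eval-*-term y 1ℚ (unit i 1) (rootTail i as))
                            (cong (λ w → 1ℚ ℚ.* (w ℚ.* eval y (rootTail i as))) (^^-unit y i 1)))
          (trans (lin-· (y ^^_) (ℚ.- a) ((1ℚ , unit i (length as)) ∷ rootTail i as)) refl))))
    (lemma z a (y ^^ unit i (length as)) (eval y (rootTail i as)))
    where
    lemma : ∀ z a u t → z ℚ.* u ℚ.+ (1ℚ ℚ.* (z ℚ.* 1ℚ ℚ.* t) ℚ.+ (ℚ.- a) ℚ.* (1ℚ ℚ.* u ℚ.+ t)) ≡
        (z ℚ.+ ℚ.- a) ℚ.* (u ℚ.+ t)
    lemma = solve-∀ ℚ-ring

  product : z ∈ a ∷ as → (z ℚ.+ ℚ.- a) ℚ.* rest ≡ 0ℚ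
  product (here z≡a)  = trans (cong (ℚ._* rest) (trans (cong (ℚ._+ ℚ.- a) z≡a) (ℚ.+-inverseʳ a)))
      (ℚ.*-zeroˡ rest)
  product (there z∈′) = trans (cong ((z ℚ.+ ℚ.- a) ℚ.*_) (rootTail-vanishes i as y z∈′))
      (ℚ.*-zeroʳ (z ℚ.+ ℚ.- a))

-- The coefficient of t^d in ∏ (1 + yᵢ t) / ∏ (1 + a t), a ∈ S.
ratio : List ℚ → ℕ → Vec ℚ n → ℚ
ratio []      d       y = eval y (elementary _ d)
ratio (a ∷ S) zero    y = ratio S zero y
ratio (a ∷ S) (suc d) y = ratio S (suc d) y ℚ.+ ℚ.- a ℚ.* ratio (a ∷ S) d y

-- `ratio` without its leading form e_d. Each denominator 1 + a t contributes only - a times the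
-- previous coefficient, which has degree d - 1.
ratioTail : ∀ n → List ℚ → ℕ → Poly n
ratioTail n []      d       = []
ratioTail n (a ∷ S) zero    = ratioTail n S zero
ratioTail n (a ∷ S) (suc d) = ratioTail n S (suc d) ++ (ℚ.- a) · (elementary n d ++ ratioTail n (a ∷ S) d)

ratioTail-degree : ∀ n S d → Terms (λ μ → deg μ < d) (ratioTail n S d)
ratioTail-degree n []      d       = []
ratioTail-degree n (a ∷ S) zero    = ratioTail-degree n S zero
ratioTail-degree n (a ∷ S) (suc d) = All.++⁺ (ratioTail-degree n S (suc d))
    (Terms-· {P = λ μ → deg μ < suc d} (ℚ.- a)
  (All.++⁺ (All.map (λ e → s≤s (ℕ.≤-reflexive e)) (elementary-degree n d))
           (All.map ℕ.m<n⇒m<1+n (ratioTail-degree n (a ∷ S) d))))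

ratio-tail : ∀ S d (y : Vec ℚ n) → ratio S d y ≡ eval y (elementary n d) ℚ.+ eval y (ratioTail n S d)
ratio-tail []      d       y = sym (ℚ.+-identityʳ _)
ratio-tail (a ∷ S) zero    y = ratio-tail S zero y
ratio-tail {n} (a ∷ S) (suc d) y = trans (cong₂ (λ u v → u ℚ.+ ℚ.- a ℚ.* v) (ratio-tail S (suc d) y)
    (ratio-tail (a ∷ S) d y))
  (trans (ℚ.+-assoc (eval y (elementary n (suc d))) _ _)
  (cong (eval y (elementary n (suc d)) ℚ.+_) (sym (trans (lin-++ (y ^^_) (ratioTail n S (suc d)) _)
    (cong (eval y (ratioTail n S (suc d)) ℚ.+_) (trans (lin-· (y ^^_) (ℚ.- a)
        (elementary n d ++ ratioTail n (a ∷ S) d))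
      (cong (ℚ.- a ℚ.*_) (lin-++ (y ^^_) (elementary n d) (ratioTail n (a ∷ S) d)))))))))

eval-elementary : ∀ d a (y : Vec ℚ n) →
  eval (a ∷ y) (elementary (suc n) d) ≡ eval y (elementary n d) ℚ.+ a ℚ.* eval y (preElementary n d)
eval-elementary {n} d a y = trans (cong (eval (a ∷ y)) (elementary-suc n d))
  (trans (lin-++ ((a ∷ y) ^^_) (cons 0 (elementary n d)) _) (cong₂ ℚ._+_
    (trans (lin-cons _ 0 (elementary n d)) (lin-cong (λ μ → ℚ.*-identityˡ (y ^^ μ)) (elementary n d)))
    (trans (lin-cons _ 1 (preElementary n d)) (trans (lin-cong
        (λ μ → cong (ℚ._* y ^^ μ) (ℚ.*-identityʳ a)) (preElementary n d))
      (lin-*ˡ a (y ^^_) (preElementary n d))))))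

ratio-∷-zero : ∀ S a (y : Vec ℚ n) → ratio S 0 (a ∷ y) ≡ ratio S 0 y
ratio-∷-zero []      a y = trans (eval-elementary 0 a y)
    (trans (cong (eval y (elementary _ 0) ℚ.+_) (ℚ.*-zeroʳ a)) (ℚ.+-identityʳ (eval y (elementary _ 0))))
ratio-∷-zero (b ∷ S) a y = ratio-∷-zero S a y

ratio-∷-suc : ∀ S d a (y : Vec ℚ n) → ratio S (suc d) (a ∷ y) ≡ ratio S (suc d) y ℚ.+ a ℚ.* ratio S d y
ratio-∷-suc []      d       a y = eval-elementary (suc d) a y
ratio-∷-suc (b ∷ S) zero    a y = trans (cong₂ (λ u v → u ℚ.+ ℚ.- b ℚ.* v) (ratio-∷-suc S zero a y)
    (ratio-∷-zero S a y))
  (lemma a b (ratio S 1 y) (ratio S 0 y))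
  where
  lemma : ∀ a b u v → u ℚ.+ a ℚ.* v ℚ.+ ℚ.- b ℚ.* v ≡ u ℚ.+ ℚ.- b ℚ.* v ℚ.+ a ℚ.* v
  lemma = solve-∀ ℚ-ring
ratio-∷-suc (b ∷ S) (suc d) a y = trans (cong₂ (λ u v → u ℚ.+ ℚ.- b ℚ.* v) (ratio-∷-suc S (suc d) a y)
    (ratio-∷-suc (b ∷ S) d a y))
  (lemma a b (ratio S (suc (suc d)) y) (ratio S (suc d) y) (ratio (b ∷ S) (suc d) y) (ratio (b ∷ S) d y))
  where
  lemma : ∀ a b u v w z → u ℚ.+ a ℚ.* v ℚ.+ ℚ.- b ℚ.* (w ℚ.+ a ℚ.* z)
                        ≡ u ℚ.+ ℚ.- b ℚ.* w ℚ.+ a ℚ.* (v ℚ.+ ℚ.- b ℚ.* z)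
  lemma = solve-∀ ℚ-ring

-- The new coordinate brings a factor 1 + a t, which cancels the denominator belonging to the
-- occurrence of a in S.
ratio-take : ∀ {S a} (a∈S : a ∈ S) d (y : Vec ℚ n) → ratio S d (a ∷ y) ≡ ratio (S ─ a∈S) d y
ratio-take {S = a ∷ S} (here refl) zero    y = ratio-∷-zero S a y
ratio-take {S = a ∷ S} (here refl) (suc d) y =
  trans (cong₂ (λ u v → u ℚ.+ ℚ.- a ℚ.* v) (ratio-∷-suc S d a y) (ratio-take {S = a ∷ S} (here refl) d y))
  (lemma a (ratio S (suc d) y) (ratio S d y))
  where
  lemma : ∀ a u v → u ℚ.+ a ℚ.* v ℚ.+ ℚ.- a ℚ.* v ≡ u
  lemma = solve-∀ ℚ-ring
ratio-take {S = b ∷ S} (there a∈) zero    y = ratio-take a∈ zero y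
ratio-take {S = b ∷ S} (there a∈) (suc d) y =
  cong₂ (λ u v → u ℚ.+ ℚ.- b ℚ.* v) (ratio-take a∈ (suc d) y) (ratio-take {S = b ∷ S} (there a∈) d y)

module _ (αs : List ℚ) where

  -- On a point containing S the ratio is the polynomial ∏ (1 + yᵢ t) over
  -- the coordinates outside S.
  ratio-vanishes : ∀ {S d} {y : Vec ℚ n} → Point αs S y → n < d ℕ.+ length S → ratio S d y ≡ 0ℚ
  ratio-vanishes {d = suc d} []            _  = refl
  ratio-vanishes {n = suc n} {d = d} (take {y = y} a∈S pt) lt = trans (ratio-take a∈S d y)
      (ratio-vanishes {d = d} pt
    (ℕ.≤-pred (subst (suc n <_) (trans (cong (d ℕ.+_) (sym (length-─ a∈S))) (ℕ.+-suc d _)) lt)))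
  ratio-vanishes {d = zero}  (skip {S = S} {a = a} {y = y} _ pt) lt = trans (ratio-∷-zero S a y)
      (ratio-vanishes {d = zero} pt (ℕ.<-trans ℕ.≤-refl lt))
  ratio-vanishes {d = suc d} (skip {S = S} {a = a} {y = y} _ pt) (s≤s lt) = trans (ratio-∷-suc S d a y)
    (trans (cong₂ (λ u v → u ℚ.+ a ℚ.* v) (ratio-vanishes {d = suc d} pt (ℕ.m<n⇒m<1+n lt))
        (ratio-vanishes {d = d} pt lt))
    (trans (ℚ.+-identityˡ _) (ℚ.*-zeroʳ a)))

  private k = length αs

  point⊆αs : ∀ {S} {y : Vec ℚ n} → All (_∈ αs) S → Point αs S y → ∀ i → Vec.lookup y i ∈ αs
  point⊆αs S⊆ (take a∈S _)  zero    = All.lookup S⊆ a∈S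
  point⊆αs S⊆ (take a∈S pt) (suc i) = point⊆αs (All.─⁺ a∈S S⊆) pt i
  point⊆αs S⊆ (skip a∈ _)   zero    = a∈
  point⊆αs S⊆ (skip _ pt)   (suc i) = point⊆αs S⊆ pt i

  module _ (S : List ℚ) (S⊆ : All (_∈ αs) S) where

    private s = length S

    -- The homogeneous components of p are leading forms of polynomials
    -- vanishing on all points.
    LeadingForms : Poly n → Set
    LeadingForms {n} p = ∀ d → ∃ λ l → Terms (λ μ → deg μ < d) l ×
      (∀ {y : Vec ℚ n} → Point αs S y → lin (restrict d (y ^^_)) p ℚ.+ eval y l ≡ 0ℚ)

    homogeneous-leadingForm : ∀ {e} {p : Poly n} → Terms (λ μ → deg μ ≡ e) p →
      (∃ λ l → Terms (λ μ → deg μ < e) l × (∀ {y} → Point αs S y → eval y p ℚ.+ eval y l ≡ 0ℚ)) →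
          LeadingForms p
    homogeneous-leadingForm {e = e} {p} h (l , lt , van) d with e ℕ.≟ d
    ... | yes refl = l , lt , λ {y} pt → trans (cong (ℚ._+ eval y l) (lin-cong-Terms (restrict-≡ d (y ^^_)) h)) (van pt)
    ... | no e≢d   = [] , [] , λ {y} _ → trans (ℚ.+-identityʳ _)
        (trans (lin-cong-Terms (λ { μ refl → restrict-≢ d (y ^^_) μ e≢d }) h) (lin-0 p))

    -- The generators are completed by `rootTail` and `ratioTail`. Multiplication by a term
    -- multiplies a component and its completion by the same monomial, which keeps both the
    -- vanishing and the gap in degree.
    ideal⇒leadingForms : ∀ {p : Poly n} → Ideal (Gen k s) p → LeadingForms p
    ideal⇒leadingForms {n} = Ideal-induction LeadingForms gen (λ d → [] , [] , λ _ → refl) (λ {p} {q} → plus {p} {q}) term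
      λ {p} {q} e L d → let l , lt , van = L d in l , lt , λ {y} pt → trans (cong (ℚ._+ eval y l) (sym (on e _))) (van pt)
      where
      gen : ∀ {p : Poly n} → Gen k s p → LeadingForms p
      gen (power i) = homogeneous-leadingForm (subst (Terms _) (sym (x^ᴾ i k)) (deg-unit i k ∷ []))
        (rootTail i αs , rootTail-degree i αs , λ {y} pt → trans
          (cong (ℚ._+ eval y (rootTail i αs)) (trans (cong (eval y) (x^ᴾ i k)) (eval-term y (unit i k))))
          (rootTail-vanishes i αs y (point⊆αs S⊆ pt i)))
      gen (elem d lt) = homogeneous-leadingForm (elementary-degree n d)
        (ratioTail n S d , ratioTail-degree n S d , λ {y} pt → trans (sym (ratio-tail S d y)) (ratio-vanishes {d = d} pt lt))

      plus : ∀ {p q : Poly n} → LeadingForms p → LeadingForms q → LeadingForms (p +ᴾ q)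
      plus {p} {q} L M d with L d | M d
      ... | l , lt , van | l′ , lt′ , van′ = l ++ l′ , All.++⁺ lt lt′ , λ {y} pt →
        trans (cong₂ ℚ._+_ (lin-++ (restrict d (y ^^_)) p q) (lin-++ (y ^^_) l l′))
        (trans (lemma (lin (restrict d (y ^^_)) p) (lin (restrict d (y ^^_)) q) (eval y l) (eval y l′))
        (trans (cong₂ ℚ._+_ (van pt) (van′ pt)) (ℚ.+-identityʳ 0ℚ)))
        where
        lemma : ∀ a b c d → (a ℚ.+ b) ℚ.+ (c ℚ.+ d) ≡ (a ℚ.+ c) ℚ.+ (b ℚ.+ d)
        lemma = solve-∀ ℚ-ring

      term : ∀ c μ {q : Poly n} → LeadingForms q → LeadingForms (((c , μ) ∷ []) *ᴾ q)
      term c μ {q} L d with deg μ ℕ.≤? d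
      ... | no nl = [] , [] , λ {y} _ → trans (ℚ.+-identityʳ _) (trans (lin-*-term (restrict d (y ^^_)) c μ q)
        (trans (cong (c ℚ.*_) (trans (lin-cong (λ ν → restrict-≢ d (y ^^_) (μ ∙ ν) λ e → nl
            (subst (deg μ ≤_) (trans (sym (deg-∙ μ ν)) e) (ℕ.m≤m+n _ _))) q) (lin-0 q)))
        (ℚ.*-zeroʳ c)))
      ... | yes le with L (d ℕ.∸ deg μ)
      ...   | l , lt , van = ((c , μ) ∷ []) *ᴾ l ,
        Terms-term-* {Q = λ ν → deg ν < d ℕ.∸ deg μ} c μ
          (λ {ν} lt → subst₂ _<_ (sym (deg-∙ μ ν)) (ℕ.m+[n∸m]≡n le) (ℕ.+-monoʳ-< (deg μ) lt)) lt ,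
        λ {y} pt → trans (cong₂ ℚ._+_ (trans (lin-*-term (restrict d (y ^^_)) c μ q)
            (cong (c ℚ.*_) (trans (lin-cong (shift y) q)
                (lin-*ˡ (y ^^ μ) (restrict (d ℕ.∸ deg μ) (y ^^_)) q))))
            (eval-*-term y c μ l))
          (trans (lemma c (y ^^ μ) (lin (restrict (d ℕ.∸ deg μ) (y ^^_)) q) (eval y l))
          (trans (cong (λ w → c ℚ.* (y ^^ μ ℚ.* w)) (van pt))
          (trans (cong (c ℚ.*_) (ℚ.*-zeroʳ (y ^^ μ))) (ℚ.*-zeroʳ c))))
        where
        lemma : ∀ c u a b → c ℚ.* (u ℚ.* a) ℚ.+ c ℚ.* (u ℚ.* b) ≡ c ℚ.* (u ℚ.* (a ℚ.+ b))
        lemma = solve-∀ ℚ-ring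

        shift : ∀ (y : Vec ℚ n) ν → restrict d (y ^^_) (μ ∙ ν) ≡ y ^^ μ ℚ.* restrict (d ℕ.∸ deg μ) (y ^^_) ν
        shift y ν with deg ν ℕ.≟ d ℕ.∸ deg μ
        ... | yes e = trans (restrict-≡ d (y ^^_) (μ ∙ ν)
            (trans (deg-∙ μ ν) (trans (cong (deg μ ℕ.+_) e) (ℕ.m+[n∸m]≡n le))))
            (trans (^^-∙ y μ ν) (cong (y ^^ μ ℚ.*_) (sym (restrict-≡ (d ℕ.∸ deg μ) (y ^^_) ν e))))
        ... | no ne = trans (restrict-≢ d (y ^^_) (μ ∙ ν) λ e → ne
              (trans (sym (ℕ.m+n∸m≡n (deg μ) (deg ν))) (cong (ℕ._∸ deg μ) (trans (sym (deg-∙ μ ν)) e))))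
            (sym (trans (cong (y ^^ μ ℚ.*_) (restrict-≢ (d ℕ.∸ deg μ) (y ^^_) ν ne)) (ℚ.*-zeroʳ (y ^^ μ))))

spanned⇒basis : ∀ {k s} {p : Poly n} → Spanned k s p → ∃ λ b → Terms (InB k s) b × Ideal (Gen k s) (p +ᴾ -ᴾ b)
spanned⇒basis (basis c {μ} μ∈) = (c , μ) ∷ [] , μ∈ ∷ [] , resp-≋ (mk≋ λ φ → sym (lemma c (φ μ))) 0∈
  where
  lemma : ∀ c a → c ℚ.* a ℚ.+ (ℚ.- 1ℚ ℚ.* c ℚ.* a ℚ.+ 0ℚ) ≡ 0ℚ
  lemma = solve-∀ ℚ-ring
spanned⇒basis (ideal {p = p} I) = [] , [] , resp-≋ (mk≋ λ φ → sym (trans (lin-++ φ p []) (ℚ.+-identityʳ _))) I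
spanned⇒basis {k = k} (sum {p = p} {q} a a′) with spanned⇒basis a | spanned⇒basis a′
... | b , h , I | b′ , h′ , I′ = b ++ b′ , All.++⁺ h h′ , resp-≋ (mk≋ λ φ →
    trans (lin-++ φ (p +ᴾ -ᴾ b) (q +ᴾ -ᴾ b′))
    (trans (cong₂ ℚ._+_ (lin-- k φ p b) (lin-- k φ q b′))
    (trans (lemma (lin φ p) (lin φ q) (lin φ b) (lin φ b′))
    (sym (trans (lin-- k φ (p +ᴾ q) (b ++ b′)) (cong₂ (λ u v → u ℚ.+ ℚ.- 1ℚ ℚ.* v) (lin-++ φ p q) (lin-++ φ b b′)))))))
  (+-closed I I′)
  where
  lemma : ∀ a b c d → (a ℚ.+ ℚ.- 1ℚ ℚ.* c) ℚ.+ (b ℚ.+ ℚ.- 1ℚ ℚ.* d) ≡ (a ℚ.+ b) ℚ.+ ℚ.- 1ℚ ℚ.* (c ℚ.+ d)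
  lemma = solve-∀ ℚ-ring
spanned⇒basis {k = k} (respects {p = p} {q} e a) with spanned⇒basis a
... | b , h , I = b , h , resp-≋ (mk≋ λ φ → trans (lin-- k φ p b) (trans (cong (ℚ._+ ℚ.- 1ℚ ℚ.* lin φ b) (on e φ)) (sym (lin-- k φ q b)))) I

-- A reduction obtained from `spanned` may mix degrees. Since the ideal is homogeneous, the
-- component of degree d of the whole congruence can be taken.
graded-basis : ∀ k s d (p : Poly n) → Terms (λ μ → deg μ ≡ d) p →
  ∃ λ b → Terms (λ μ → InB k s μ × deg μ ≡ d) b × Ideal (Gen k s) (p +ᴾ -ᴾ b)
graded-basis {n} k s d p h with spanned⇒basis (spanned k n s p)
... | b , hb , I = comp d b , Terms-comp d hb , resp-≋ (mk≋ λ φ →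
    trans (lin-comp φ d (p +ᴾ -ᴾ b))
    (trans (lin-- k (restrict d φ) p b)
    (trans (cong₂ (λ u v → u ℚ.+ ℚ.- 1ℚ ℚ.* v) (trans (sym (lin-comp φ d p)) (on (comp-homogeneous h) φ))
        (sym (lin-comp φ d b)))
    (sym (lin-- k φ p (comp d b))))))
  (comp-closed I d)

module _ (αs : List ℚ) (uα : Unique αs) (S : List ℚ) (u : Unique S) (S⊆ : All (_∈ αs) S)
    (s≤k : length S ≤ length αs) where

  private
    k = length αs
    s = length S

  -- A term of degree d is congruent to a homogeneous combination of basis monomials. Their
  -- difference lies in the ideal, so on the points it equals a polynomial of lower degree, to which
  -- the same reduction applies.
  reduce : ∀ d (l : Poly n) → Terms (λ μ → deg μ < d) l →
    ∃ λ b → Terms (λ μ → InB k s μ × deg μ < d) b × (∀ {y} → Point αs S y → eval y l ≡ eval y b)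
  reduce-term : ∀ d c (μ : Monomial n) → deg μ ≤ d →
    ∃ λ b → Terms (λ μ → InB k s μ × deg μ < suc d) b × (∀ {y} → Point αs S y → eval y
        ((c , μ) ∷ []) ≡ eval y b)

  reduce d       []            []              = [] , [] , λ _ → refl
  reduce (suc d) ((c , μ) ∷ l) (s≤s μ≤d ∷ lt) with reduce-term d c μ μ≤d | reduce (suc d) l lt
  ... | b , h , e | b′ , h′ , e′ = b ++ b′ , All.++⁺ h h′ , λ {y} pt →
    trans (lin-++ (y ^^_) ((c , μ) ∷ []) l) (trans (cong₂ ℚ._+_ (e pt) (e′ pt)) (sym (lin-++ (y ^^_) b b′)))

  reduce-term d c μ μ≤d with ℕ.m≤n⇒m<n∨m≡n μ≤d
  ... | inj₁ μ<d = let b , h , e = reduce d ((c , μ) ∷ []) (μ<d ∷ []) in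
        b , All.map (λ (a , lt) → a , ℕ.m<n⇒m<1+n lt) h , e
  ... | inj₂ μ≡d with graded-basis k s d ((c , μ) ∷ []) (μ≡d ∷ [])
  ...   | b , h , I with ideal⇒leadingForms αs S S⊆ I d
  ...     | l , lt , van with reduce d l lt
  ...       | b′ , h′ , e′ = b +ᴾ -ᴾ b′ ,
        All.++⁺ (All.map (λ (a , e) → a , s≤s (ℕ.≤-reflexive e)) h)
                (Terms-· {P = λ μ → InB k s μ × deg μ < suc d} (ℚ.- 1ℚ)
                    (All.map (λ (a , lt) → a , ℕ.m<n⇒m<1+n lt) h′)) ,
        λ {y} pt → trans
          (solve-for {b = eval y b} (trans (sym (cong (ℚ._+ eval y l)
            (trans (lin-cong-Terms (restrict-≡ d (y ^^_))
                (All.++⁺ {xs = (c , μ) ∷ []} (μ≡d ∷ []) (Terms-· {P = λ μ → deg μ ≡ d} (ℚ.- 1ℚ)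
                (All.map proj₂ h))))
                   (lin-- k (y ^^_) ((c , μ) ∷ []) b)))) (van pt)))
          (trans (cong (λ w → eval y b ℚ.+ ℚ.- 1ℚ ℚ.* w) (e′ pt)) (sym (lin-- k (y ^^_) b b′)))
        where
        solve-for : ∀ {a b c} → a ℚ.+ ℚ.- 1ℚ ℚ.* b ℚ.+ c ≡ 0ℚ → a ≡ b ℚ.+ ℚ.- 1ℚ ℚ.* c
        solve-for {a} {b} {c} e = trans (lemma a b c) (trans (cong (ℚ._+ (b ℚ.+ ℚ.- 1ℚ ℚ.* c)) e)
            (ℚ.+-identityˡ _))
          where
          lemma : ∀ a b c → a ≡ (a ℚ.+ ℚ.- 1ℚ ℚ.* b ℚ.+ c) ℚ.+ (b ℚ.+ ℚ.- 1ℚ ℚ.* c)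
          lemma = solve-∀ ℚ-ring

  -- Complete the component of p in degree d to a polynomial vanishing on the points and reduce the
  -- completion to basis monomials of degree less than d. The result is supported on the basis,
  -- hence 0, and in degree d it still has the coefficients of p.
  ideal∩basis≡0 : ∀ (p : Poly n) → (∀ μ → ¬ InB k s μ → coeff p μ ≡ 0ℚ) → Ideal (Gen k s) p → ∀ ν →
      coeff p ν ≡ 0ℚ
  ideal∩basis≡0 p support I ν with ideal⇒leadingForms αs S S⊆ I (deg ν)
  ... | l , lt , van with reduce (deg ν) l lt
  ...   | b , h , e = trans (sym (trans (coeff-+ (comp d p) b ν)
        (trans (cong₂ ℚ._+_ (coeff-comp-≡ p refl) (coeff-∉ h λ (_ , lt) → ℕ.<-irrefl refl lt))
            (ℚ.+-identityʳ _))))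
      (vanishing⇒zero αs uα S s refl s≤k u S⊆ (comp d p +ᴾ b) support′
        (λ {y} pt → trans (lin-++ (y ^^_) (comp d p) b)
          (trans (cong₂ ℚ._+_ (lin-comp (y ^^_) d p) (sym (e pt))) (van pt))) ν)
    where
    d = deg ν
    support′ : ∀ μ → ¬ InB k s μ → coeff (comp d p +ᴾ b) μ ≡ 0ℚ
    support′ μ μ∉ = trans (coeff-+ (comp d p) b μ) (cong₂ ℚ._+_ (left (deg μ ℕ.≟ d))
        (coeff-∉ h λ (μ∈ , _) → μ∉ μ∈))
      where
      left : Dec (deg μ ≡ d) → coeff (comp d p) μ ≡ 0ℚ
      left (yes e) = trans (coeff-comp-≡ p e) (support μ μ∉)
      left (no ne) = coeff-comp-≢ p ne

-- Dimensions

module _ {G H : Poly n → Set} (G⊆H : ∀ {p} → G p → Ideal H p) where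

  Ideal-mono : ∀ {p} → Ideal G p → Ideal H p
  Ideal-mono (generator g)  = G⊆H g
  Ideal-mono 0∈             = 0∈
  Ideal-mono (+-closed a b) = +-closed (Ideal-mono a) (Ideal-mono b)
  Ideal-mono (*-closed p a) = *-closed p (Ideal-mono a)
  Ideal-mono (resp-≈ e a)   = resp-≈ e (Ideal-mono a)

Generator⇒Gen : ∀ {k} {p : Poly n} → Ideal (Generator n k) p → Ideal (Gen k k) p
Generator⇒Gen {n} {k} = Ideal-mono λ where
  (power i)    → generator (power i)
  (elem d l _) → generator (elem d (ℕ.≤-trans (ℕ.≤-trans (s≤s (ℕ.m≤n+m∸n n k))
    (ℕ.≤-reflexive (trans (sym (ℕ.+-suc k (n ℕ.∸ k))) (trans (ℕ.+-comm k _)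
        (cong (ℕ._+ k) (ℕ.+-comm 1 (n ℕ.∸ k)))))))
    (ℕ.+-monoˡ-≤ k l)))

Gen⇒Generator : ∀ {k} → k ≤ n → {p : Poly n} → Ideal (Gen k k) p → Ideal (Generator n k) p
Gen⇒Generator {n} {k} k≤n = Ideal-mono include
  where
  include : ∀ {p} → Gen k k p → Ideal (Generator n k) p
  include (power i)   = generator (power i)
  include (elem d lt) with d ℕ.≤? n
  ... | yes d≤n = generator (elem d (ℕ.≤-trans (ℕ.≤-reflexive
      (trans (ℕ.+-comm (n ℕ.∸ k) 1) (sym (ℕ.+-∸-assoc 1 k≤n))))
                    (ℕ.m≤n+o⇒m∸n≤o (suc n) k (subst (suc n ≤_) (ℕ.+-comm d k) lt))) d≤n)
  -- `Gen` places no upper bound on d, but the additional generators are 0.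
  ... | no d≰n  = subst (Ideal _) (sym (elementary-> n (ℕ.≰⇒> d≰n))) 0∈

-- Any k distinct rationals would serve. Written directly as fractions with denominator 1, they are
-- distinct by injectivity of constructors.
nodes : ℕ → List ℚ
nodes k = List.map (λ j → ℚ.mkℚ (pos j) 0 (Coprime.sym (Coprime.1-coprimeTo j))) (List.upTo k)

nodes-unique : ∀ k → Unique (nodes k)
nodes-unique k = Unique.map⁺ (λ { refl → refl }) (Unique.upTo⁺ k)

length-nodes : ∀ k → length (nodes k) ≡ k
length-nodes k = trans (List.length-map _ (List.upTo k)) (List.length-upTo k)

ideal∩span≡0 : ∀ {k} (p : Poly n) → (∀ μ → ¬ InB k k μ → coeff p μ ≡ 0ℚ) → Ideal (Generator n k) p → p ≈ᴾ []
-- All nodes are prescribed, so s = k and the points are the surjective words in the nodes.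
ideal∩span≡0 {k = k} p support I = ideal∩basis≡0 (nodes k) (nodes-unique k) (nodes k) (nodes-unique k)
  (All.tabulate λ a∈ → a∈) ℕ.≤-refl p
  (λ μ μ∉ → support μ λ μ∈ → μ∉ (subst (λ l → InB l l μ) (sym (length-nodes k)) μ∈))
  (subst (λ l → Ideal (Gen l l) p) (sym (length-nodes k)) (Generator⇒Gen I))

combine : (L : List (Monomial n)) → Vector ℚ (length L) → Poly n
combine []      c = []
combine (μ ∷ L) c = (c zero , μ) ∷ combine L (c ∘ suc)

lin-combine : ∀ {k} φ (L : List (Monomial n)) c →
  lin φ (linearCombination (R n k) c (λ i → (1ℚ , List.lookup L i) ∷ [])) ≡ lin φ (combine L c)
lin-combine φ []      c = refl
lin-combine {k = k} φ (μ ∷ L) c = cong₂ ℚ._+_ (cong (ℚ._* φ μ) (ℚ.*-identityʳ (c zero)))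
    (lin-combine {k = k} φ L (c ∘ suc))

combine-terms : ∀ (L : List (Monomial n)) c → Terms (_∈ L) (combine L c)
combine-terms []      c = []
combine-terms (μ ∷ L) c = here refl ∷ All.map there (combine-terms L (c ∘ suc))

coeff-combine : ∀ {L : List (Monomial n)} → Unique L → ∀ c i → coeff (combine L c) (List.lookup L i) ≡ c i
coeff-combine {L = μ ∷ L} (μ∉ ∷ u) c zero = trans (cong₂ ℚ._+_
  (head (μ ≟ᴹ μ)) (coeff-∉ (combine-terms L (c ∘ suc)) λ μ∈ → All.lookup μ∉ μ∈ refl)) (ℚ.+-identityʳ (c zero))
  where
  head : (d : Dec (μ ≡ μ)) → (if does d then c zero else 0ℚ) ≡ c zero
  head (yes _) = refl
  head (no ne) = contradiction refl ne
coeff-combine {L = μ ∷ L} (μ∉ ∷ u) c (suc i) = trans (cong₂ ℚ._+_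
  (head (μ ≟ᴹ List.lookup L i)) (coeff-combine u (c ∘ suc) i)) (ℚ.+-identityˡ (c (suc i)))
  where
  head : (d : Dec (μ ≡ List.lookup L i)) → (if does d then c zero else 0ℚ) ≡ 0ℚ
  head (yes e) = contradiction e (All.lookup μ∉ (∈.∈-lookup i))
  head (no _)  = refl

≈-combine : ∀ {L : List (Monomial n)} → Unique L → ∀ p → Terms (_∈ L) p → p ≈ᴾ combine L
    (λ i → coeff p (List.lookup L i))
≈-combine {L = L} u p p⊆L ν with Any.any? (ν ≟ᴹ_) L
... | no ν∉  = trans (coeff-∉ p⊆L ν∉) (sym (coeff-∉ (combine-terms L _) ν∉))
... | yes ν∈ = trans (cong (coeff p) (Any.lookup-index ν∈))
  (sym (trans (cong (coeff (combine L _)) (Any.lookup-index ν∈))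
      (coeff-combine u (λ i → coeff p (List.lookup L i)) (Any.index ν∈))))

module _ {n k} (k≤n : k ≤ n) where

  open LeftModule (R n k) using (_≈ᴹ_; ≈ᴹ-refl; ≈ᴹ-sym; ≈ᴹ-trans)

  ≋⇒≈ᴹ : ∀ {p q : Poly n} → p ≋ q → p ≈ᴹ q
  ≋⇒≈ᴹ {p} {q} e = mod (resp-≋ (mk≋ λ φ → sym (trans (lin-- k φ p q)
    (trans (cong (ℚ._+ ℚ.- 1ℚ ℚ.* lin φ q) (on e φ)) (trans
        (cong (lin φ q ℚ.+_) (sym (ℚ.neg-distribˡ-* 1ℚ (lin φ q))))
    (trans (cong (λ w → lin φ q ℚ.+ ℚ.- w) (ℚ.*-identityˡ (lin φ q))) (ℚ.+-inverseʳ (lin φ q))))))) 0∈)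

  hasDimension : (W : Pred (Poly n) _) (L : List (Monomial n)) → Unique L →
    (∀ {μ} → μ ∈ L → InB k k μ) →
    (∀ {μ} → μ ∈ L → W ((1ℚ , μ) ∷ [])) →
    (∀ v → W v → ∃ λ b → Terms (_∈ L) b × v ≈ᴹ b) →
    HasDimension (R n k) W (length L)
  hasDimension W L u L⊆B L⊆W span = (λ i → (1ℚ , List.lookup L i) ∷ []) , record
    { contained   = λ i → L⊆W (∈.∈-lookup i)
    ; independent = λ c (mod I) i → trans (sym (coeff-combine u c i))
        (ideal∩span≡0 (combine L c)
          (λ μ μ∉ → coeff-∉ (combine-terms L c) λ μ∈ → μ∉ (L⊆B μ∈))
          (resp-≋ (mk≋ λ φ → trans (lin-++ φ (linearCombination (R n k) c _) [])
            (trans (ℚ.+-identityʳ (lin φ (linearCombination (R n k) c _))) (lin-combine {k = k} φ L c))) I)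
          (List.lookup L i))
    ; spanning    = λ v w → let b , b⊆L , e = span v w in
        (λ i → coeff b (List.lookup L i)) ,
        ≈ᴹ-trans e (≋⇒≈ᴹ (mk≋ λ φ → trans (≈⇒lin {p = b} {combine L _} (≈-combine u b b⊆L) φ)
          (sym (lin-combine {k = k} φ L _))))
    }

  component-dimension : ∀ (L : List (Monomial n)) → Unique L → (∀ {μ} → μ ∈ L ⇔ InB k k μ) → ∀ d →
    HasDimension (R n k) (R-component n k d) (length (List.filter (λ μ → deg μ ℕ.≟ d) L))
  component-dimension L u L⇔B d = hasDimension (R-component n k d) (List.filter (λ μ → deg μ ℕ.≟ d) L)
    (Unique.filter⁺ (λ μ → deg μ ℕ.≟ d) u)
    (λ μ∈ → Equivalence.to L⇔B (proj₁ (∈.∈-filter⁻ (λ μ → deg μ ℕ.≟ d) {xs = L} μ∈)))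
    (λ {μ} μ∈ → (1ℚ , μ) ∷ [] , homogeneous μ (proj₂ (∈.∈-filter⁻ (λ μ → deg μ ℕ.≟ d) {xs = L} μ∈)) , ≈ᴹ-refl)
    span
    where
    homogeneous : ∀ (μ : Monomial n) → deg μ ≡ d → Homogeneous d ((1ℚ , μ) ∷ [])
    homogeneous μ e ν ne with μ ≟ᴹ ν
    ... | yes refl = e
    ... | no _     = contradiction refl ne

    span : ∀ v → R-component n k d v → ∃ λ b → Terms (_∈ List.filter (λ μ → deg μ ℕ.≟ d) L) b × v ≈ᴹ b
    -- The list h may contain terms of other degrees that cancel. `comp d h` represents the same
    -- polynomial without them, as `graded-basis` requires.
    span v (h , hom , h∼v) with graded-basis k k d (comp d h)
        (All.map proj₂ (Terms-comp {P = λ _ → U tt} d (All.universal (λ _ → tt) h)))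
    ... | b , hb , I = b , All.map (λ (μ∈ , e) → ∈.∈-filter⁺ (λ μ → deg μ ℕ.≟ d)
        (Equivalence.from L⇔B μ∈) e) hb ,
      ≈ᴹ-trans (≈ᴹ-sym h∼v) (≈ᴹ-trans (≋⇒≈ᴹ (≋-sym (≈⇒≋ comp≈h))) (mod (Gen⇒Generator k≤n I)))
      where
      comp≈h : comp d h ≈ᴾ h
      comp≈h ν with deg ν ℕ.≟ d
      ... | yes e = coeff-comp-≡ h e
      ... | no ne with coeff h ν ℚ.≟ 0ℚ
      ...   | yes z = trans (coeff-comp-≢ h ne) (sym z)
      ...   | no nz = contradiction (hom ν nz) ne

  total-dimension : ∀ (L : List (Monomial n)) → Unique L → (∀ {μ} → μ ∈ L ⇔ InB k k μ) → HasDimension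
      (R n k) U (length L)
  total-dimension L u L⇔B = hasDimension U L u (Equivalence.to L⇔B) (λ _ → tt) λ v _ →
    let b , hb , I = spanned⇒basis (spanned k n k v) in
    b , All.map (Equivalence.from L⇔B) hb , mod (Gen⇒Generator k≤n I)

-- Counting the basis monomials

-- Here r is k - s, the number of exponents i with s ≤ i < k. Recursion on the pair, with s + r
-- constant, avoids subtraction.
basisMonomials : ∀ n (s r : ℕ) → List (Monomial n)
basisMonomials zero    zero    r = [] ∷ []
basisMonomials zero    (suc s) r = []
basisMonomials (suc n) zero    r = List.cartesianProductWith _∷_ (List.upTo r) (basisMonomials n zero r)
basisMonomials (suc n) (suc s) r =
  List.cartesianProductWith _∷_ (List.upTo (suc s)) (basisMonomials n s (suc r)) ++
  List.cartesianProductWith (λ i μ → suc s + i ∷ μ) (List.upTo r) (basisMonomials n (suc s) r)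

basisMonomials-unique : ∀ n s r → Unique (basisMonomials n s r)
basisMonomials-unique zero    zero    r = [] ∷ []
basisMonomials-unique zero    (suc s) r = []
basisMonomials-unique (suc n) zero    r =
  Unique.cartesianProductWith⁺ _∷_ Vec.∷-injective (Unique.upTo⁺ r) (basisMonomials-unique n zero r)
basisMonomials-unique (suc n) (suc s) r = Unique.++⁺
  (Unique.cartesianProductWith⁺ _∷_ Vec.∷-injective (Unique.upTo⁺ (suc s))
      (basisMonomials-unique n s (suc r)))
  (Unique.cartesianProductWith⁺ (λ i μ → suc s + i ∷ μ)
    (λ e → ℕ.+-cancelˡ-≡ (suc s) _ _ (Vec.∷-injectiveˡ e) , Vec.∷-injectiveʳ e) (Unique.upTo⁺ r)
        (basisMonomials-unique n (suc s) r))
  disjoint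
  where
  disjoint : ∀ {μ} → ¬ (μ ∈ List.cartesianProductWith _∷_ (List.upTo (suc s)) (basisMonomials n s (suc r)) ×
                        μ ∈ List.cartesianProductWith (λ i μ → suc s + i ∷ μ) (List.upTo r)
                            (basisMonomials n (suc s) r))
  disjoint (l , h) with ∈.∈-cartesianProductWith⁻ _∷_ (List.upTo (suc s)) _ l
                      | ∈.∈-cartesianProductWith⁻ (λ i μ → suc s + i ∷ μ) (List.upTo r) _ h
  ... | i , μ , i∈ , _ , refl | j , ν , _ , _ , e =
    ℕ.<⇒≱ (∈.∈-upTo⁻ i∈) (subst (suc s ≤_) (sym (Vec.∷-injectiveˡ e)) (ℕ.m≤m+n (suc s) j))

∈-basisMonomials : ∀ {k} n s r → s + r ≡ k → ∀ {μ} → μ ∈ basisMonomials n s r ⇔ InB k s μ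
∈-basisMonomials n s r e = mk⇔ (to n s r e) (from n s r e)
  where
  to : ∀ {k} n s r → s + r ≡ k → ∀ {μ} → μ ∈ basisMonomials n s r → InB k s μ
  to zero    zero    r e (here refl) = []
  to (suc n) zero    r refl μ∈ with ∈.∈-cartesianProductWith⁻ _∷_ (List.upTo r) _ μ∈
  ... | i , μ , i∈ , μ∈′ , refl = high z≤n (∈.∈-upTo⁻ i∈) (to n zero r refl μ∈′)
  to (suc n) (suc s) r refl μ∈ with ∈.∈-++⁻ (List.cartesianProductWith _∷_ (List.upTo (suc s))
      (basisMonomials n s (suc r))) μ∈
  ... | inj₁ l with ∈.∈-cartesianProductWith⁻ _∷_ (List.upTo (suc s)) _ l
  ...   | i , μ , i∈ , μ∈′ , refl = low (ℕ.≤-pred (∈.∈-upTo⁻ i∈)) (to n s (suc r) (ℕ.+-suc s r) μ∈′)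
  to (suc n) (suc s) r refl μ∈ | inj₂ h with ∈.∈-cartesianProductWith⁻ (λ i μ → suc s + i ∷ μ)
      (List.upTo r) _ h
  ...   | i , μ , i∈ , μ∈′ , refl = high (ℕ.m≤m+n (suc s) i) (ℕ.+-monoʳ-< (suc s) (∈.∈-upTo⁻ i∈))
      (to n (suc s) r refl μ∈′)

  from : ∀ {k} n s r → s + r ≡ k → ∀ {μ} → InB k s μ → μ ∈ basisMonomials n s r
  from zero    .0      r e []              = here refl
  from (suc n) zero    r refl (high _ i<k b) = ∈.∈-cartesianProductWith⁺ _∷_ (∈.∈-upTo⁺ i<k)
      (from n zero r refl b)
  from (suc n) (suc s) r refl (low i≤s b) =
    ∈.∈-++⁺ˡ (∈.∈-cartesianProductWith⁺ _∷_ (∈.∈-upTo⁺ (s≤s i≤s)) (from n s (suc r) (ℕ.+-suc s r) b))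
  from (suc n) (suc s) r refl (high {i = i} {μ = μ} s<i i<k b) =
    ∈.∈-++⁺ʳ _ (subst (λ j → j ∷ μ ∈ List.cartesianProductWith (λ i μ → suc s + i ∷ μ) (List.upTo r)
        (basisMonomials n (suc s) r))
      (ℕ.m+[n∸m]≡n s<i)
      (∈.∈-cartesianProductWith⁺ (λ i μ → suc s + i ∷ μ)
        (∈.∈-upTo⁺ (ℕ.+-cancelˡ-< (suc s) _ _ (subst (_< suc s + r) (sym (ℕ.m+[n∸m]≡n s<i)) i<k)))
        (from n (suc s) r refl b)))

∑ : List A → (A → ℕ) → ℕ
∑ []       f = 0
∑ (x ∷ xs) f = f x + ∑ xs f

∑-cong : ∀ (xs : List A) {f g} → (∀ x → f x ≡ g x) → ∑ xs f ≡ ∑ xs g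
∑-cong []       e = refl
∑-cong (x ∷ xs) e = cong₂ _+_ (e x) (∑-cong xs e)

∑-++ : ∀ (xs ys : List A) f → ∑ (xs ++ ys) f ≡ ∑ xs f + ∑ ys f
∑-++ []       ys f = refl
∑-++ (x ∷ xs) ys f = trans (cong (f x +_) (∑-++ xs ys f)) (sym (ℕ.+-assoc (f x) _ _))

∑-map : ∀ (g : A → B) xs f → ∑ (List.map g xs) f ≡ ∑ xs (f ∘ g)
∑-map g []       f = refl
∑-map g (x ∷ xs) f = cong (f (g x) +_) (∑-map g xs f)

∑-cartesianProductWith : ∀ (g : A → B → E) xs ys f →
  ∑ (List.cartesianProductWith g xs ys) f ≡ ∑ xs λ x → ∑ ys λ y → f (g x y)
∑-cartesianProductWith g []       ys f = refl
∑-cartesianProductWith g (x ∷ xs) ys f = trans (∑-++ (List.map (g x) ys) _ f)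
  (cong₂ _+_ (∑-map (g x) ys f) (∑-cartesianProductWith g xs ys f))

∑-*ˡ : ∀ (xs : List A) c f → ∑ xs (λ x → c * f x) ≡ c * ∑ xs f
∑-*ˡ []       c f = sym (ℕ.*-zeroʳ c)
∑-*ˡ (x ∷ xs) c f = trans (cong (c * f x +_) (∑-*ˡ xs c f)) (sym (ℕ.*-distribˡ-+ c (f x) _))

∑-*ʳ : ∀ (xs : List A) c f → ∑ xs (λ x → f x * c) ≡ ∑ xs f * c
∑-*ʳ []       c f = refl
∑-*ʳ (x ∷ xs) c f = trans (cong (f x * c +_) (∑-*ʳ xs c f)) (sym (ℕ.*-distribʳ-+ c (f x) _))

∑-+ : ∀ (xs : List A) f g → ∑ xs (λ x → f x + g x) ≡ ∑ xs f + ∑ xs g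
∑-+ []       f g = refl
∑-+ (x ∷ xs) f g = trans (cong (f x + g x +_) (∑-+ xs f g)) (lemma (f x) (g x) (∑ xs f) (∑ xs g))
  where
  lemma : ∀ a b c d → a + b + (c + d) ≡ a + c + (b + d)
  lemma = ℕ-solve-∀

∑-zero : ∀ (xs : List A) → ∑ xs (λ _ → 0) ≡ 0
∑-zero []       = refl
∑-zero (x ∷ xs) = ∑-zero xs

⟦_⟧ : Bool → ℕ
⟦ b ⟧ = if b then 1 else 0

∑-filter : ∀ {P : A → Set} (P? : Decidable P) xs f → ∑ (List.filter P? xs) f ≡ ∑ xs λ x → ⟦ does
    (P? x) ⟧ * f x
∑-filter P? []       f = refl
∑-filter P? (x ∷ xs) f with does (P? x)
... | true  = cong₂ _+_ (sym (ℕ.+-identityʳ (f x))) (∑-filter P? xs f)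
... | false = ∑-filter P? xs f

∑-1 : ∀ (xs : List A) → ∑ xs (λ _ → 1) ≡ length xs
∑-1 []       = refl
∑-1 (x ∷ xs) = cong suc (∑-1 xs)

length-filter≡∑ : ∀ {P : A → Set} (P? : Decidable P) xs → length (List.filter P? xs) ≡ ∑ xs λ x → ⟦ does
    (P? x) ⟧
length-filter≡∑ P? xs = trans (sym (∑-1 (List.filter P? xs)))
    (trans (∑-filter P? xs (λ _ → 1)) (∑-cong xs λ x → ℕ.*-identityʳ _))

∑-upTo-suc : ∀ n f → ∑ (List.upTo (suc n)) f ≡ f 0 + ∑ (List.upTo n) (f ∘ suc)
∑-upTo-suc n f = cong (f 0 +_) (trans (cong (λ xs → ∑ xs f) (sym (List.map-applyUpTo (λ i → i) suc n)))
    (∑-map suc (List.upTo n) f))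

-- The value of [ k ]q at q.
bracket : ℕ → ℕ → ℕ
bracket q zero    = 0
bracket q (suc k) = 1 + q * bracket q k

∑-powers : ∀ q k → ∑ (List.upTo k) (q ^_) ≡ bracket q k
∑-powers q zero    = refl
∑-powers q (suc k) = trans (∑-upTo-suc k (q ^_)) (cong suc
    (trans (∑-*ˡ (List.upTo k) q (q ^_)) (cong (q *_) (∑-powers q k))))

bracket-suc : ∀ q k → bracket q (suc k) ≡ bracket q k + q ^ k
bracket-suc q zero    = cong suc (ℕ.*-zeroʳ q)
bracket-suc q (suc k) = cong suc (trans (cong (q *_) (bracket-suc q k))
    (ℕ.*-distribˡ-+ q (bracket q k) (q ^ k)))

module _ (q : ℕ) where

  basisSeries : ℕ → ℕ → ℕ → ℕ
  basisSeries zero    zero    r = 1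
  basisSeries zero    (suc s) r = 0
  basisSeries (suc n) zero    r = bracket q r * basisSeries n zero r
  basisSeries (suc n) (suc s) r =
    bracket q (suc s) * basisSeries n s (suc r) + q ^ suc s * bracket q r * basisSeries n (suc s) r

  ∑-basisMonomials : ∀ n s r → ∑ (basisMonomials n s r) (λ μ → q ^ deg μ) ≡ basisSeries n s r
  ∑-shifted : ∀ n s r c m → ∑ (List.cartesianProductWith (λ i μ → c + i ∷ μ) (List.upTo m)
      (basisMonomials n s r)) (λ μ → q ^ deg μ)
    ≡ q ^ c * bracket q m * basisSeries n s r

  ∑-basisMonomials zero    zero    r = refl
  ∑-basisMonomials zero    (suc s) r = refl
  ∑-basisMonomials (suc n) zero    r = trans (∑-shifted n zero r 0 r)
      (cong (_* basisSeries n zero r) (ℕ.+-identityʳ (bracket q r)))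
  ∑-basisMonomials (suc n) (suc s) r = trans
    (∑-++ (List.cartesianProductWith _∷_ (List.upTo (suc s)) (basisMonomials n s (suc r))) _ _)
    (cong₂ _+_ (trans (∑-shifted n s (suc r) 0 (suc s)) (cong (_* basisSeries n s (suc r))
        (ℕ.+-identityʳ (bracket q (suc s)))))
               (∑-shifted n (suc s) r (suc s) r))

  ∑-shifted n s r c m = trans (∑-cartesianProductWith (λ i μ → c + i ∷ μ) (List.upTo m)
      (basisMonomials n s r) _)
    (trans (∑-cong (List.upTo m) λ i → trans
        (∑-cong (basisMonomials n s r) λ μ → trans (ℕ.^-distribˡ-+-* q (c + i) (deg μ))
            (cong (_* q ^ deg μ) (ℕ.^-distribˡ-+-* q c i)))
        (trans (∑-*ˡ (basisMonomials n s r) (q ^ c * q ^ i) _)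
            (cong (q ^ c * q ^ i *_) (∑-basisMonomials n s r))))
    (trans (∑-*ʳ (List.upTo m) (basisSeries n s r) (λ i → q ^ c * q ^ i)) (cong (_* basisSeries n s r)
      (trans (∑-*ˡ (List.upTo m) (q ^ c) (q ^_)) (cong (q ^ c *_) (∑-powers q m))))))

  basisSeries-< : ∀ {n s} r → n < s → basisSeries n s r ≡ 0
  basisSeries-< {zero}  {suc s} r _         = refl
  basisSeries-< {suc n} {suc s} r (s≤s n<s) rewrite basisSeries-< (suc r) n<s | basisSeries-< r (ℕ.m<n⇒m<1+n n<s)
    | ℕ.*-zeroʳ (bracket q (suc s)) | ℕ.*-zeroʳ (q ^ suc s * bracket q r) = refl

  -- For words over an alphabet of size s + r + 1 that use the first s letters,
  -- this separates those that use one further letter from those that do not.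
  basisSeries-split : ∀ n s r → basisSeries n s (suc r) ≡ basisSeries n (suc s) r + q ^
      (n ∸ s) * basisSeries n s r
  basisSeries-split zero    zero    r = refl
  basisSeries-split zero    (suc s) r = refl
  basisSeries-split (suc n) zero    r = trans (cong (bracket q (suc r) *_) (basisSeries-split n zero r))
    (trans (lemma q (bracket q r) (basisSeries n 1 r) (q ^ n) (basisSeries n 0 r))
    (cong (λ h → (1 + q * 0) * h + q * 1 * bracket q r * basisSeries n 1 r + q * q ^ n *
        (bracket q r * basisSeries n 0 r))
      (sym (basisSeries-split n zero r))))
    where
    lemma : ∀ q b h p h′ → (1 + q * b) * (h + p * h′) ≡ (1 + q * 0) *
        (h + p * h′) + q * 1 * b * h + q * p * (b * h′)
    lemma = ℕ-solve-∀
  basisSeries-split (suc n) (suc s) r = begin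
    bracket q (suc s) * basisSeries n s (suc (suc r)) + q ^ suc s * bracket q (suc r) * X
      ≡⟨ cong (λ h → bracket q (suc s) * h + q ^ suc s * bracket q (suc r) * X)
          (basisSeries-split n s (suc r)) ⟩
    bracket q (suc s) * (X + p * Y) + q ^ suc s * (1 + q * bracket q r) * X
      ≡⟨ lemma₁ q (bracket q (suc s)) X p Y (q ^ suc s) (bracket q r) ⟩
    (bracket q (suc s) + q ^ suc s) * X + q * q ^ suc s * bracket q r * X + p * (bracket q (suc s) * Y)
      ≡⟨ cong₂ (λ b h → b * X + q * q ^ suc s * bracket q r * h + p * (bracket q (suc s) * Y))
           (sym (bracket-suc q (suc s))) (basisSeries-split n (suc s) r) ⟩
    bracket q (suc (suc s)) * X + q * q ^ suc s * bracket q r * (Z + q ^ (n ∸ suc s) * W) + p *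
        (bracket q (suc s) * Y)
      ≡⟨ lemma₂ (bracket q (suc (suc s)) * X) q (q ^ suc s) (bracket q r) Z (q ^ (n ∸ suc s)) W p
          (bracket q (suc s) * Y) ⟩
    bracket q (suc (suc s)) * X + q * q ^ suc s * bracket q r * Z +
        (q ^ suc s * bracket q r * (q * q ^ (n ∸ suc s) * W) + p * (bracket q (suc s) * Y))
      ≡⟨ cong (λ h → bracket q (suc (suc s)) * X + q * q ^ suc s * bracket q r * Z +
          (q ^ suc s * bracket q r * h + p * (bracket q (suc s) * Y))) step ⟩
    bracket q (suc (suc s)) * X + q * q ^ suc s * bracket q r * Z +
        (q ^ suc s * bracket q r * (p * W) + p * (bracket q (suc s) * Y))
      ≡⟨ lemma₃ (bracket q (suc (suc s)) * X + q * q ^ suc s * bracket q r * Z)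
          (q ^ suc s * bracket q r) p W (bracket q (suc s) * Y) ⟩
    bracket q (suc (suc s)) * X + q * q ^ suc s * bracket q r * Z + p *
        (bracket q (suc s) * Y + q ^ suc s * bracket q r * W) ∎
    where
    open ≡-Reasoning
    X = basisSeries n (suc s) (suc r)
    Y = basisSeries n s (suc r)
    Z = basisSeries n (suc (suc s)) r
    W = basisSeries n (suc s) r
    p = q ^ (n ∸ s)

    -- The exponents agree only if s < n. Otherwise the subtraction is truncated, but then W is 0
    -- because there are fewer variables than required low steps.
    step : q * q ^ (n ∸ suc s) * W ≡ p * W
    step with n ℕ.≤? s
    ... | yes n≤s rewrite basisSeries-< {n} {suc s} r (s≤s n≤s) = trans (ℕ.*-zeroʳ (q * q ^ (n ∸ suc s))) (sym (ℕ.*-zeroʳ p))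
    ... | no  n≰s = cong (λ e → q ^ e * W) (sym (ℕ.+-∸-assoc 1 (ℕ.≰⇒> n≰s)))

    lemma₁ : ∀ q b X p Y t c → b * (X + p * Y) + t * (1 + q * c) * X ≡ (b + t) * X + q * t * c * X + p *
        (b * Y)
    lemma₁ = ℕ-solve-∀

    lemma₂ : ∀ a q t c Z u W p Y → a + q * t * c * (Z + u * W) + p * Y ≡ a + q * t * c * Z +
        (t * c * (q * u * W) + p * Y)
    lemma₂ = ℕ-solve-∀

    lemma₃ : ∀ a c p W Y → a + (c * (p * W) + p * Y) ≡ a + p * (Y + c * W)
    lemma₃ = ℕ-solve-∀

-- Polynomials in q and their values

evalq : ℕ[q] → ℕ → ℕ
evalq []      q = 0
evalq (a ∷ f) q = a + q * evalq f q

private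
  tailq : ℕ[q] → ℕ[q]
  tailq []      = []
  tailq (a ∷ f) = f

  evalq-tail : ∀ f q → evalq f q ≡ coeffq f 0 + q * evalq (tailq f) q
  evalq-tail []      q = sym (ℕ.*-zeroʳ q)
  evalq-tail (a ∷ f) q = refl

  coeffq-tail : ∀ f d → coeffq f (suc d) ≡ coeffq (tailq f) d
  coeffq-tail []      d = refl
  coeffq-tail (a ∷ f) d = refl

  -- For large q the coefficients are the digits of the value in base q.
  evalq-injective-≥ : ∀ N f g → (∀ q → N ≤ q → evalq f q ≡ evalq g q) → f ≈q g
  evalq-injective-≥ N f g e zero = trans (sym (digit f (s≤s (ℕ.m≤n⇒m≤o+n N (ℕ.m≤m+n _ _)))))
    (trans (cong (ℕ._% q) (e q (ℕ.m≤n⇒m≤1+n (ℕ.m≤m+n N _)))) (digit g (s≤s (ℕ.m≤n⇒m≤o+n N (ℕ.m≤n+m _ _)))))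
    where
    -- Larger than both constant coefficients, which are therefore the remainders modulo q, and at
    -- least N.
    q = suc (N + (coeffq f 0 + coeffq g 0))
    digit : ∀ f → coeffq f 0 < q → evalq f q ℕ.% q ≡ coeffq f 0
    digit f lt = trans (cong (ℕ._% q) (trans (evalq-tail f q) (cong (coeffq f 0 +_) (ℕ.*-comm q _))))
      (trans (ℕ.[m+kn]%n≡m%n (coeffq f 0) (evalq (tailq f) q) q) (ℕ.m<n⇒m%n≡m lt))
  evalq-injective-≥ N f g e (suc d) = trans (coeffq-tail f d)
    (trans (evalq-injective-≥ (suc N) (tailq f) (tailq g) tails d) (sym (coeffq-tail g d)))
    where
    tails : ∀ q → suc N ≤ q → evalq (tailq f) q ≡ evalq (tailq g) q
    -- The factor q can be cancelled only if it is positive. The threshold N in the induction keeps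
    -- track of this.
    tails q@(suc _) N<q = ℕ.*-cancelˡ-≡ _ _ q (ℕ.+-cancelˡ-≡ (coeffq f 0) _ _
      (trans (sym (evalq-tail f q)) (trans (e q (ℕ.<⇒≤ N<q)) (trans (evalq-tail g q)
        (cong (_+ q * evalq (tailq g) q) (sym (evalq-injective-≥ N f g e zero)))))))

evalq-injective : ∀ f g → (∀ q → evalq f q ≡ evalq g q) → f ≈q g
evalq-injective f g e = evalq-injective-≥ 0 f g λ q _ → e q

evalq-+q : ∀ f g q → evalq (f +q g) q ≡ evalq f q + evalq g q
evalq-+q []      g       q = refl
evalq-+q (a ∷ f) []      q = sym (ℕ.+-identityʳ _)
evalq-+q (a ∷ f) (b ∷ g) q = trans (cong (λ h → a + b + q * h) (evalq-+q f g q))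
    (lemma a b q (evalq f q) (evalq g q))
  where
  lemma : ∀ a b q f g → a + b + q * (f + g) ≡ a + q * f + (b + q * g)
  lemma = ℕ-solve-∀

evalq-map-* : ∀ a g q → evalq (List.map (a *_) g) q ≡ a * evalq g q
evalq-map-* a []      q = sym (ℕ.*-zeroʳ a)
evalq-map-* a (b ∷ g) q = trans (cong (λ h → a * b + q * h) (evalq-map-* a g q)) (lemma a b q (evalq g q))
  where
  lemma : ∀ a b q g → a * b + q * (a * g) ≡ a * (b + q * g)
  lemma = ℕ-solve-∀

evalq-*q : ∀ f g q → evalq (f *q g) q ≡ evalq f q * evalq g q
evalq-*q []      g q = refl
evalq-*q (a ∷ f) g q = trans (evalq-+q (List.map (a *_) g) (0 ∷ (f *q g)) q)
  (trans (cong₂ (λ u v → u + q * v) (evalq-map-* a g q) (evalq-*q f g q)) (lemma a q (evalq f q) (evalq g q)))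
  where
  lemma : ∀ a q f g → a * g + q * (f * g) ≡ (a + q * f) * g
  lemma = ℕ-solve-∀

evalq-q^ : ∀ d q → evalq (q^ d) q ≡ q ^ d
evalq-q^ zero    q = cong suc (ℕ.*-zeroʳ q)
evalq-q^ (suc d) q = cong (q *_) (evalq-q^ d q)

evalq-[] : ∀ k q → evalq [ k ]q q ≡ bracket q k
evalq-[] zero    q = refl
evalq-[] (suc k) q = cong (λ h → 1 + q * h) (evalq-[] k q)

series : (A → ℕ) → List A → ℕ[q]
series f xs = sumq (List.map (λ x → q^ f x) xs)

evalq-series : ∀ (f : A → ℕ) xs q → evalq (series f xs) q ≡ ∑ xs λ x → q ^ f x
evalq-series f []       q = refl
evalq-series f (x ∷ xs) q = trans (evalq-+q (q^ f x) (series f xs) q)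
    (cong₂ _+_ (evalq-q^ (f x) q) (evalq-series f xs q))

coeffq-+q : ∀ f g d → coeffq (f +q g) d ≡ coeffq f d + coeffq g d
coeffq-+q []      g       d       = refl
coeffq-+q (a ∷ f) []      d       = sym (ℕ.+-identityʳ _)
coeffq-+q (a ∷ f) (b ∷ g) zero    = refl
coeffq-+q (a ∷ f) (b ∷ g) (suc d) = coeffq-+q f g d

coeffq-q^ : ∀ e d → coeffq (q^ e) d ≡ ⟦ does (e ℕ.≟ d) ⟧
coeffq-q^ zero    zero    = refl
coeffq-q^ zero    (suc d) = refl
coeffq-q^ (suc e) zero    = refl
coeffq-q^ (suc e) (suc d) = coeffq-q^ e d

coeffq-series : ∀ (f : A → ℕ) xs d → coeffq (series f xs) d ≡ ∑ xs λ x → ⟦ does (f x ℕ.≟ d) ⟧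
coeffq-series f []       d = refl
coeffq-series f (x ∷ xs) d = trans (coeffq-+q (q^ f x) (series f xs) d)
    (cong₂ _+_ (coeffq-q^ (f x) d) (coeffq-series f xs d))

-- Words and their inversions

private variable
  k : ℕ

true≢false : true ≢ false
true≢false ()

∑-allFin-suc : ∀ n (f : Fin (suc n) → ℕ) → ∑ (List.allFin (suc n)) f ≡ f zero + ∑ (List.allFin n) (f ∘ suc)
∑-allFin-suc n f = cong (f zero +_) (trans (cong (λ xs → ∑ xs f) (sym (List.map-tabulate (λ i → i) suc)))
    (∑-map suc (List.allFin n) f))

-- A word v over Fin k is read from the last letter to the first: the head of v
-- is the block of the largest letter.
above below : Subset k → Fin k → ℕ
above (b ∷ T) zero    = ∣ T ∣
above (b ∷ T) (suc c) = above T c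
below (b ∷ T) zero    = 0
below (b ∷ T) (suc c) = ⟦ b ⟧ + below T c

image : Vec (Fin k) n → Subset k
image []      = ⊥
image (c ∷ v) = image v Vec.[ c ]≔ inside

-- The letter added last is the largest. It is never the smaller member of an inversion, and it is
-- the larger one exactly with the minima of the used blocks to the right of c.
wordInv : Vec (Fin k) n → ℕ
wordInv []      = 0
wordInv (c ∷ v) = above (image v) c + wordInv v

newLetter : Bool → ℕ → ℕ
newLetter used m = if used then 0 else m

-- The increment of `maxInv` minus that of `wordInv`. For a used block the former is `∣ image v ∣` -
-- 1, the number of other used blocks. For a new block it is n: besides the used blocks there are n
-- - `∣ image v ∣` letters that are not minima, and the maximal contribution of each grows by one.
wordCoinv : Vec (Fin k) n → ℕ
wordCoinv []              = 0
wordCoinv {n = suc n} (c ∷ v) =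
  newLetter (Vec.lookup (image v) c) (n ∸ ∣ image v ∣) + below (image v) c + wordCoinv v

above-[]≔ : ∀ (T : Subset k) c b → above (T Vec.[ c ]≔ b) c ≡ above T c
above-[]≔ (_ ∷ T) zero    b = refl
above-[]≔ (_ ∷ T) (suc c) b = above-[]≔ T c b

below-[]≔ : ∀ (T : Subset k) c b → below (T Vec.[ c ]≔ b) c ≡ below T c
below-[]≔ (_ ∷ T) zero    b = refl
below-[]≔ (a ∷ T) (suc c) b = cong (⟦ a ⟧ +_) (below-[]≔ T c b)

∣∷∣ : ∀ b (T : Subset k) → ∣ b ∷ T ∣ ≡ ⟦ b ⟧ + ∣ T ∣
∣∷∣ false T = refl
∣∷∣ true  T = refl

∣∣-split : ∀ (T : Subset k) c → ∣ T ∣ ≡ ⟦ Vec.lookup T c ⟧ + (above T c + below T c)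
∣∣-split (b ∷ T) zero    = trans (∣∷∣ b T) (cong (⟦ b ⟧ +_) (sym (ℕ.+-identityʳ ∣ T ∣)))
∣∣-split (b ∷ T) (suc c) = trans (∣∷∣ b T) (trans (cong (⟦ b ⟧ +_) (∣∣-split T c))
  (lemma ⟦ b ⟧ ⟦ Vec.lookup T c ⟧ (above T c) (below T c)))
  where
  lemma : ∀ b l a c → b + (l + (a + c)) ≡ l + (a + (b + c))
  lemma = ℕ-solve-∀

∣[]≔∣ : ∀ (T : Subset k) c b → ∣ T Vec.[ c ]≔ b ∣ ≡ ⟦ b ⟧ + (above T c + below T c)
∣[]≔∣ T c b = trans (∣∣-split (T Vec.[ c ]≔ b) c)
  (cong₂ _+_ (cong ⟦_⟧ (Vec.lookup∘updateAt c T)) (cong₂ _+_ (above-[]≔ T c b) (below-[]≔ T c b)))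

infix 4 _≟ˢ_
_≟ˢ_ : (S T : Subset k) → Dec (S ≡ T)
_≟ˢ_ = Vec.≡-dec Bool._≟_

[]≔-noop : ∀ (S : Subset k) c {b} → Vec.lookup S c ≡ b → S Vec.[ c ]≔ b ≡ S
[]≔-noop S c refl = Vec.[]≔-lookup S c

insert⇔delete : ∀ (S T : Subset k) c → Vec.lookup S c ≡ outside → Vec.lookup T c ≡ inside →
  S Vec.[ c ]≔ inside ≡ T ⇔ S ≡ T Vec.[ c ]≔ outside
insert⇔delete S T c S-c T-c = mk⇔
  (λ e → sym (trans (cong (Vec._[ c ]≔ outside) (sym e)) (trans (Vec.[]≔-idempotent S c) ([]≔-noop S c S-c))))
  (λ e → trans (cong (Vec._[ c ]≔ inside) e) (trans (Vec.[]≔-idempotent T c) ([]≔-noop T c T-c)))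

module _ (x y : ℕ) where

  -- The homogeneous form ∑ x^(t-1-i) y^i of [ t ]q.
  bracket₂ : ℕ → ℕ
  bracket₂ zero    = 0
  bracket₂ (suc t) = x ^ t + y * bracket₂ t

  ∑-above-below : ∀ (T : Subset k) →
    ∑ (List.allFin k) (λ c → ⟦ Vec.lookup T c ⟧ * (x ^ above T c * y ^ below T c)) ≡ bracket₂ ∣ T ∣
  ∑-above-below []      = refl
  ∑-above-below {suc k} (b ∷ T) = trans (∑-allFin-suc k _) (trans
    (cong₂ _+_ (cong (⟦ b ⟧ *_) (ℕ.*-identityʳ (x ^ ∣ T ∣)))
      (trans (∑-cong (List.allFin k) λ c → trans
          (cong (λ p → ⟦ Vec.lookup T c ⟧ * (x ^ above T c * p)) (ℕ.^-distribˡ-+-* y ⟦ b ⟧ (below T c)))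
          (lemma ⟦ Vec.lookup T c ⟧ (x ^ above T c) (y ^ ⟦ b ⟧) (y ^ below T c)))
        (trans (∑-*ˡ (List.allFin k) (y ^ ⟦ b ⟧) _) (cong (y ^ ⟦ b ⟧ *_) (∑-above-below T)))))
    (total b))
    where
    lemma : ∀ l a b c → l * (a * (b * c)) ≡ b * (l * (a * c))
    lemma = ℕ-solve-∀

    total : ∀ b → ⟦ b ⟧ * x ^ ∣ T ∣ + y ^ ⟦ b ⟧ * bracket₂ ∣ T ∣ ≡ bracket₂ ∣ b ∷ T ∣
    total false = ℕ.+-identityʳ _
    total true  = cong₂ _+_ (ℕ.+-identityʳ (x ^ ∣ T ∣)) (cong (_* bracket₂ ∣ T ∣) (ℕ.*-identityʳ y))

  -- The joint distribution of inv, marked by x, and coinv, marked by y, over words of length n with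
  -- a given image of size t. The two summands distinguish whether the last letter opens a block.
  -- For t = 0 the factor `bracket₂ 0` is 0, so the truncation in `pred t` does no harm.
  surjectionSeries : ℕ → ℕ → ℕ
  surjectionSeries zero    zero    = 1
  surjectionSeries zero    (suc t) = 0
  surjectionSeries (suc n) t       = bracket₂ t * (y ^ (n ∸ pred t) * surjectionSeries n
      (pred t) + surjectionSeries n t)

  weight : Vec (Fin k) n → ℕ
  weight v = x ^ wordInv v * y ^ wordCoinv v

  imageSeries : ∀ n → Subset k → ℕ
  imageSeries {k} n T = ∑ (vectors n (List.allFin k)) λ v → ⟦ does (image v ≟ˢ T) ⟧ * weight v

  -- For c in T the image of c ∷ v is T exactly if that of v is T or T without c, and whether c lies
  -- in `image v` decides which indicator on the right can be 1. For c outside T both sides are 0.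
  weight-∷ : ∀ c (v : Vec (Fin k) n) T → ⟦ does (image (c ∷ v) ≟ˢ T) ⟧ * weight (c ∷ v)
    ≡ ⟦ Vec.lookup T c ⟧ * (x ^ above T c * y ^ below T c) *
      (y ^ (n ∸ pred ∣ T ∣) * (⟦ does (image v ≟ˢ T Vec.[ c ]≔ outside) ⟧ * weight v) + ⟦ does
          (image v ≟ˢ T) ⟧ * weight v)
  weight-∷ {n = n} c v T with Vec.lookup T c in T-c
  ... | false rewrite dec-false (image (c ∷ v) ≟ˢ T) (λ e → true≢false (trans (sym (Vec.lookup∘updateAt c (image v))) (trans (cong (λ S → Vec.lookup S c) e) T-c))) = refl
  ... | true with Vec.lookup (image v) c in I-c
  ...   | true rewrite dec-false (image v ≟ˢ T Vec.[ c ]≔ outside) (λ e → true≢false (trans (sym I-c) (trans (cong (λ S → Vec.lookup S c) e) (Vec.lookup∘updateAt c T))))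
          | []≔-noop (image v) c I-c = used (image v ≟ˢ T)
    where
    used : (d : Dec (image v ≡ T)) → ⟦ does d ⟧ * (x ^ (above (image v) c + wordInv v) * y ^
        (below (image v) c + wordCoinv v))
      ≡ 1 * (x ^ above T c * y ^ below T c) * (y ^ (n ∸ pred ∣ T ∣) * 0 + ⟦ does d ⟧ * weight v)
    used (yes refl) rewrite ℕ.^-distribˡ-+-* x (above T c) (wordInv v) | ℕ.^-distribˡ-+-* y (below T c) (wordCoinv v) =
      lemma (x ^ above T c) (y ^ below T c) (x ^ wordInv v) (y ^ wordCoinv v) (y ^ (n ∸ pred ∣ T ∣))
      where
      lemma : ∀ a b i j p → 1 * (a * i * (b * j)) ≡ 1 * (a * b) * (p * 0 + 1 * (i * j))
      lemma = ℕ-solve-∀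
    used (no _) = lemma (x ^ above T c * y ^ below T c) (y ^ (n ∸ pred ∣ T ∣)) (weight v)
      where
      lemma : ∀ a p w → 0 ≡ 1 * a * (p * 0 + 0 * w)
      lemma = ℕ-solve-∀
  ...   | false rewrite dec-false (image v ≟ˢ T) (λ e → true≢false (trans (sym T-c) (trans (cong (λ S → Vec.lookup S c) (sym e)) I-c)))
          | does-⇔ (insert⇔delete (image v) T c I-c T-c) (image (c ∷ v) ≟ˢ T)
              (image v ≟ˢ T Vec.[ c ]≔ outside) = new (image v ≟ˢ T Vec.[ c ]≔ outside)
    where
    new : (d : Dec (image v ≡ T Vec.[ c ]≔ outside)) →
      ⟦ does d ⟧ * (x ^ (above (image v) c + wordInv v) * y ^
          (n ∸ ∣ image v ∣ + below (image v) c + wordCoinv v))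
      ≡ 1 * (x ^ above T c * y ^ below T c) * (y ^ (n ∸ pred ∣ T ∣) * (⟦ does d ⟧ * weight v) + 0 * weight v)
    new (yes e) = trans (cong₂ (λ i j → 1 * (i * j))
        (trans (ℕ.^-distribˡ-+-* x (above (image v) c) (wordInv v))
            (cong (λ a → x ^ a * x ^ wordInv v) above≡))
        (trans (ℕ.^-distribˡ-+-* y (n ∸ ∣ image v ∣ + below (image v) c) (wordCoinv v))
          (cong (_* y ^ wordCoinv v) (trans (ℕ.^-distribˡ-+-* y (n ∸ ∣ image v ∣) (below (image v) c))
            (cong₂ (λ m b → y ^ (n ∸ m) * y ^ b) size below≡)))))
      (lemma (x ^ above T c) (y ^ below T c) (x ^ wordInv v) (y ^ wordCoinv v) (y ^ (n ∸ pred ∣ T ∣)))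
      where
      lemma : ∀ a b i j p → 1 * (a * i * (p * b * j)) ≡ 1 * (a * b) * (p * (1 * (i * j)) + 0 * (i * j))
      lemma = ℕ-solve-∀

      above≡ : above (image v) c ≡ above T c
      above≡ = trans (cong (λ S → above S c) e) (above-[]≔ T c outside)

      below≡ : below (image v) c ≡ below T c
      below≡ = trans (cong (λ S → below S c) e) (below-[]≔ T c outside)

      size : ∣ image v ∣ ≡ pred ∣ T ∣
      size = trans (cong ∣_∣ e) (trans (∣[]≔∣ T c outside)
        (cong pred (sym (trans (∣∣-split T c) (cong (λ b → ⟦ b ⟧ + (above T c + below T c)) T-c)))))
    new (no _) = lemma (x ^ above T c * y ^ below T c) (y ^ (n ∸ pred ∣ T ∣)) (weight v)
      where
      lemma : ∀ a p w → 0 ≡ 1 * a * (p * (0 * w) + 0 * w)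
      lemma = ℕ-solve-∀

  ∣∣≡0⇒⊥ : ∀ (T : Subset k) → ∣ T ∣ ≡ 0 → ⊥ ≡ T
  ∣∣≡0⇒⊥ []          e = refl
  ∣∣≡0⇒⊥ (false ∷ T) e = cong (false ∷_) (∣∣≡0⇒⊥ T e)

  imageSeries≡ : ∀ n (T : Subset k) → imageSeries n T ≡ surjectionSeries n ∣ T ∣
  imageSeries≡ {k} zero T with ⊥ ≟ˢ T
  ... | yes refl rewrite Subset.∣⊥∣≡0 k = refl
  ... | no ⊥≢T with ∣ T ∣ in e
  ...   | zero  = contradiction (∣∣≡0⇒⊥ T e) ⊥≢T
  ...   | suc _ = refl
  imageSeries≡ {k} (suc n) T = begin
    ∑ (vectors (suc n) (List.allFin k)) (λ v → ⟦ does (image v ≟ˢ T) ⟧ * weight v)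
      ≡⟨ ∑-cartesianProductWith _∷_ (List.allFin k) (vectors n (List.allFin k)) _ ⟩
    ∑ (List.allFin k) (λ c → ∑ words λ v → ⟦ does (image (c ∷ v) ≟ˢ T) ⟧ * weight (c ∷ v))
      ≡⟨ ∑-cong (List.allFin k) (λ c → trans (∑-cong words λ v → weight-∷ c v T)
          (trans (∑-*ˡ words (local c) _) (inner c))) ⟩
    ∑ (List.allFin k) (λ c → local c * (p * surjectionSeries n (pred ∣ T ∣) + surjectionSeries n ∣ T ∣))
      ≡⟨ ∑-*ʳ (List.allFin k) _ local ⟩
    ∑ (List.allFin k) local * (p * surjectionSeries n (pred ∣ T ∣) + surjectionSeries n ∣ T ∣)
      ≡⟨ cong (_* (p * surjectionSeries n (pred ∣ T ∣) + surjectionSeries n ∣ T ∣)) (∑-above-below T) ⟩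
    bracket₂ ∣ T ∣ * (p * surjectionSeries n (pred ∣ T ∣) + surjectionSeries n ∣ T ∣) ∎
    where
    open ≡-Reasoning
    words = vectors n (List.allFin k)
    p = y ^ (n ∸ pred ∣ T ∣)
    local : Fin k → ℕ
    local c = ⟦ Vec.lookup T c ⟧ * (x ^ above T c * y ^ below T c)

    inner : ∀ c → local c * ∑ words (λ v → p * (⟦ does (image v ≟ˢ T Vec.[ c ]≔ outside) ⟧ * weight v) + ⟦ does (image v ≟ˢ T) ⟧ * weight v)
      ≡ local c * (p * surjectionSeries n (pred ∣ T ∣) + surjectionSeries n ∣ T ∣)
    inner c with Vec.lookup T c in T-c
    ... | false = refl
    ... | true  = cong (1 * (x ^ above T c * y ^ below T c) *_) (trans (∑-+ words _ _)
      (cong₂ _+_ (trans (∑-*ˡ words p _) (cong (p *_) (trans (imageSeries≡ n (T Vec.[ c ]≔ outside))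
          (cong (surjectionSeries n) size))))
                 (imageSeries≡ n T)))
      where
      size : ∣ T Vec.[ c ]≔ outside ∣ ≡ pred ∣ T ∣
      size = trans (∣[]≔∣ T c outside) (cong pred (sym (trans (∣∣-split T c)
          (cong (λ b → ⟦ b ⟧ + (above T c + below T c)) T-c))))

-- The constant from which `coinv` subtracts, taken also for words that do not use all blocks; k is
-- then the number of used blocks.
maxInv : ℕ → ℕ → ℕ
maxInv n k = (n ∸ k) * (k ∸ 1) + k C 2

maxInv-old : ∀ {n t} → t ≤ n → maxInv (suc n) t ≡ maxInv n t + (t ∸ 1)
maxInv-old {n} {t} t≤n rewrite ℕ.+-∸-assoc 1 t≤n = lemma (t ∸ 1) ((n ∸ t) * (t ∸ 1)) (t C 2)
  where
  lemma : ∀ a b c → a + b + c ≡ b + c + a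
  lemma = ℕ-solve-∀

maxInv-new : ∀ {n t} → suc t ≤ n → maxInv (suc n) (suc (suc t)) ≡ maxInv n (suc t) + n
maxInv-new {n} {t} t<n = trans
  (cong (λ c → (n ∸ suc t) * suc t + c) (sym (trans (cong (_+ suc t C 2) (sym (nC1≡n (suc t))))
      (nCk+nC[k+1]≡[n+1]C[k+1] (suc t) 1))))
  (trans (lemma (n ∸ suc t) t (suc t C 2)) (cong ((n ∸ suc t) * t + suc t C 2 +_) (ℕ.m∸n+n≡m t<n)))
  where
  lemma : ∀ e t c → e * suc t + (suc t + c) ≡ e * t + c + (e + suc t)
  lemma = ℕ-solve-∀

∣image∣≤ : ∀ (v : Vec (Fin k) n) → ∣ image v ∣ ≤ n
∣image∣≤ {k} []      = ℕ.≤-reflexive (Subset.∣⊥∣≡0 k)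
∣image∣≤     (c ∷ v) = ℕ.≤-trans (ℕ.≤-reflexive (∣[]≔∣ (image v) c inside))
  (s≤s (ℕ.≤-trans (ℕ.m≤n+m _ ⟦ Vec.lookup (image v) c ⟧)
      (ℕ.≤-trans (ℕ.≤-reflexive (sym (∣∣-split (image v) c))) (∣image∣≤ v))))

wordInv+wordCoinv : ∀ (v : Vec (Fin k) n) → wordInv v + wordCoinv v ≡ maxInv n ∣ image v ∣
wordInv+wordCoinv {k} []      rewrite Subset.∣⊥∣≡0 k = refl
wordInv+wordCoinv {n = suc n} (c ∷ v) with Vec.lookup (image v) c in I-c
... | true = begin
    above (image v) c + wordInv v + (below (image v) c + wordCoinv v)
      ≡⟨ lemma (above (image v) c) (wordInv v) (below (image v) c) (wordCoinv v) ⟩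
    wordInv v + wordCoinv v + (above (image v) c + below (image v) c)
      ≡⟨ cong₂ _+_ (wordInv+wordCoinv v) (cong pred (sym size)) ⟩
    maxInv n ∣ image v ∣ + (∣ image v ∣ ∸ 1)
      ≡⟨ sym (maxInv-old (∣image∣≤ v)) ⟩
    maxInv (suc n) ∣ image v ∣
      ≡⟨ cong (maxInv (suc n)) (trans size (sym (∣[]≔∣ (image v) c inside))) ⟩
    maxInv (suc n) ∣ image (c ∷ v) ∣ ∎
    where
    open ≡-Reasoning
    lemma : ∀ a i b j → a + i + (b + j) ≡ i + j + (a + b)
    lemma = ℕ-solve-∀

    size : ∣ image v ∣ ≡ 1 + (above (image v) c + below (image v) c)
    size = trans (∣∣-split (image v) c) (cong (λ b → ⟦ b ⟧ + (above (image v) c + below (image v) c)) I-c)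
... | false = begin
    above (image v) c + wordInv v + (n ∸ ∣ image v ∣ + below (image v) c + wordCoinv v)
      ≡⟨ lemma (above (image v) c) (wordInv v) (n ∸ ∣ image v ∣) (below (image v) c) (wordCoinv v) ⟩
    wordInv v + wordCoinv v + (n ∸ ∣ image v ∣ + (above (image v) c + below (image v) c))
      ≡⟨ cong₂ _+_ (wordInv+wordCoinv v) (trans (cong (n ∸ ∣ image v ∣ +_) (sym size))
          (ℕ.m∸n+n≡m (∣image∣≤ v))) ⟩
    maxInv n ∣ image v ∣ + n
      ≡⟨ next v ⟩
    maxInv (suc n) (suc ∣ image v ∣)
      ≡⟨ cong (maxInv (suc n)) (trans (cong suc size) (sym (∣[]≔∣ (image v) c inside))) ⟩
    maxInv (suc n) ∣ image (c ∷ v) ∣ ∎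
    where
    open ≡-Reasoning
    lemma : ∀ a i e b j → a + i + (e + b + j) ≡ i + j + (e + (a + b))
    lemma = ℕ-solve-∀

    size : ∣ image v ∣ ≡ above (image v) c + below (image v) c
    size = trans (∣∣-split (image v) c) (cong (λ b → ⟦ b ⟧ + (above (image v) c + below (image v) c)) I-c)

    -- With an empty image the identity fails for n > 0, because k - 1 is truncated at k = 0. Only
    -- the empty word has an empty image, and there n = 0.
    next : ∀ {n} (v : Vec (Fin k) n) → maxInv n ∣ image v ∣ + n ≡ maxInv (suc n) (suc ∣ image v ∣)
    next {k} []      rewrite Subset.∣⊥∣≡0 k = refl
    next (d ∷ v) with ∣ image (d ∷ v) ∣ | ∣[]≔∣ (image v) d inside | ∣image∣≤ (d ∷ v)
    ... | suc t | _ | le = sym (maxInv-new le)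

-- Ordered set partitions as words

∑-allFin-last : ∀ n (f : Fin (suc n) → ℕ) → ∑ (List.allFin (suc n)) f ≡ f (fromℕ n) + ∑ (List.allFin n)
    (f ∘ inject₁)
∑-allFin-last zero    f = refl
∑-allFin-last (suc n) f = begin
  ∑ (List.allFin (suc (suc n))) f
    ≡⟨ ∑-allFin-suc (suc n) f ⟩
  f zero + ∑ (List.allFin (suc n)) (f ∘ suc)
    ≡⟨ cong (f zero +_) (∑-allFin-last n (f ∘ suc)) ⟩
  f zero + (f (fromℕ (suc n)) + ∑ (List.allFin n) (f ∘ suc ∘ inject₁))
    ≡⟨ lemma (f zero) (f (fromℕ (suc n))) _ ⟩
  f (fromℕ (suc n)) + (f zero + ∑ (List.allFin n) (f ∘ inject₁ ∘ suc))
    ≡⟨ cong (f (fromℕ (suc n)) +_) (sym (∑-allFin-suc n (f ∘ inject₁))) ⟩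
  f (fromℕ (suc n)) + ∑ (List.allFin (suc n)) (f ∘ inject₁) ∎
  where
  open ≡-Reasoning
  lemma : ∀ a b c → a + (b + c) ≡ b + (a + c)
  lemma = ℕ-solve-∀

∑-opposite : ∀ n (f : Fin n → ℕ) → ∑ (List.allFin n) f ≡ ∑ (List.allFin n) (f ∘ opposite)
∑-opposite zero    f = refl
∑-opposite (suc n) f = trans (∑-allFin-last n f)
  (trans (cong (f (fromℕ n) +_) (∑-opposite n (f ∘ inject₁))) (sym (∑-allFin-suc n (f ∘ opposite))))

opposite-≤ : ∀ {i j : Fin n} → i Fin.≤ j → opposite j Fin.≤ opposite i
opposite-≤ {n} {i} {j} le rewrite Fin.opposite-prop i | Fin.opposite-prop j = ℕ.∸-monoʳ-≤ n (s≤s le)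

opposite-< : ∀ {i j : Fin n} → i Fin.< j → opposite j Fin.< opposite i
opposite-< {n} {i} {j} lt rewrite Fin.opposite-prop i | Fin.opposite-prop j = ℕ.∸-monoʳ-< (s≤s lt) (Fin.toℕ<n j)

⟦∧⟧ : ∀ a b → ⟦ a ∧ b ⟧ ≡ ⟦ a ⟧ * ⟦ b ⟧
⟦∧⟧ false b = refl
⟦∧⟧ true  b = sym (ℕ.*-identityˡ ⟦ b ⟧)

lookup-image⁻ : ∀ (v : Vec (Fin k) n) {m} → Vec.lookup (image v) m ≡ true → ∃ λ i → Vec.lookup v i ≡ m
lookup-image⁻ []      {m} e = contradiction (trans (sym e) (Vec.lookup-replicate m false)) true≢false
lookup-image⁻ (c ∷ v) {m} e with c Fin.≟ m
... | yes c≡m = zero , c≡m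
... | no  c≢m = let i , e′ = lookup-image⁻ v (trans (sym (Vec.lookup∘updateAt′ m c (λ m≡c → c≢m (sym m≡c)) (image v))) e) in suc i , e′

lookup-image⁺ : ∀ (v : Vec (Fin k) n) i → Vec.lookup (image v) (Vec.lookup v i) ≡ true
lookup-image⁺ (c ∷ v) zero    = Vec.lookup∘updateAt c (image v)
lookup-image⁺ (c ∷ v) (suc i) with Vec.lookup v i Fin.≟ c
... | yes e rewrite e = Vec.lookup∘updateAt c (image v)
... | no ne = trans (Vec.lookup∘updateAt′ (Vec.lookup v i) c ne (image v)) (lookup-image⁺ v i)

-- Position i holds the smallest letter of its block.
IsRecord : Vec (Fin k) n → Fin n → Set
IsRecord v i = ∀ j → Vec.lookup v j ≡ Vec.lookup v i → j Fin.≤ i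

isRecord? : ∀ (v : Vec (Fin k) n) i → Dec (IsRecord v i)
isRecord? v i = Fin.all? λ j → (Vec.lookup v j Fin.≟ Vec.lookup v i) →-dec (j Fin.≤? i)

isRecord-suc : ∀ c (v : Vec (Fin k) n) i → does (isRecord? (c ∷ v) (suc i)) ≡ does (isRecord? v i)
isRecord-suc c v i = does-⇔ (mk⇔ to from) (isRecord? (c ∷ v) (suc i)) (isRecord? v i)
  where
  to : IsRecord (c ∷ v) (suc i) → IsRecord v i
  to r j e = ℕ.≤-pred (r (suc j) e)

  from : IsRecord v i → IsRecord (c ∷ v) (suc i)
  from r zero    e = z≤n
  from r (suc j) e = s≤s (r j e)

isRecord-zero : ∀ c (v : Vec (Fin k) n) → does (isRecord? (c ∷ v) zero) ≡ not (Vec.lookup (image v) c)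
isRecord-zero c v with Vec.lookup (image v) c in e
... | true  = dec-false (isRecord? (c ∷ v) zero) λ r →
  let i , e′ = lookup-image⁻ v e in ℕ.<⇒≱ (s≤s z≤n) (r (suc i) e′)
... | false = dec-true (isRecord? (c ∷ v) zero) r
  where
  r : IsRecord (c ∷ v) zero
  r zero    _  = z≤n
  r (suc i) e′ = contradiction (trans (sym (lookup-image⁺ v i))
      (trans (cong (Vec.lookup (image v)) e′) e)) true≢false

∑-insert : ∀ (S : Subset k) c (g : Fin k → ℕ) →
  ∑ (List.allFin k) (λ m → ⟦ Vec.lookup (S Vec.[ c ]≔ inside) m ⟧ * g m)
  ≡ ⟦ not (Vec.lookup S c) ⟧ * g c + ∑ (List.allFin k) (λ m → ⟦ Vec.lookup S m ⟧ * g m)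
∑-insert {suc k} (b ∷ S) zero    g = trans (∑-allFin-suc k _) (trans (lemma b)
  (cong (⟦ not b ⟧ * g zero +_) (sym (∑-allFin-suc k (λ m → ⟦ Vec.lookup (b ∷ S) m ⟧ * g m)))))
  where
  rest = ∑ (List.allFin k) (λ m → ⟦ Vec.lookup S m ⟧ * g (suc m))
  lemma : ∀ b → 1 * g zero + rest ≡ ⟦ not b ⟧ * g zero + (⟦ b ⟧ * g zero + rest)
  lemma true  = refl
  lemma false = refl
∑-insert {suc k} (b ∷ S) (suc c) g = trans (∑-allFin-suc k _) (trans
  (cong (⟦ b ⟧ * g zero +_) (∑-insert S c (g ∘ suc)))
  (trans (lemma (⟦ b ⟧ * g zero) (⟦ not (Vec.lookup S c) ⟧ * g (suc c)) _)
    (cong (⟦ not (Vec.lookup S c) ⟧ * g (suc c) +_) (sym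
        (∑-allFin-suc k (λ m → ⟦ Vec.lookup (b ∷ S) m ⟧ * g m))))))
  where
  lemma : ∀ a b c → a + (b + c) ≡ b + (a + c)
  lemma = ℕ-solve-∀

-- Every used block has exactly one smallest letter. In the induction the head is a record exactly
-- if its block is new, which matches the contribution in `∑-insert`.
∑-records : ∀ (v : Vec (Fin k) n) (g : Fin k → ℕ) →
  ∑ (List.allFin n) (λ i → ⟦ does (isRecord? v i) ⟧ * g (Vec.lookup v i)) ≡ ∑ (List.allFin k)
      (λ m → ⟦ Vec.lookup (image v) m ⟧ * g m)
∑-records {k} []      g = sym (trans (∑-cong (List.allFin k) λ m → cong (λ b → ⟦ b ⟧ * g m)
    (Vec.lookup-replicate m false)) (∑-zero (List.allFin k)))
∑-records {k} {suc n} (c ∷ v) g = trans (∑-allFin-suc n _) (trans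
  (cong₂ _+_ (cong (λ b → ⟦ b ⟧ * g c) (isRecord-zero c v))
    (trans (∑-cong (List.allFin n) λ i → cong (λ b → ⟦ b ⟧ * g (Vec.lookup v i)) (isRecord-suc c v i))
        (∑-records v g)))
  (sym (∑-insert (image v) c g)))

∑-lookup : ∀ (T : Subset k) → ∑ (List.allFin k) (λ m → ⟦ Vec.lookup T m ⟧ * 1) ≡ ∣ T ∣
∑-lookup {zero}  []      = refl
∑-lookup {suc k} (b ∷ T) = trans (∑-allFin-suc k _) (trans (cong₂ _+_ (ℕ.*-identityʳ ⟦ b ⟧) (∑-lookup T))
    (sym (∣∷∣ b T)))

∑-above : ∀ (T : Subset k) c → ∑ (List.allFin k) (λ m → ⟦ Vec.lookup T m ⟧ * ⟦ does
    (c Fin.<? m) ⟧) ≡ above T c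
∑-above {suc k} (b ∷ T) zero    = trans (∑-allFin-suc k _) (cong₂ _+_ (ℕ.*-zeroʳ ⟦ b ⟧) (∑-lookup T))
∑-above {suc k} (b ∷ T) (suc c) = trans (∑-allFin-suc k _) (cong₂ _+_ (ℕ.*-zeroʳ ⟦ b ⟧) (∑-above T c))

wordInversion? : ∀ (v : Vec (Fin k) n) i j → Dec (j Fin.< i × IsRecord v i × Vec.lookup v j Fin.< Vec.lookup v i)
wordInversion? v i j = (j Fin.<? i) ×-dec (isRecord? v i ×-dec (Vec.lookup v j Fin.<? Vec.lookup v i))

∑-wordInversion : ∀ (v : Vec (Fin k) n) →
  ∑ (List.allFin n) (λ i → ∑ (List.allFin n) λ j → ⟦ does (wordInversion? v i j) ⟧) ≡ wordInv v
∑-wordInversion []      = refl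
∑-wordInversion {k} {suc n} (c ∷ v) = begin
  ∑ (List.allFin (suc n)) (λ i → ∑ (List.allFin (suc n)) (inversion (c ∷ v) i))
    ≡⟨ ∑-allFin-suc n _ ⟩
  ∑ (List.allFin (suc n)) (λ _ → 0) + ∑ (List.allFin n) (λ i → ∑ (List.allFin (suc n))
      (inversion (c ∷ v) (suc i)))
    -- As i, position zero gives nothing, since no j precedes it; as j, it meets the records in the
    -- blocks above c.
    ≡⟨ cong₂ _+_ (∑-zero (List.allFin (suc n))) (∑-cong (List.allFin n) λ i → trans
        (∑-allFin-suc n (inversion (c ∷ v) (suc i)))
         (cong₂ _+_ (head i) (∑-cong (List.allFin n) (tail i)))) ⟩
  ∑ (List.allFin n) (λ i → ⟦ does (isRecord? v i) ⟧ * ⟦ does (c Fin.<? Vec.lookup v i) ⟧ + ∑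
      (List.allFin n) (inversion v i))
    ≡⟨ ∑-+ (List.allFin n) _ _ ⟩
  ∑ (List.allFin n) (λ i → ⟦ does (isRecord? v i) ⟧ * ⟦ does (c Fin.<? Vec.lookup v i) ⟧) +
  ∑ (List.allFin n) (λ i → ∑ (List.allFin n) (inversion v i))
    ≡⟨ cong₂ _+_ (trans (∑-records v λ m → ⟦ does (c Fin.<? m) ⟧) (∑-above (image v) c)) (∑-wordInversion v) ⟩
  above (image v) c + wordInv v ∎
  where
  open ≡-Reasoning
  inversion : ∀ {n} → Vec (Fin k) n → Fin n → Fin n → ℕ
  inversion v i j = ⟦ does (wordInversion? v i j) ⟧

  head : ∀ i → inversion (c ∷ v) (suc i) zero ≡ ⟦ does (isRecord? v i) ⟧ * ⟦ does (c Fin.<? Vec.lookup v i) ⟧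
  head i = trans (cong (λ b → ⟦ b ∧ does (c Fin.<? Vec.lookup v i) ⟧) (isRecord-suc c v i))
    (⟦∧⟧ (does (isRecord? v i)) (does (c Fin.<? Vec.lookup v i)))

  tail : ∀ i j → inversion (c ∷ v) (suc i) (suc j) ≡ inversion v i j
  tail i j = cong (λ b → ⟦ does (j Fin.<? i) ∧ (b ∧ does (Vec.lookup v j Fin.<? Vec.lookup v i)) ⟧)
      (isRecord-suc c v i)

-- Positions run from the largest letter downwards, so `opposite` converts between positions and
-- letters.
toBlocks : Vec (Fin k) n → Blocks n k
toBlocks v = Vec.tabulate λ m → Vec.tabulate λ i → does (Vec.lookup v (opposite i) Fin.≟ m)

lookup-toBlocks : ∀ (v : Vec (Fin k) n) m i → Vec.lookup (Vec.lookup (toBlocks v) m) i ≡ does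
    (Vec.lookup v (opposite i) Fin.≟ m)
lookup-toBlocks v m i = trans (cong (λ S → Vec.lookup S i) (Vec.lookup∘tabulate _ m))
    (Vec.lookup∘tabulate _ i)

from-does : ∀ {P : Set} (d : Dec P) → does d ≡ true → P
from-does (yes p) _ = p

∈-toBlocks⁻ : ∀ (v : Vec (Fin k) n) {m i} → _∈B_ (toBlocks v) i m → Vec.lookup v (opposite i) ≡ m
∈-toBlocks⁻ v {m} {i} i∈ = from-does (Vec.lookup v (opposite i) Fin.≟ m)
    (trans (sym (lookup-toBlocks v m i)) (Vec.[]=⇒lookup i∈))

∈-toBlocks⁺ : ∀ (v : Vec (Fin k) n) {m i} → Vec.lookup v (opposite i) ≡ m → _∈B_ (toBlocks v) i m
∈-toBlocks⁺ v {m} {i} e = Vec.lookup⇒[]= i _ (trans (lookup-toBlocks v m i)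
    (dec-true (Vec.lookup v (opposite i) Fin.≟ m) e))

inversion⇔ : ∀ (v : Vec (Fin k) n) i j → IsInversion (toBlocks v) (i , j) ⇔
  (opposite j Fin.< opposite i × IsRecord v (opposite i) × Vec.lookup v (opposite j) Fin.< Vec.lookup v
      (opposite i))
inversion⇔ {n = n} v i j = mk⇔ to from
  where
  to : IsInversion (toBlocks v) (i , j) → _
  to (i<j , m , (i∈m , min) , ℓ , j∈ℓ , ℓ<m) = opposite-< i<j , record-i ,
    subst₂ Fin._<_ (sym (∈-toBlocks⁻ v j∈ℓ)) (sym (∈-toBlocks⁻ v i∈m)) ℓ<m
    where
    record-i : IsRecord v (opposite i)
    record-i j′ e = subst (Fin._≤ opposite i) (Fin.opposite-involutive j′) (opposite-≤ (min (opposite j′)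
      (∈-toBlocks⁺ v (trans (cong (Vec.lookup v) (Fin.opposite-involutive j′))
          (trans e (∈-toBlocks⁻ v i∈m))))))

  from : _ → IsInversion (toBlocks v) (i , j)
  from (lt , r , below) = subst₂ Fin._<_ (Fin.opposite-involutive i) (Fin.opposite-involutive j)
      (opposite-< lt) ,
    Vec.lookup v (opposite i) ,
    (∈-toBlocks⁺ v refl , λ j′ j′∈ → subst₂ Fin._≤_ (Fin.opposite-involutive i) (Fin.opposite-involutive j′)
      (opposite-≤ (r (opposite j′) (∈-toBlocks⁻ v j′∈)))) ,
    Vec.lookup v (opposite j) , ∈-toBlocks⁺ v refl , below

inv-toBlocks : ∀ (v : Vec (Fin k) n) → inv (toBlocks v) ≡ wordInv v
inv-toBlocks {k} {n} v = begin
  inv (toBlocks v)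
    ≡⟨ length-filter≡∑ (isInversion? (toBlocks v)) (List.cartesianProduct (List.allFin n) (List.allFin n)) ⟩
  ∑ (List.cartesianProduct (List.allFin n) (List.allFin n)) (λ p → ⟦ does (isInversion? (toBlocks v) p) ⟧)
    ≡⟨ ∑-cartesianProductWith _,_ (List.allFin n) (List.allFin n) _ ⟩
  ∑ (List.allFin n) (λ i → ∑ (List.allFin n) λ j → ⟦ does (isInversion? (toBlocks v) (i , j)) ⟧)
    ≡⟨ ∑-cong (List.allFin n) (λ i → ∑-cong (List.allFin n) λ j → cong ⟦_⟧
         (does-⇔ (inversion⇔ v i j) (isInversion? (toBlocks v) (i , j))
             (wordInversion? v (opposite i) (opposite j)))) ⟩
  ∑ (List.allFin n) (λ i → ∑ (List.allFin n) λ j → ⟦ does (wordInversion? v (opposite i) (opposite j)) ⟧)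
    ≡⟨ ∑-cong (List.allFin n) (λ i → sym (∑-opposite n λ j → ⟦ does (wordInversion? v (opposite i) j) ⟧)) ⟩
  ∑ (List.allFin n) (λ i → ∑ (List.allFin n) λ j → ⟦ does (wordInversion? v (opposite i) j) ⟧)
    ≡⟨ sym (∑-opposite n λ i → ∑ (List.allFin n) λ j → ⟦ does (wordInversion? v i j) ⟧) ⟩
  ∑ (List.allFin n) (λ i → ∑ (List.allFin n) λ j → ⟦ does (wordInversion? v i j) ⟧)
    ≡⟨ ∑-wordInversion v ⟩
  wordInv v ∎
  where open ≡-Reasoning

-- The identity `wordInv+wordCoinv` also shows that the truncated subtraction in `coinv` is exact.
coinv-toBlocks : ∀ (v : Vec (Fin k) n) → image v ≡ ⊤ → coinv (toBlocks v) ≡ wordCoinv v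
coinv-toBlocks {k} {n} v e = trans (cong (maxInv n k ∸_) (inv-toBlocks v)) (trans (cong (_∸ wordInv v)
  (trans (cong (maxInv n) (sym (trans (cong ∣_∣ e) (Subset.∣⊤∣≡n k)))) (sym (wordInv+wordCoinv v))))
  (ℕ.m+n∸m≡n (wordInv v) (wordCoinv v)))

-- A word assigns each letter to exactly one block by its very form, so only the nonemptiness of the
-- blocks is a condition.
partition⇔ : ∀ (v : Vec (Fin k) n) → IsPartition (toBlocks v) ⇔ image v ≡ ⊤
partition⇔ {k} {n} v = mk⇔ to from
  where
  lookup-ext : ∀ {S T : Subset k} → (∀ m → Vec.lookup S m ≡ Vec.lookup T m) → S ≡ T
  lookup-ext {S} {T} e = trans (sym (Vec.tabulate∘lookup S))
      (trans (Vec.tabulate-cong e) (Vec.tabulate∘lookup T))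

  to : IsPartition (toBlocks v) → image v ≡ ⊤
  to (nonempty , _) = lookup-ext λ m → let i , i∈ = nonempty m in
    trans (cong (Vec.lookup (image v)) (sym (∈-toBlocks⁻ v i∈)))
        (trans (lookup-image⁺ v (opposite i)) (sym (Vec.lookup-replicate m true)))

  from : image v ≡ ⊤ → IsPartition (toBlocks v)
  from e = (λ m → let i , e′ = lookup-image⁻ v (trans (cong (λ S → Vec.lookup S m) e) (Vec.lookup-replicate m true)) in
              opposite i , ∈-toBlocks⁺ v (trans (cong (Vec.lookup v) (Fin.opposite-involutive i)) e′)) ,
           λ i → Vec.lookup v (opposite i) , ∈-toBlocks⁺ v refl , λ ℓ i∈ℓ → sym (∈-toBlocks⁻ v i∈ℓ)

toBlocks-injective : ∀ {v w : Vec (Fin k) n} → toBlocks v ≡ toBlocks w → v ≡ w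
toBlocks-injective {v = v} {w} e = trans (sym (Vec.tabulate∘lookup v))
    (trans (Vec.tabulate-cong same) (Vec.tabulate∘lookup w))
  where
  same : ∀ i → Vec.lookup v i ≡ Vec.lookup w i
  same i = sym (trans (cong (Vec.lookup w) (sym (Fin.opposite-involutive i)))
    (∈-toBlocks⁻ w (subst (λ B → _∈B_ B (opposite i) (Vec.lookup v i)) e
      (∈-toBlocks⁺ v (cong (Vec.lookup v) (Fin.opposite-involutive i))))))

toBlocks-surjective : ∀ (B : Blocks n k) → IsPartition B → ∃ λ v → toBlocks v ≡ B
toBlocks-surjective {n} {k} B (_ , unique) = v , trans (Vec.tabulate-cong λ m → trans
    (Vec.tabulate-cong (same m)) (Vec.tabulate∘lookup _)) (Vec.tabulate∘lookup B)
  where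
  v = Vec.tabulate λ i → proj₁ (unique (opposite i))

  block : ∀ i → Vec.lookup v (opposite i) ≡ proj₁ (unique i)
  block i = trans (Vec.lookup∘tabulate _ (opposite i)) (cong (λ j → proj₁ (unique j))
      (Fin.opposite-involutive i))

  same : ∀ m i → does (Vec.lookup v (opposite i) Fin.≟ m) ≡ Vec.lookup (Vec.lookup B m) i
  same m i with Vec.lookup (Vec.lookup B m) i in e
  ... | true  = dec-true (Vec.lookup v (opposite i) Fin.≟ m)
      (trans (block i) (sym (proj₂ (proj₂ (unique i)) m (Vec.lookup⇒[]= i _ e))))
  ... | false = dec-false (Vec.lookup v (opposite i) Fin.≟ m) λ e′ → true≢false
    (trans (sym (Vec.[]=⇒lookup (subst (_∈B_ B i) (trans (sym (block i)) e′) (proj₁ (proj₂ (unique i)))))) e)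

∈-vectors : ∀ {xs : List A} → (∀ x → x ∈ xs) → ∀ {n} (v : Vec A n) → v ∈ vectors n xs
∈-vectors all []      = here refl
∈-vectors all (x ∷ v) = ∈.∈-cartesianProductWith⁺ _∷_ (all x) (∈-vectors all v)

vectors-unique : ∀ {xs : List A} → Unique xs → ∀ n → Unique (vectors n xs)
vectors-unique u zero    = [] ∷ []
vectors-unique u (suc n) = Unique.cartesianProductWith⁺ _∷_ Vec.∷-injective u (vectors-unique u n)

∈-subsets : ∀ (S : Subset n) → S ∈ subsets n
∈-subsets = ∈-vectors λ { false → here refl ; true → there (here refl) }

subsets-unique : ∀ n → Unique (subsets n)
subsets-unique = vectors-unique (((λ ()) ∷ []) ∷ [] ∷ [])

surjections : ∀ n k → List (Vec (Fin k) n)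
surjections n k = List.filter (λ v → image v ≟ˢ ⊤) (vectors n (List.allFin k))

OP↭surjections : ∀ n k → OP n k ↭ List.map toBlocks (surjections n k)
OP↭surjections n k = ∼bag⇒↭ (unique∧set⇒bag
  (Unique.filter⁺ isPartition? (vectors-unique (subsets-unique n) k))
  (Unique.map⁺ toBlocks-injective (Unique.filter⁺ (λ v → image v ≟ˢ ⊤) (vectors-unique (Unique.allFin⁺ k) n)))
  (mk⇔ to from))
  where
  to : ∀ {B} → B ∈ OP n k → B ∈ List.map toBlocks (surjections n k)
  to {B} B∈ with ∈.∈-filter⁻ isPartition? {xs = vectors k (subsets n)} B∈
  ... | _ , part with toBlocks-surjective B part
  ...   | v , refl = ∈.∈-map⁺ toBlocks (∈.∈-filter⁺ (λ v → image v ≟ˢ ⊤) (∈-vectors ∈.∈-allFin v)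
      (Equivalence.to (partition⇔ v) part))

  from : ∀ {B} → B ∈ List.map toBlocks (surjections n k) → B ∈ OP n k
  from B∈ with ∈.∈-map⁻ toBlocks B∈
  ... | v , v∈ , refl = ∈.∈-filter⁺ isPartition? (∈-vectors ∈-subsets (toBlocks v))
    (Equivalence.from (partition⇔ v) (proj₂ (∈.∈-filter⁻
        (λ v → image v ≟ˢ ⊤) {xs = vectors n (List.allFin k)} v∈)))

∑-↭ : ∀ {xs ys : List A} (f : A → ℕ) → xs ↭ ys → ∑ xs f ≡ ∑ ys f
∑-↭ f ↭.refl          = refl
∑-↭ f (↭.prep x p)    = cong (f x +_) (∑-↭ f p)
∑-↭ f (↭.swap x y p)  = trans (cong (λ s → f x + (f y + s)) (∑-↭ f p)) (lemma (f x) (f y) _)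
  where
  lemma : ∀ a b c → a + (b + c) ≡ b + (a + c)
  lemma = ℕ-solve-∀
∑-↭ f (↭.trans p q)   = trans (∑-↭ f p) (∑-↭ f q)

∑-OP : ∀ x y n k (f : Blocks n k → ℕ) → (∀ v → image v ≡ ⊤ → f (toBlocks v) ≡ weight x y v) → ∑
    (OP n k) f ≡ surjectionSeries x y n k
∑-OP x y n k f e = begin
  ∑ (OP n k) f
    ≡⟨ ∑-↭ f (OP↭surjections n k) ⟩
  ∑ (List.map toBlocks (surjections n k)) f
    ≡⟨ ∑-map toBlocks (surjections n k) f ⟩
  ∑ (surjections n k) (f ∘ toBlocks)
    ≡⟨ ∑-filter (λ v → image v ≟ˢ ⊤) (vectors n (List.allFin k)) (f ∘ toBlocks) ⟩
  ∑ (vectors n (List.allFin k)) (λ v → ⟦ does (image v ≟ˢ ⊤) ⟧ * f (toBlocks v))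
    ≡⟨ ∑-cong (vectors n (List.allFin k)) (λ v → pointwise v (image v ≟ˢ ⊤)) ⟩
  imageSeries x y n ⊤
    ≡⟨ imageSeries≡ x y n ⊤ ⟩
  surjectionSeries x y n ∣ ⊤ {k} ∣
    ≡⟨ cong (surjectionSeries x y n) (Subset.∣⊤∣≡n k) ⟩
  surjectionSeries x y n k ∎
  where
  open ≡-Reasoning
  pointwise : ∀ v (d : Dec (image v ≡ ⊤)) → ⟦ does d ⟧ * f (toBlocks v) ≡ ⟦ does d ⟧ * weight x y v
  pointwise v (yes s) = cong (1 *_) (e v s)
  pointwise v (no _)  = refl

-- Unordered set partitions

-- Functions that are invariant under permutations of their arguments and
-- vanish if two of them agree.
Alternating : ∀ k → (Vec A k → ℕ) → Set
Alternating zero          f = Unit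
Alternating (suc zero)    f = Unit
Alternating (suc (suc k)) f =
  (∀ x y v → f (x ∷ y ∷ v) ≡ f (y ∷ x ∷ v)) × (∀ x v → f (x ∷ x ∷ v) ≡ 0) ×
      (∀ x → Alternating (suc k) (f ∘ (x ∷_)))

Alternating-∷ : ∀ k {f : Vec A (suc k) → ℕ} → Alternating (suc k) f → ∀ x → Alternating k (f ∘ (x ∷_))
Alternating-∷ zero    _           x = tt
Alternating-∷ (suc k) (_ , _ , h) x = h x

∑-vectors-suc : ∀ k (xs : List A) f → ∑ (vectors (suc k) xs) f ≡ ∑ xs λ y → ∑ (vectors k xs) (f ∘ (y ∷_))
∑-vectors-suc k xs f = ∑-cartesianProductWith _∷_ xs (vectors k xs) f

-- Since f is alternating, x is used at most once, in any of suc k positions.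
∑-vectors-∷ : ∀ k x (xs : List A) f → Alternating (suc k) f →
  ∑ (vectors (suc k) (x ∷ xs)) f ≡ ∑ (vectors (suc k) xs) f + suc k * ∑ (vectors k xs) (f ∘ (x ∷_))
∑-vectors-∷ zero    x xs f _ = trans (∑-vectors-suc 0 (x ∷ xs) f)
  (trans (cong (f (x ∷ []) + 0 +_) (sym (∑-vectors-suc 0 xs f))) (lemma (f (x ∷ [])) (∑ (vectors 1 xs) f)))
  where
  lemma : ∀ a b → a + 0 + b ≡ b + 1 * (a + 0)
  lemma = ℕ-solve-∀
∑-vectors-∷ (suc k) x xs f (swap , rep , alt) = begin
  ∑ (vectors (suc (suc k)) (x ∷ xs)) f
    ≡⟨ ∑-vectors-suc (suc k) (x ∷ xs) f ⟩
  ∑ (vectors (suc k) (x ∷ xs)) (f ∘ (x ∷_)) + ∑ xs (λ y → ∑ (vectors (suc k) (x ∷ xs)) (f ∘ (y ∷_)))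
    ≡⟨ cong₂ _+_ (∑-vectors-∷ k x xs (f ∘ (x ∷_)) (alt x))
        (∑-cong xs λ y → ∑-vectors-∷ k x xs (f ∘ (y ∷_)) (alt y)) ⟩
  X + suc k * ∑ (vectors k xs) (λ v → f (x ∷ x ∷ v)) +
  ∑ xs (λ y → ∑ (vectors (suc k) xs) (f ∘ (y ∷_)) + suc k * ∑ (vectors k xs) (λ v → f (y ∷ x ∷ v)))
    ≡⟨ cong₂ (λ a b → X + suc k * a + b)
         (trans (∑-cong (vectors k xs) (rep x)) (∑-zero (vectors k xs)))
         (trans (∑-+ xs _ _) (cong₂ _+_ (sym (∑-vectors-suc (suc k) xs f)) (trans (∑-*ˡ xs (suc k) _)
           (cong (suc k *_) (trans (∑-cong xs λ y → ∑-cong (vectors k xs) λ v → swap y x v)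
             (sym (∑-vectors-suc k xs (f ∘ (x ∷_))))))))) ⟩
  X + suc k * 0 + (∑ (vectors (suc (suc k)) xs) f + suc k * X)
    ≡⟨ lemma X (suc k) (∑ (vectors (suc (suc k)) xs) f) ⟩
  ∑ (vectors (suc (suc k)) xs) f + suc (suc k) * X ∎
  where
  open ≡-Reasoning
  X = ∑ (vectors (suc k) xs) (f ∘ (x ∷_))
  lemma : ∀ a m b → a + m * 0 + (b + m * a) ≡ b + (1 + m) * a
  lemma = ℕ-solve-∀

-- By `∑-vectors-∷` the sum over vectors obeys the recursion that defines `combinations`, except for
-- a factor `suc k` for the position of x; these factors multiply to the factorial.
∑-vectors≡!*∑-combinations : ∀ k (xs : List A) f → Alternating k f → ∑ (vectors k xs) f ≡ k ! * ∑
    (combinations k xs) f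
∑-vectors≡!*∑-combinations zero    xs       f _   = sym (ℕ.*-identityˡ _)
∑-vectors≡!*∑-combinations (suc k) []       f _   = sym (ℕ.*-zeroʳ (suc k !))
∑-vectors≡!*∑-combinations (suc k) (x ∷ xs) f alt = begin
  ∑ (vectors (suc k) (x ∷ xs)) f
    ≡⟨ ∑-vectors-∷ k x xs f alt ⟩
  ∑ (vectors (suc k) xs) f + suc k * ∑ (vectors k xs) (f ∘ (x ∷_))
    ≡⟨ cong₂ (λ a b → a + suc k * b) (∑-vectors≡!*∑-combinations (suc k) xs f alt)
         (∑-vectors≡!*∑-combinations k xs (f ∘ (x ∷_)) (Alternating-∷ k alt x)) ⟩
  suc k ! * ∑ (combinations (suc k) xs) f + suc k * (k ! * ∑ (combinations k xs) (f ∘ (x ∷_)))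
    ≡⟨ lemma (suc k) (k !) (∑ (combinations (suc k) xs) f) (∑ (combinations k xs) (f ∘ (x ∷_))) ⟩
  suc k ! * (∑ (combinations k xs) (f ∘ (x ∷_)) + ∑ (combinations (suc k) xs) f)
    ≡⟨ cong (suc k ! *_) (sym (trans (∑-++ (List.map (x ∷_) (combinations k xs)) _ f)
         (cong (_+ ∑ (combinations (suc k) xs) f) (∑-map (x ∷_) (combinations k xs) f)))) ⟩
  suc k ! * ∑ (combinations (suc k) (x ∷ xs)) f ∎
  where
  open ≡-Reasoning
  lemma : ∀ m r a b → m * r * a + m * (r * b) ≡ m * r * (b + a)
  lemma = ℕ-solve-∀

-- Decides whether the sets in B are nonempty and cover every i exactly once,
-- where earlier sets have covered i already e i times and were nonempty if b.
covers : Bool → (Fin n → ℕ) → Blocks n k → Bool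
covers b e []      = b ∧ does (Fin.all? λ i → e i ℕ.≟ 1)
covers b e (S ∷ B) = covers (b ∧ does (Subset.nonempty? S)) (λ i → e i + ⟦ Vec.lookup S i ⟧) B

covers-cong : ∀ {b c} {e f : Fin n → ℕ} → b ≡ c → (∀ i → e i ≡ f i) → (B : Blocks n k) →
    covers b e B ≡ covers c f B
covers-cong {b = b} {e = e} {f} refl h [] = cong (b ∧_) (does-⇔
    (mk⇔ (λ g i → trans (sym (h i)) (g i)) (λ g i → trans (h i) (g i)))
  (Fin.all? λ i → e i ℕ.≟ 1) (Fin.all? λ i → f i ℕ.≟ 1))
covers-cong refl h (S ∷ B) = covers-cong refl (λ i → cong (_+ ⟦ Vec.lookup S i ⟧) (h i)) B

covers-empty : ∀ {e} (B : Blocks n k) → covers false e B ≡ false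
covers-empty []      = refl
covers-empty (S ∷ B) = covers-empty B

covers-twice : ∀ {b e} i → 2 ≤ e i → (B : Blocks n k) → covers b e B ≡ false
covers-twice {b = b} {e} i 2≤ [] = trans (cong (b ∧_) (dec-false (Fin.all? λ i → e i ℕ.≟ 1) λ h →
    ℕ.<⇒≢ 2≤ (sym (h i)))) (Bool.∧-zeroʳ b)
covers-twice {b = b} {e} i 2≤ (S ∷ B) = covers-twice i (ℕ.≤-trans 2≤ (ℕ.m≤m+n (e i) _)) B

-- Exchanging two sets permutes a conjunction and a sum. A repeated set is either empty or covers
-- one of its elements twice, and both defects persist whatever sets follow.
covers-alternating : ∀ k b (e : Fin n → ℕ) → Alternating k (λ B → ⟦ covers b e B ⟧)
covers-alternating zero          b e = tt
covers-alternating (suc zero)    b e = tt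
covers-alternating (suc (suc k)) b e = swap , repeated , λ S → covers-alternating (suc k) _ _
  where
  swap : ∀ S T B → ⟦ covers b e (S ∷ T ∷ B) ⟧ ≡ ⟦ covers b e (T ∷ S ∷ B) ⟧
  swap S T B = cong ⟦_⟧ (covers-cong
    (trans (Bool.∧-assoc b _ _) (trans (cong (b ∧_) (Bool.∧-comm (does (Subset.nonempty? S)) _))
        (sym (Bool.∧-assoc b _ _))))
    (λ i → lemma (e i) ⟦ Vec.lookup S i ⟧ ⟦ Vec.lookup T i ⟧) B)
    where
    lemma : ∀ a b c → a + b + c ≡ a + c + b
    lemma = ℕ-solve-∀

  repeated : ∀ S B → ⟦ covers b e (S ∷ S ∷ B) ⟧ ≡ 0
  repeated S B with Subset.nonempty? S
  ... | no _ = cong ⟦_⟧ (trans (covers-cong (trans (cong (_∧ false) (Bool.∧-zeroʳ b)) refl)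
      (λ _ → refl) B) (covers-empty B))
  ... | yes (i , i∈) = cong ⟦_⟧ (covers-twice i twice B)
    where
    twice : 2 ≤ e i + ⟦ Vec.lookup S i ⟧ + ⟦ Vec.lookup S i ⟧
    twice rewrite Vec.[]=⇒lookup i∈ | ℕ.+-assoc (e i) 1 1 = ℕ.m≤n+m 2 (e i)

occurrences : Fin n → Blocks n k → ℕ
occurrences i []      = 0
occurrences i (S ∷ B) = ⟦ Vec.lookup S i ⟧ + occurrences i B

covers⇔ : ∀ b e (B : Blocks n k) →
  covers b e B ≡ true ⇔ (b ≡ true × (∀ m → Nonempty (Vec.lookup B m)) × (∀ i → e i + occurrences i B ≡ 1))
covers⇔ b e [] = mk⇔ (to b) from
  where
  to : ∀ b → b ∧ does (Fin.all? λ i → e i ℕ.≟ 1) ≡ true → b ≡ true × (∀ m → Nonempty (Vec.lookup [] m)) ×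
      (∀ i → e i + 0 ≡ 1)
  to true h = refl , (λ ()) , λ i → trans (ℕ.+-identityʳ (e i)) (from-does (Fin.all? λ i → e i ℕ.≟ 1) h i)

  from : _ → b ∧ does (Fin.all? λ i → e i ℕ.≟ 1) ≡ true
  from (refl , _ , g) = dec-true (Fin.all? λ i → e i ℕ.≟ 1) λ i → trans (sym (ℕ.+-identityʳ (e i))) (g i)
covers⇔ b e (S ∷ B) = mk⇔ (to b) from
  where
  IH : ∀ b → _
  IH b = covers⇔ (b ∧ does (Subset.nonempty? S)) (λ i → e i + ⟦ Vec.lookup S i ⟧) B

  to : ∀ b → covers b e (S ∷ B) ≡ true →
    b ≡ true × (∀ m → Nonempty (Vec.lookup (S ∷ B) m)) × (∀ i → e i + occurrences i (S ∷ B) ≡ 1)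
  to b h with Equivalence.to (IH b) h
  ... | b′ , ne , g with b | Subset.nonempty? S
  ...   | true | yes s = refl , (λ { zero → s ; (suc m) → ne m }) , λ i → trans (sym (ℕ.+-assoc (e i) _ _)) (g i)

  from : _ → covers b e (S ∷ B) ≡ true
  from (refl , ne , g) = Equivalence.from (IH true) (dec-true (Subset.nonempty? S) (ne zero) ,
      (λ m → ne (suc m)) , λ i → trans (ℕ.+-assoc (e i) _ _) (g i))

occurrences≡0 : ∀ i (B : Blocks n k) → occurrences i B ≡ 0 ⇔ (∀ m → ¬ _∈B_ B i m)
occurrences≡0 i B = mk⇔ (to B) (from B)
  where
  to : ∀ {k} (B : Blocks _ k) → occurrences i B ≡ 0 → ∀ m → ¬ _∈B_ B i m
  to (S ∷ B) h zero    i∈ rewrite Vec.[]=⇒lookup i∈ with () ← h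
  to (S ∷ B) h (suc m) i∈ = to B (ℕ.m+n≡0⇒n≡0 ⟦ Vec.lookup S i ⟧ h) m i∈

  from : ∀ {k} (B : Blocks _ k) → (∀ m → ¬ _∈B_ B i m) → occurrences i B ≡ 0
  from []      h = refl
  from (S ∷ B) h with Vec.lookup S i in e
  ... | true  = contradiction (Vec.lookup⇒[]= i S e) (h zero)
  ... | false = from B λ m → h (suc m)

occurrences≡1 : ∀ i (B : Blocks n k) → occurrences i B ≡ 1 ⇔ (∃ λ m → _∈B_ B i m × (∀ ℓ → _∈B_ B i ℓ → ℓ ≡ m))
occurrences≡1 i B = mk⇔ (to B) (from B)
  where
  to : ∀ {k} (B : Blocks _ k) → occurrences i B ≡ 1 → ∃ λ m → _∈B_ B i m × (∀ ℓ → _∈B_ B i ℓ → ℓ ≡ m)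
  to (S ∷ B) h with Vec.lookup S i in e
  ... | true = zero , Vec.lookup⇒[]= i S e , λ where
    zero    _  → refl
    (suc ℓ) i∈ → contradiction i∈ (Equivalence.to (occurrences≡0 i B) (ℕ.suc-injective h) ℓ)
  ... | false with to B h
  ...   | m , i∈ , u = suc m , i∈ , λ where
    zero    i∈S → contradiction (trans (sym (Vec.[]=⇒lookup i∈S)) e) true≢false
    (suc ℓ) i∈ℓ → cong suc (u ℓ i∈ℓ)

  from : ∀ {k} (B : Blocks _ k) → (∃ λ m → _∈B_ B i m × (∀ ℓ → _∈B_ B i ℓ → ℓ ≡ m)) → occurrences i B ≡ 1
  from (S ∷ B) (zero , i∈ , u) rewrite Vec.[]=⇒lookup i∈ = cong suc (Equivalence.from (occurrences≡0 i B) λ ℓ i∈ℓ → Fin.0≢1+n (sym (u (suc ℓ) i∈ℓ)))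
  from (S ∷ B) (suc m , i∈ , u) with Vec.lookup S i in e
  ... | true  = contradiction (u zero (Vec.lookup⇒[]= i S e)) Fin.0≢1+n
  ... | false = from B (m , i∈ , λ ℓ i∈ℓ → Fin.suc-injective (u (suc ℓ) i∈ℓ))

isPartition≡covers : ∀ (B : Blocks n k) → does (isPartition? B) ≡ covers true (λ _ → 0) B
isPartition≡covers B = trans (does-⇔ (mk⇔ to from) (isPartition? B)
    (covers true (λ _ → 0) B Bool.≟ true)) (does-≟-true (covers true (λ _ → 0) B))
  where
  does-≟-true : ∀ b → does (b Bool.≟ true) ≡ b
  does-≟-true true  = refl
  does-≟-true false = refl

  to : IsPartition B → covers true (λ _ → 0) B ≡ true
  to (ne , u) = Equivalence.from (covers⇔ true (λ _ → 0) B)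
      (refl , ne , λ i → Equivalence.from (occurrences≡1 i B) (u i))

  from : covers true (λ _ → 0) B ≡ true → IsPartition B
  from h with Equivalence.to (covers⇔ true (λ _ → 0) B) h
  ... | _ , ne , g = ne , λ i → Equivalence.to (occurrences≡1 i B) (g i)

length-OP≡!*Stir : ∀ n k → length (OP n k) ≡ k ! * Stir n k
length-OP≡!*Stir n k = begin
  length (OP n k)
    ≡⟨ count (vectors k (subsets n)) ⟩
  ∑ (vectors k (subsets n)) (λ B → ⟦ covers true (λ _ → 0) B ⟧)
    ≡⟨ ∑-vectors≡!*∑-combinations k (subsets n) _ (covers-alternating k true (λ _ → 0)) ⟩
  k ! * ∑ (combinations k (subsets n)) (λ B → ⟦ covers true (λ _ → 0) B ⟧)
    ≡⟨ cong (k ! *_) (sym (count (combinations k (subsets n)))) ⟩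
  k ! * Stir n k ∎
  where
  open ≡-Reasoning
  count : ∀ (Bs : List (Blocks n k)) → length (List.filter isPartition? Bs) ≡ ∑ Bs λ B → ⟦ covers true
      (λ _ → 0) B ⟧
  count Bs = trans (length-filter≡∑ isPartition? Bs) (∑-cong Bs λ B → cong ⟦_⟧ (isPartition≡covers B))

-- Comparison of the recursions

bracket₂-1-q : ∀ q t → bracket₂ 1 q t ≡ bracket q t
bracket₂-1-q q zero    = refl
bracket₂-1-q q (suc t) = cong₂ (λ a b → a + q * b) (ℕ.^-zeroˡ t) (bracket₂-1-q q t)

bracket₂-q-1 : ∀ q t → bracket₂ q 1 t ≡ bracket q t
bracket₂-q-1 q zero    = refl
bracket₂-q-1 q (suc t) = trans (cong (λ b → q ^ t + 1 * b) (bracket₂-q-1 q t))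
  (trans (lemma (q ^ t) (bracket q t)) (sym (bracket-suc q t)))
  where
  lemma : ∀ a b → a + 1 * b ≡ b + a
  lemma = ℕ-solve-∀

-- For r = 0 there are no high exponents, and the low ones lead to r = 1. Expanding that by
-- `basisSeries-split` gives the two summands of the word recursion.
surjectionSeries≡basisSeries : ∀ q n k → surjectionSeries 1 q n k ≡ basisSeries q n k 0
surjectionSeries≡basisSeries q zero    zero    = refl
surjectionSeries≡basisSeries q zero    (suc k) = refl
surjectionSeries≡basisSeries q (suc n) zero    = refl
surjectionSeries≡basisSeries q (suc n) (suc t) = begin
  bracket₂ 1 q (suc t) * (q ^ (n ∸ t) * surjectionSeries 1 q n t + surjectionSeries 1 q n (suc t))
    ≡⟨ cong₂ _*_ (bracket₂-1-q q (suc t)) (cong₂ (λ a b → q ^ (n ∸ t) * a + b)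
         (surjectionSeries≡basisSeries q n t) (surjectionSeries≡basisSeries q n (suc t))) ⟩
  bracket q (suc t) * (q ^ (n ∸ t) * basisSeries q n t 0 + basisSeries q n (suc t) 0)
    ≡⟨ cong (bracket q (suc t) *_) (trans (ℕ.+-comm _ (basisSeries q n (suc t) 0))
        (sym (basisSeries-split q n t 0))) ⟩
  bracket q (suc t) * basisSeries q n t 1
    ≡⟨ lemma (bracket q (suc t) * basisSeries q n t 1) (q ^ suc t) (basisSeries q n (suc t) 0) ⟩
  basisSeries q (suc n) (suc t) 0 ∎
  where
  open ≡-Reasoning
  lemma : ∀ a p b → a ≡ a + p * 0 * b
  lemma = ℕ-solve-∀

-- For y = 1 the power of y disappears and both summands get the factor [k]_q, as in the recursion
-- of `Stirq` multiplied by [k]!_q. The length is `suc n` because `Stirq` is anchored at 1.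
surjectionSeries≡Stirq : ∀ q n k → surjectionSeries q 1 (suc n) k ≡ evalq ([ k ]!q *q Stirq (suc n) k) q
surjectionSeries≡Stirq q n k = trans (go n k) (sym (evalq-*q [ k ]!q (Stirq (suc n) k) q))
  where
  go : ∀ n k → surjectionSeries q 1 (suc n) k ≡ evalq [ k ]!q q * evalq (Stirq (suc n) k) q
  step : ∀ n k → surjectionSeries q 1 (suc n) (suc k) ≡ bracket q (suc k) *
      (surjectionSeries q 1 n k + surjectionSeries q 1 n (suc k))
  step n k = cong₂ _*_ (bracket₂-q-1 q (suc k)) (cong (_+ surjectionSeries q 1 n (suc k))
    (trans (cong (_* surjectionSeries q 1 n k) (ℕ.^-zeroˡ (n ∸ k))) (ℕ.*-identityˡ _)))

  factorial : ∀ k → evalq [ suc k ]!q q ≡ bracket q (suc k) * evalq [ k ]!q q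
  factorial k = trans (evalq-*q [ suc k ]q [ k ]!q q) (cong (_* evalq [ k ]!q q) (evalq-[] (suc k) q))

  go zero    zero          = sym (ℕ.*-zeroʳ (1 + q * 0))
  go zero    (suc zero)    = trans (step 0 0) (sym (trans (cong (_* (1 + q * 0)) (factorial 0)) (lemma q)))
    where
    lemma : ∀ q → (1 + q * 0) * (1 + q * 0) * (1 + q * 0) ≡ (1 + q * 0) * (1 + 0)
    lemma = ℕ-solve-∀
  go zero    (suc (suc k)) = trans (step 0 (suc k)) (trans (ℕ.*-zeroʳ (bracket q (suc (suc k))))
      (sym (ℕ.*-zeroʳ (evalq [ suc (suc k) ]!q q))))
  go (suc n) zero          = sym (ℕ.*-zeroʳ (1 + q * 0))
  go (suc n) (suc k)       = begin
    surjectionSeries q 1 (suc (suc n)) (suc k)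
      ≡⟨ step (suc n) k ⟩
    bracket q (suc k) * (surjectionSeries q 1 (suc n) k + surjectionSeries q 1 (suc n) (suc k))
      ≡⟨ cong (bracket q (suc k) *_) (cong₂ _+_ (go n k)
          (trans (go n (suc k)) (cong (_* s′) (factorial k)))) ⟩
    bracket q (suc k) * (evalq [ k ]!q q * s + bracket q (suc k) * evalq [ k ]!q q * s′)
      ≡⟨ lemma (bracket q (suc k)) (evalq [ k ]!q q) s s′ ⟩
    bracket q (suc k) * evalq [ k ]!q q * (s + bracket q (suc k) * s′)
      ≡⟨ cong₂ _*_ (sym (factorial k)) (sym (trans (evalq-+q (Stirq (suc n) k) _ q)
           (cong (s +_) (trans (evalq-*q [ suc k ]q (Stirq (suc n) (suc k)) q)
               (cong (_* s′) (evalq-[] (suc k) q)))))) ⟩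
    evalq [ suc k ]!q q * evalq (Stirq (suc (suc n)) (suc k)) q ∎
    where
    open ≡-Reasoning
    s  = evalq (Stirq (suc n) k) q
    s′ = evalq (Stirq (suc n) (suc k)) q
    lemma : ∀ b f s s′ → b * (f * s + b * f * s′) ≡ b * f * (s + b * s′)
    lemma = ℕ-solve-∀

∑-coinv : ∀ q n k → ∑ (OP n k) (λ σ → q ^ coinv σ) ≡ ∑ (basisMonomials n k 0) (λ μ → q ^ deg μ)
∑-coinv q n k = trans (∑-OP 1 q n k _ λ v s → trans (cong (q ^_) (coinv-toBlocks v s))
    (sym (trans (cong (_* q ^ wordCoinv v) (ℕ.^-zeroˡ (wordInv v))) (ℕ.*-identityˡ _))))
  (trans (surjectionSeries≡basisSeries q n k) (sym (∑-basisMonomials q n k 0)))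

∑-inv : ∀ q n k → ∑ (OP (suc n) k) (λ σ → q ^ inv σ) ≡ evalq ([ k ]!q *q Stirq (suc n) k) q
∑-inv q n k = trans (∑-OP q 1 (suc n) k _ λ v s → trans (cong (q ^_) (inv-toBlocks v))
    (sym (trans (cong (q ^ wordInv v *_) (ℕ.^-zeroˡ (wordCoinv v))) (ℕ.*-identityʳ _))))
  (surjectionSeries≡Stirq q n k)

coinvSeries≈basis : ∀ n k → coinvSeries n k ≈q series deg (basisMonomials n k 0)
coinvSeries≈basis n k = evalq-injective (coinvSeries n k) (series deg (basisMonomials n k 0)) λ q →
  trans (evalq-series coinv (OP n k) q) (trans (∑-coinv q n k)
      (sym (evalq-series deg (basisMonomials n k 0) q)))

invSeries≈ : ∀ n k → series inv (OP (suc n) k) ≈q [ k ]!q *q Stirq (suc n) k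
invSeries≈ n k = evalq-injective (series inv (OP (suc n) k)) ([ k ]!q *q Stirq (suc n) k) λ q →
  trans (evalq-series inv (OP (suc n) k) q) (∑-inv q n k)

inv+coinv : ∀ {B : Blocks n k} → B ∈ OP n k → inv B + coinv B ≡ maxInv n k
inv+coinv {n} {k} B∈ with ∈.∈-map⁻ toBlocks (∈-resp-↭ (OP↭surjections n k) B∈)
... | v , v∈ , refl with proj₂ (∈.∈-filter⁻ (λ v → image v ≟ˢ ⊤) {xs = vectors n (List.allFin k)} v∈)
...   | s = trans (cong₂ _+_ (inv-toBlocks v) (coinv-toBlocks v s)) (trans (wordInv+wordCoinv v)
  (cong (maxInv n) (trans (cong ∣_∣ s) (Subset.∣⊤∣≡n k))))

-- Reversal of coefficients

∑-cong-∈ : ∀ (xs : List A) {f g} → (∀ {x} → x ∈ xs → f x ≡ g x) → ∑ xs f ≡ ∑ xs g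
∑-cong-∈ []       e = refl
∑-cong-∈ (x ∷ xs) e = cong₂ _+_ (e (here refl)) (∑-cong-∈ xs (e ∘ there))

coeffq-++ˡ : ∀ (f g : ℕ[q]) {i} → i < length f → coeffq (f ++ g) i ≡ coeffq f i
coeffq-++ˡ (a ∷ f) g {zero}  _         = refl
coeffq-++ˡ (a ∷ f) g {suc i} (s≤s i<f) = coeffq-++ˡ f g i<f

coeffq-++-length : ∀ (f : ℕ[q]) a → coeffq (f ++ a ∷ []) (length f) ≡ a
coeffq-++-length []      a = refl
coeffq-++-length (b ∷ f) a = coeffq-++-length f a

coeffq-≥ : ∀ (f : ℕ[q]) {i} → length f ≤ i → coeffq f i ≡ 0
coeffq-≥ []      _         = refl
coeffq-≥ (a ∷ f) (s≤s f≤i) = coeffq-≥ f f≤i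

coeffq-reverse : ∀ (f : ℕ[q]) {i j} → i + suc j ≡ length f → coeffq (List.reverse f) i ≡ coeffq f j
coeffq-reverse [] {i} {j} e with () ← trans (sym (ℕ.+-suc i j)) e
coeffq-reverse (a ∷ f) {i} {zero} e = trans (cong₂ coeffq (List.unfold-reverse a f)
    (trans (ℕ.suc-injective (trans (ℕ.+-comm 1 i) e)) (sym (List.length-reverse f))))
  (coeffq-++-length (List.reverse f) a)
coeffq-reverse (a ∷ f) {i} {suc j} e = trans (cong (λ g → coeffq g i) (List.unfold-reverse a f))
  (trans (coeffq-++ˡ (List.reverse f) (a ∷ []) (subst (i <_) (trans e′ (sym (List.length-reverse f)))
      (ℕ.m<m+n i (s≤s z≤n))))
         (coeffq-reverse f e′))
  where
  e′ : i + suc j ≡ length f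
  e′ = ℕ.suc-injective (trans (sym (ℕ.+-suc i (suc j))) e)

dropWhile-zeros : ∀ {zs : ℕ[q]} → All (_≡ 0) zs → ∀ {a} → a ≢ 0 → ∀ f → List.dropWhile (ℕ._≟ 0)
    (zs ++ a ∷ f) ≡ a ∷ f
dropWhile-zeros {[]}     []          {zero}  a≢0 f = contradiction refl a≢0
dropWhile-zeros {[]}     []          {suc a} a≢0 f = refl
dropWhile-zeros {.0 ∷ _} (refl ∷ zs) a≢0 f = dropWhile-zeros zs a≢0 f

-- A list may carry zeros beyond the degree, and reversal moves them to the front, where `revq`
-- drops them. Splitting at D isolates exactly these zeros.
split-degree : ∀ D (f : ℕ[q]) → coeffq f D ≢ 0 → (∀ {e} → D < e → coeffq f e ≡ 0) →
  ∃ λ g → ∃ λ a → ∃ λ zs → f ≡ (g ++ a ∷ []) ++ zs × length g ≡ D × a ≢ 0 × All (_≡ 0) zs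
split-degree D       []      ne _ = contradiction refl ne
split-degree zero    (a ∷ f) ne h = [] , a , f , refl , refl , ne , zeros f (λ e → h (s≤s z≤n))
  where
  zeros : ∀ f → (∀ e → coeffq f e ≡ 0) → All (_≡ 0) f
  zeros []      h = []
  zeros (b ∷ f) h = h 0 ∷ zeros f (h ∘ suc)
split-degree (suc D) (b ∷ f) ne h with split-degree D f ne (λ lt → h (s≤s lt))
... | g , a , zs , refl , len , a≢0 , all0 = b ∷ g , a , zs , refl , cong suc len , a≢0 , all0

revq-split : ∀ g {a} zs → a ≢ 0 → All (_≡ 0) zs → revq ((g ++ a ∷ []) ++ zs) ≡ List.reverse (g ++ a ∷ [])
revq-split g {a} zs a≢0 all0 = trans (cong (List.dropWhile (ℕ._≟ 0)) (trans (List.reverse-++ (g ++ a ∷ []) zs)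
    (cong (List.reverse zs ++_) (List.reverse-++ g (a ∷ [])))))
  (trans (dropWhile-zeros (All-resp-↭ (↭-sym (↭-reverse zs)) all0) a≢0 (List.reverse g))
      (sym (List.reverse-++ g (a ∷ []))))

module _ (D : ℕ) (f : ℕ[q]) (ne : coeffq f D ≢ 0) (beyond : ∀ {e} → D < e → coeffq f e ≡ 0) where

  coeffq-revq-≤ : ∀ {d} → d ≤ D → coeffq (revq f) d ≡ coeffq f (D ∸ d)
  coeffq-revq-≤ {d} d≤D with split-degree D f ne beyond
  ... | g , a , zs , refl , len , a≢0 , all0 = trans (cong (λ h → coeffq h d) (revq-split g zs a≢0 all0))
    (trans (coeffq-reverse (g ++ a ∷ []) (trans (ℕ.+-suc d (D ∸ d))
        (trans (cong suc (ℕ.m+[n∸m]≡n d≤D)) (sym length≡))))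
    (sym (coeffq-++ˡ (g ++ a ∷ []) zs (subst (D ∸ d <_) (sym length≡) (s≤s (ℕ.m∸n≤m D d))))))
    where
    length≡ : length (g ++ a ∷ []) ≡ suc D
    length≡ = trans (List.length-++ g) (trans (ℕ.+-comm (length g) 1) (cong suc len))

  coeffq-revq-> : ∀ {d} → D < d → coeffq (revq f) d ≡ 0
  coeffq-revq-> {d} D<d with split-degree D f ne beyond
  ... | g , a , zs , refl , len , a≢0 , all0 = trans (cong (λ h → coeffq h d) (revq-split g zs a≢0 all0))
    (coeffq-≥ (List.reverse (g ++ a ∷ [])) (subst (_≤ d) (sym (trans (List.length-reverse (g ++ a ∷ []))
      (trans (List.length-++ g) (trans (ℕ.+-comm (length g) 1) (cong suc len))))) D<d))

𝟘∈B : ∀ {k} → 1 ≤ k → ∀ n s → s ≤ n → InB k s (𝟘 {n})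
𝟘∈B 1≤k zero    zero    _         = []
𝟘∈B 1≤k (suc n) zero    _         = high z≤n 1≤k (𝟘∈B 1≤k n zero z≤n)
𝟘∈B 1≤k (suc n) (suc s) (s≤s s≤n) = low z≤n (𝟘∈B 1≤k n s s≤n)

-- The value 0 of coinv is attained since 1 is a basis monomial.
coinvSeries-0 : ∀ n k → 1 ≤ k → k ≤ n → coeffq (coinvSeries n k) 0 ≢ 0
coinvSeries-0 n k 1≤k k≤n e = ℕ.<⇒≢ (positive (Equivalence.from
    (∈-basisMonomials n k 0 (ℕ.+-identityʳ k)) (𝟘∈B 1≤k n k k≤n)))
  (sym (trans (sym (coeffq-series deg (basisMonomials n k 0) 0)) (trans (sym (coinvSeries≈basis n k 0)) e)))
  where
  positive : ∀ {μs : List (Monomial n)} → 𝟘 ∈ μs → 0 < ∑ μs λ μ → ⟦ does (deg μ ℕ.≟ 0) ⟧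
  positive (here refl) rewrite dec-true (deg (𝟘 {n}) ℕ.≟ 0) (deg-𝟘 n) = s≤s z≤n
  positive (there 𝟘∈) = ℕ.<-≤-trans (positive 𝟘∈) (ℕ.m≤n+m _ _)

-- Since inv + coinv is the constant D, coefficient d of one series is coefficient D - d of the
-- other. The reversal takes place at D because coinv attains 0, so the coefficient of q^D is not 0.
coinvSeries≈revq : ∀ n k → 1 ≤ k → k ≤ n → coinvSeries n k ≈q revq ([ k ]!q *q Stirq n k)
coinvSeries≈revq zero    zero    () _
coinvSeries≈revq (suc n) k 1≤k k≤n d = by-cases (d ℕ.≤? D)
  where
  open ≡-Reasoning
  f = [ k ]!q *q Stirq (suc n) k
  D = maxInv (suc n) k

  coeff-f : ∀ e → coeffq f e ≡ ∑ (OP (suc n) k) λ σ → ⟦ does (inv σ ℕ.≟ e) ⟧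
  coeff-f e = trans (sym (invSeries≈ n k e)) (coeffq-series inv (OP (suc n) k) e)

  reversed : ∀ {d} → d ≤ D → coeffq f (D ∸ d) ≡ coeffq (coinvSeries (suc n) k) d
  reversed {d} d≤D = trans (coeff-f (D ∸ d)) (trans (∑-cong-∈ (OP (suc n) k) λ {σ} σ∈ → cong ⟦_⟧
      (does-⇔ (mk⇔ (to {σ} σ∈) (from {σ} σ∈)) (inv σ ℕ.≟ D ∸ d) (coinv σ ℕ.≟ d)))
    (sym (coeffq-series coinv (OP (suc n) k) d)))
    where
    to : ∀ {σ} → σ ∈ OP (suc n) k → inv σ ≡ D ∸ d → coinv σ ≡ d
    to {σ} σ∈ e = ℕ.+-cancelˡ-≡ (inv σ) _ _ (trans (inv+coinv {B = σ} σ∈)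
        (sym (trans (cong (_+ d) e) (ℕ.m∸n+n≡m d≤D))))

    from : ∀ {σ} → σ ∈ OP (suc n) k → coinv σ ≡ d → inv σ ≡ D ∸ d
    from {σ} σ∈ e = ℕ.+-cancelʳ-≡ d _ _ (trans (cong (inv σ +_) (sym e))
        (trans (inv+coinv {B = σ} σ∈) (sym (ℕ.m∸n+n≡m d≤D))))

  zero-series : ∀ (g : Blocks (suc n) k → ℕ) {e} → (∀ {σ} → σ ∈ OP (suc n) k → g σ ≢ e) →
    ∑ (OP (suc n) k) (λ σ → ⟦ does (g σ ℕ.≟ e) ⟧) ≡ 0
  zero-series g {e} ne = trans (∑-cong-∈ (OP (suc n) k) λ {σ} σ∈ → cong ⟦_⟧ (dec-false (g σ ℕ.≟ e) (ne σ∈))) (∑-zero (OP (suc n) k))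

  beyond : ∀ {e} → D < e → coeffq f e ≡ 0
  beyond {e} D<e = trans (coeff-f e) (zero-series inv λ {σ} σ∈ e′ →
    ℕ.<⇒≱ D<e (subst₂ _≤_ e′ (inv+coinv {B = σ} σ∈) (ℕ.m≤m+n (inv σ) (coinv σ))))

  top : coeffq f D ≢ 0
  top e = coinvSeries-0 (suc n) k 1≤k k≤n (trans (sym (reversed z≤n)) e)

  by-cases : Dec (d ≤ D) → coeffq (coinvSeries (suc n) k) d ≡ coeffq (revq f) d
  by-cases (yes d≤D) = trans (sym (reversed d≤D)) (sym (coeffq-revq-≤ D f top beyond d≤D))
  by-cases (no  d≰D) = trans (trans (coeffq-series coinv (OP (suc n) k) d) (zero-series coinv λ {σ} σ∈ e →
      d≰D (subst₂ _≤_ e (inv+coinv {B = σ} σ∈) (ℕ.m≤n+m (coinv σ) (inv σ)))))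
    (sym (coeffq-revq-> D f top beyond (ℕ.≰⇒> d≰D)))

theorem4p10 : (n k : ℕ) → 1 ≤ k → k ≤ n →
    IsHilbertSeries (R n k) (R-component n k) (coinvSeries n k)
    × coinvSeries n k ≈q revq ([ k ]!q *q Stirq n k)
    × HasDimension (R n k) U (length (OP n k))
    × length (OP n k) ≡ k ! * Stir n k
theorem4p10 n k 1≤k k≤n =
  (λ d → subst (HasDimension (R n k) (R-component n k d)) (sym (graded d))
      (component-dimension k≤n L L-unique L⇔B d)) ,
  coinvSeries≈revq n k 1≤k k≤n ,
  subst (HasDimension (R n k) U) (sym total) (total-dimension k≤n L L-unique L⇔B) ,
  length-OP≡!*Stir n k
  where
  L = basisMonomials n k 0
  L-unique = basisMonomials-unique n k 0

  L⇔B : ∀ {μ} → μ ∈ L ⇔ InB k k μ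
  L⇔B = ∈-basisMonomials n k 0 (ℕ.+-identityʳ k)

  graded : ∀ d → coeffq (coinvSeries n k) d ≡ length (List.filter (λ μ → deg μ ℕ.≟ d) L)
  graded d = trans (coinvSeries≈basis n k d) (trans (coeffq-series deg L d)
      (sym (length-filter≡∑ (λ μ → deg μ ℕ.≟ d) L)))

  total : length (OP n k) ≡ length L
  -- At q = 1 both generating functions count their lists.
  total = trans (sym (∑-1^ (OP n k) coinv)) (trans (∑-coinv 1 n k) (∑-1^ L deg))
    where
    ∑-1^ : ∀ {A : Set} (xs : List A) (f : A → ℕ) → ∑ xs (λ x → 1 ^ f x) ≡ length xs
    ∑-1^ xs f = trans (∑-cong xs λ x → ℕ.^-zeroˡ (f x)) (∑-1 xs)
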